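{- Let $G$ be a signed eulerian graph and let $\Phi(G)$ denote its flow number. Then: (a) $G$ has no nowhere-zero integer flow if and only if $G$ is unbalanced and $G-e$ is balanced for some edge $e$; (b) $\Phi(G)=2$ if and only if $G$ has an even number of negative edges; (c) $\Phi(G)=3$ if and only if $G$ can be decomposed into three edge-disjoint eulerian subgraphs, each with an odd number of negative edges, that share a common vertex; (d) $\Phi(G)=4$ in all remaining cases (i.e. whenever $G$ has a nowhere-zero integer flow and neither (b) nor (c) applies).
   Context: Graphs are finite and may have loops and multiple edges. A signed graph is a graph $G$ with a signature $\sigma:E(G)\to\{+1,-1\}$; edges with sign $-1$ are negative, others positive. The sign of a set of edges or subgraph is the product of the signs of its edges. A circuit is a connected 2-regular graph; it is balanced if its sign is $+1$ and unbalanced otherwise. A signed graph is balanced if it contains no unbalanced circuit. A graph is eulerian if it is connected and every vertex has even valency. Each edge consists of two half-edges, one at each end. An orientation of a signed graph directs each half-edge toward or away from its end-vertex so that for each positive edge exactly one half-edge points toward its end, while for each negative edge either both half-edges point away from their ends (extroverted) or both point toward them (introverted). For an abelian group $A$, an $A$-flow is a map $\xi:E(G)\to A$ such that at every vertex $v$ the sum of $\xi(e)$ over half-edges at $v$ directed out of $v$ minus the sum of $\xi(e)$ over half-edges at $v$ directed into $v$ equals $0$ (a loop contributes through both of its half-edges). Reversing both half-edges of an edge and negating its value preserves flows, so existence of flows does not depend on the chosen orientation. A flow is nowhere-zero if no edge gets value $0$. A nowhere-zero $k$-flow is a $\mathbb{Z}$-flow with values in $\{\pm1,\dots,\pm(k-1)\}$.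 The flow number $\Phi(G)$ is the least $k$ such that $G$ has a nowhere-zero $k$-flow. -}

module Defs where

open import Data.Nat using (ℕ; zero; suc; _+_; _*_; _<_)
open import Data.Nat.Divisibility using (_∣_)
open import Data.Integer as ℤ using (ℤ; ∣_∣; -_)
open import Data.Bool using (Bool; true; false; if_then_else_; _xor_)
open import Data.Fin using (Fin; zero; suc; punchIn; _≟_)
open import Data.Product using (Σ; ∃; ∃-syntax; _×_; _,_)
open import Data.Sum using (_⊎_)
open import Relation.Nullary using (¬_; does)
open import Relation.Binary.PropositionalEquality using (_≡_; _≢_)
open import Relation.Binary.Construct.Closure.ReflexiveTransitive using (Star)

-- Signed graphs (loops and multiple edges allowed).
-- A signed graph with n vertices and m edges: each edge e has two
-- half-edges h ∈ Fin 2, the half-edge h of e is at vertex  end e h .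
-- negative e ≡ true  iff  σ(e) = -1.

record SignedGraph (n m : ℕ) : Set where
  field
    end      : Fin m → Fin 2 → Fin n
    negative : Fin m → Bool
open SignedGraph public

EdgeSet : ℕ → Set
EdgeSet m = Fin m → Bool

allEdges : ∀ {m} → EdgeSet m
allEdges _ = true

sumℕ : ∀ m → (Fin m → ℕ) → ℕ
sumℕ zero    f = 0
sumℕ (suc m) f = f zero + sumℕ m (λ i → f (suc i))

sumℤ : ∀ m → (Fin m → ℤ) → ℤ
sumℤ zero    f = ℤ.0ℤ
sumℤ (suc m) f = f zero ℤ.+ sumℤ m (λ i → f (suc i))

ind : Bool → ℕ
ind true  = 1
ind false = 0

Even : ℕ → Set
Even k = 2 ∣ k

Odd : ℕ → Set
Odd k = ¬ (2 ∣ k)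

module _ {n m : ℕ} (G : SignedGraph n m) where

  -- number of half-edges of edge e at vertex v (2 for a loop at v)
  halfEdgesAt : Fin n → Fin m → ℕ
  halfEdgesAt v e = ind (does (end G e zero ≟ v)) + ind (does (end G e (suc zero) ≟ v))

  valency : EdgeSet m → Fin n → ℕ
  valency S v = sumℕ m (λ e → ind (S e) * halfEdgesAt v e)

  -- number of negative edges in S  (sign of S is +1 iff this is even)
  negCount : EdgeSet m → ℕ
  negCount S = sumℕ m (λ e → ind (S e) * ind (negative G e))

  Adj : EdgeSet m → Fin n → Fin n → Set
  Adj S u v = Σ (Fin m) λ e → S e ≡ true ×
                ((end G e zero ≡ u × end G e (suc zero) ≡ v) ⊎
                 (end G e zero ≡ v × end G e (suc zero) ≡ u))

  Walk : EdgeSet m → Fin n → Fin n → Set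
  Walk S = Star (Adj S)

  -- v is a vertex of the (edge-induced) subgraph with edge set S
  Touches : EdgeSet m → Fin n → Set
  Touches S v = Σ (Fin m) λ e → S e ≡ true × Σ (Fin 2) λ h → end G e h ≡ v

  NonEmpty : EdgeSet m → Set
  NonEmpty S = Σ (Fin m) λ e → S e ≡ true

  ConnectedOn : EdgeSet m → Set
  ConnectedOn S = ∀ u v → Touches S u → Touches S v → Walk S u v

  Circuit : EdgeSet m → Set
  Circuit S = NonEmpty S × ConnectedOn S ×
              (∀ v → Touches S v → valency S v ≡ 2)

  Balanced : Set
  Balanced = ∀ S → Circuit S → Even (negCount S)

  Eulerian : Set
  Eulerian = (∀ u v → Walk allEdges u v) × (∀ v → Even (valency allEdges v))

  EulerianSub : EdgeSet m → Set
  EulerianSub S = NonEmpty S × ConnectedOn S × (∀ v → Even (valency S v))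

  -- orientation: inward e h ≡ true iff half-edge h of e points toward its end
  Orientation : Set
  Orientation = Fin m → Fin 2 → Bool

  ValidOrientation : Orientation → Set
  ValidOrientation τ = ∀ e → (negative G e ≡ false → (τ e zero xor τ e (suc zero)) ≡ true)
                           × (negative G e ≡ true  → τ e zero ≡ τ e (suc zero))

  netOut : Orientation → (Fin m → ℤ) → Fin n → ℤ
  netOut τ ξ v = sumℤ m (λ e → contrib e zero ℤ.+ contrib e (suc zero))
    where
    contrib : Fin m → Fin 2 → ℤ
    contrib e h = if does (end G e h ≟ v)
                  then (if τ e h then - ξ e else ξ e)
                  else ℤ.0ℤ

  IsFlow : Orientation → (Fin m → ℤ) → Set
  IsFlow τ ξ = ∀ v → netOut τ ξ v ≡ ℤ.0ℤ

  NowhereZero : (Fin m → ℤ) → Set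
  NowhereZero ξ = ∀ e → ξ e ≢ ℤ.0ℤ

  HasNZIntFlow : Set
  HasNZIntFlow = Σ Orientation λ τ → ValidOrientation τ ×
                 Σ (Fin m → ℤ) λ ξ → IsFlow τ ξ × NowhereZero ξ

  HasNZkFlow : ℕ → Set
  HasNZkFlow k = Σ Orientation λ τ → ValidOrientation τ ×
                 Σ (Fin m → ℤ) λ ξ → IsFlow τ ξ × NowhereZero ξ × (∀ e → ∣ ξ e ∣ < k)

  FlowNumberIs : ℕ → Set
  FlowNumberIs k = HasNZkFlow k × (∀ j → j < k → ¬ HasNZkFlow j)

  part : (Fin m → Fin 3) → Fin 3 → EdgeSet m
  part c i e = does (c e ≟ i)

  ThreeOddEulerianDecomposition : Set
  ThreeOddEulerianDecomposition =
    Σ (Fin m → Fin 3) λ c →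
      (∀ i → EulerianSub (part c i) × Odd (negCount (part c i))) ×
      Σ (Fin n) λ v → ∀ i → Touches (part c i) v

deleteEdge : ∀ {n m} → SignedGraph n (suc m) → Fin (suc m) → SignedGraph n m
deleteEdge G e = record { end = λ f → end G (punchIn e f) ; negative = λ f → negative G (punchIn e f) }

{-# OPTIONS --safe #-}

-- Along an Euler tour a flow is a sequence of integers whose jumps, placed at the visited vertices with
-- the sign accumulated so far, cancel at every vertex.  If the number of negative edges is even, a
-- constant sequence is a 2-flow.  If it is odd, sequences are antiperiodic on the universal cover of the
-- tour, and a balanced arc (between two visits of one vertex with the same sign) supports a {0,1}-flow.
-- The deletion of an edge in no balanced arc leaves a potential; it does not extend to the edge, whose
-- flow value is then forced to be 0.  If every edge is in a balanced arc, a greedy chain of such arcs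
-- covers the tour with overlaps of neighbours only, and the coefficients 1, 2, 1, 2, … give a 4-flow.
--
-- A 3-flow reduced modulo 3 is a ±1-labelling.  Cut the tour at its defects, the visits entered and left
-- with equal labels: at each vertex their signed number is a multiple of 3.  Two opposite defects at a
-- vertex disappear on reversing the tour between them.  If there are none and more than three defects,
-- a Chevalley–Warning argument over 𝔽₃ (as in the Alon–Friedland–Kalai theorem) provides a nonempty
-- proper set of arcs whose flipping preserves divisibility by 3 and removes defects.  Finally three
-- defects remain, at one vertex, and they cut the tour into the three odd closed trails.

module Submission where

open import Defs
open import Data.Bool using (Bool; true; false; if_then_else_; _∧_; _∨_; _xor_; not) renaming (_≟_ to _≟ᵇ_)
import Data.Bool.Properties as Bool
open import Data.Empty using (⊥; ⊥-elim)
open import Data.Fin using (Fin; zero; suc; punchIn; punchOut; _≟_)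
open import Data.Fin.Properties using (any?; all?; ¬∀⟶∃¬; punchIn-punchOut; punchInᵢ≢i)
open import Data.Integer as ℤ using (ℤ; ∣_∣; -_; 0ℤ; 1ℤ)
import Data.Integer.DivMod as ℤD
import Data.Integer.Divisibility.Signed as ∣ℤ
open ∣ℤ using () renaming (_∣_ to _∣ℤ_)
import Data.Integer.Properties as ℤ
import Data.Integer.Tactic.RingSolver as ℤS
open import Data.List using (List; []; _∷_; _++_; length)
import Data.List.Properties as List
open import Data.List.Membership.Propositional using (_∈_; _∉_; find; lose)
open import Data.List.Membership.Propositional.Properties using (∈-∃++; ∈-++⁺ˡ; ∈-++⁺ʳ; ∈-++⁻)
open import Data.List.Relation.Unary.Any using (here; there)
import Data.List.Relation.Unary.Any as Any
open import Data.Nat using (ℕ; zero; suc; _+_; _*_; _∸_; _≤_; _<_; z≤n; s≤s; _%_; _/_)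
open import Data.Nat.Divisibility using (_∣_; divides)
import Data.Nat.DivMod as DM
import Data.Nat.Properties as ℕ
import Data.Nat.Tactic.RingSolver as ℕS
open import Data.Product using (Σ; ∃; _×_; _,_; proj₁; proj₂)
open import Data.Product.Properties using (≡-dec)
open import Data.Sum using (_⊎_; inj₁; inj₂)
open import Data.Unit using (⊤; tt)
open import Data.Vec using (Vec; []; _∷_; replicate)
import Data.Vec.Properties as Vec
open import Function using (_∘_; case_of_)
open import Function.Bundles using (_⇔_; mk⇔)
open import Relation.Binary.Construct.Closure.ReflexiveTransitive using (ε; _◅_; _◅◅_; reverse; gmap)
open import Relation.Binary.Definitions using (tri<; tri≈; tri>)
open import Relation.Binary.PropositionalEquality
open import Relation.Nullary using (¬_; Dec; yes; no; does)
open import Relation.Nullary.Decidable using (¬?; _×-dec_)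
import Algebra.Properties.CommutativeSemigroup as CS

-- Balance speaks of circuits, whereas the flow arguments need a potential, that is, a switching of
-- vertices that makes all edges positive. The passage is constructive: edge by edge, either a
-- potential or an unbalanced circuit is built. For the 4-flow one period of the cover has to be
-- covered, and the last arc may run beyond it. There it meets the first arc again, with reversed
-- sign. It must not meet the second arc as well, where the coefficients could add up to 4 or more.
-- The choice of a furthest first arc bounds the overrun; if the second arc is still reached, the
-- first one is dropped. Three defects are the threshold of the polynomial argument. Without
-- opposite defects, each of the D vertices with defects has at least three of them, so the number N
-- of defects, which is also the number of arcs, is at least 3D. One arc stays fixed, because
-- flipping all arcs removes no defect. The product has degree 2D, and for such N and D the
-- inequality 2D < N - 1 holds exactly when N > 3. A trail of odd sign has an odd number of defects,
-- so the reduction cannot remove all of them.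

module ℕ+ = CS ℕ.+-commutativeSemigroup
module ℤ+ = CS ℤ.+-commutativeSemigroup

-- Parity of natural numbers

odd? : ℕ → Bool
odd? zero    = false
odd? (suc k) = not (odd? k)

odd?-+ : ∀ a b → odd? (a + b) ≡ odd? a xor odd? b
odd?-+ zero    b = refl
odd?-+ (suc a) b = trans (cong not (odd?-+ a b)) (Bool.not-distribˡ-xor (odd? a) (odd? b))

odd?-double : ∀ a → odd? (a + a) ≡ false
odd?-double a = trans (odd?-+ a a) (Bool.xor-same (odd? a))

odd?-*2 : ∀ q → odd? (q * 2) ≡ false
odd?-*2 zero    = refl
odd?-*2 (suc q) = trans (Bool.not-involutive _) (odd?-*2 q)

even⇒odd?≡false : ∀ {k} → Even k → odd? k ≡ false
even⇒odd?≡false (divides q refl) = odd?-*2 q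

odd?≡false⇒even : ∀ k → odd? k ≡ false → Even k
odd?≡false⇒even zero          _  = divides 0 refl
odd?≡false⇒even (suc (suc k)) eq with odd?≡false⇒even k (trans (sym (Bool.not-involutive _)) eq)
... | divides q refl = divides (suc q) refl

odd?≡true⇒odd : ∀ {k} → odd? k ≡ true → Odd k
odd?≡true⇒odd eq 2∣k with () ← trans (sym eq) (even⇒odd?≡false 2∣k)

odd⇒odd?≡true : ∀ {k} → Odd k → odd? k ≡ true
odd⇒odd?≡true {k} ok with odd? k in eq
... | true  = refl
... | false = ⊥-elim (ok (odd?≡false⇒even k eq))

odd?-ind : ∀ b → odd? (ind b) ≡ b
odd?-ind true  = refl
odd?-ind false = refl

-- Sums over Fin

sumℕ-cong : ∀ m {f g : Fin m → ℕ} → (∀ i → f i ≡ g i) → sumℕ m f ≡ sumℕ m g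
sumℕ-cong zero    eq = refl
sumℕ-cong (suc m) eq = cong₂ _+_ (eq zero) (sumℕ-cong m (λ i → eq (suc i)))

sumℕ-0 : ∀ m → sumℕ m (λ _ → 0) ≡ 0
sumℕ-0 zero    = refl
sumℕ-0 (suc m) = sumℕ-0 m

sumℕ-+ : ∀ m (f g : Fin m → ℕ) → sumℕ m (λ i → f i + g i) ≡ sumℕ m f + sumℕ m g
sumℕ-+ zero    f g = refl
sumℕ-+ (suc m) f g =
  trans (cong (f zero + g zero +_) (sumℕ-+ m (λ i → f (suc i)) (λ i → g (suc i))))
        (ℕ+.interchange (f zero) (g zero) _ _)

sumℕ-*ˡ : ∀ m a (f : Fin m → ℕ) → sumℕ m (λ i → a * f i) ≡ a * sumℕ m f
sumℕ-*ˡ zero    a f = sym (ℕ.*-zeroʳ a)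
sumℕ-*ˡ (suc m) a f =
  trans (cong (a * f zero +_) (sumℕ-*ˡ m a (λ i → f (suc i)))) (sym (ℕ.*-distribˡ-+ a (f zero) _))

sumℕ-swap : ∀ n m (F : Fin n → Fin m → ℕ) →
            sumℕ n (λ v → sumℕ m (F v)) ≡ sumℕ m (λ e → sumℕ n (λ v → F v e))
sumℕ-swap zero    m F = sym (sumℕ-0 m)
sumℕ-swap (suc n) m F =
  trans (cong (sumℕ m (F zero) +_) (sumℕ-swap n m (λ v → F (suc v))))
        (sym (sumℕ-+ m (F zero) _))

sumℕ-δ : ∀ {m} (i : Fin m) (f : Fin m → ℕ) →
         sumℕ m (λ j → ind (does (i ≟ j)) * f j) ≡ f i
sumℕ-δ {suc m} zero    f = trans (cong₂ _+_ (ℕ.+-identityʳ (f zero)) (sumℕ-0 m)) (ℕ.+-identityʳ (f zero))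
sumℕ-δ {suc m} (suc i) f = sumℕ-δ i (λ j → f (suc j))

sumℕ-mono : ∀ m {f g : Fin m → ℕ} → (∀ i → f i ≤ g i) → sumℕ m f ≤ sumℕ m g
sumℕ-mono zero    f≤g = z≤n
sumℕ-mono (suc m) f≤g = ℕ.+-mono-≤ (f≤g zero) (sumℕ-mono m (λ i → f≤g (suc i)))

term≤sumℕ : ∀ {m} (f : Fin m → ℕ) i → f i ≤ sumℕ m f
term≤sumℕ f zero    = ℕ.m≤m+n _ _
term≤sumℕ f (suc i) = ℕ.≤-trans (term≤sumℕ (λ j → f (suc j)) i) (ℕ.m≤n+m _ _)

odd?-sumℕ-cong : ∀ m {f g : Fin m → ℕ} → (∀ i → odd? (f i) ≡ odd? (g i)) →
                 odd? (sumℕ m f) ≡ odd? (sumℕ m g)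
odd?-sumℕ-cong zero    eq = refl
odd?-sumℕ-cong (suc m) {f} {g} eq =
  trans (odd?-+ (f zero) _)
    (trans (cong₂ _xor_ (eq zero) (odd?-sumℕ-cong m (λ i → eq (suc i)))) (sym (odd?-+ (g zero) _)))

odd?-sumℕ-false : ∀ m {f : Fin m → ℕ} → (∀ i → odd? (f i) ≡ false) → odd? (sumℕ m f) ≡ false
odd?-sumℕ-false m eq = trans (odd?-sumℕ-cong m {g = λ _ → 0} eq) (cong odd? (sumℕ-0 m))

sumℕ-odd-term : ∀ m (f : Fin m → ℕ) → odd? (sumℕ m f) ≡ true → Σ (Fin m) λ i → odd? (f i) ≡ true
sumℕ-odd-term (suc m) f eq with odd? (f zero) in eq₀
... | true  = zero , eq₀
... | false with i , oi ← sumℕ-odd-term m (λ j → f (suc j))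
                            (trans (sym (trans (odd?-+ (f zero) _) (cong (_xor odd? (sumℕ m (λ j → f (suc j)))) eq₀))) eq) = suc i , oi

sumℤ-cong : ∀ m {f g : Fin m → ℤ} → (∀ i → f i ≡ g i) → sumℤ m f ≡ sumℤ m g
sumℤ-cong zero    eq = refl
sumℤ-cong (suc m) eq = cong₂ ℤ._+_ (eq zero) (sumℤ-cong m (λ i → eq (suc i)))

sumℤ-0 : ∀ m → sumℤ m (λ _ → 0ℤ) ≡ 0ℤ
sumℤ-0 zero    = refl
sumℤ-0 (suc m) = trans (ℤ.+-identityˡ _) (sumℤ-0 m)

sumℤ-+ : ∀ m (f g : Fin m → ℤ) → sumℤ m (λ i → f i ℤ.+ g i) ≡ sumℤ m f ℤ.+ sumℤ m g
sumℤ-+ zero    f g = refl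
sumℤ-+ (suc m) f g =
  trans (cong₂ ℤ._+_ (refl {x = (f zero ℤ.+ g zero)}) (sumℤ-+ m (λ i → f (suc i)) (λ i → g (suc i))))
        (ℤ+.interchange (f zero) (g zero) _ _)

sumℤ-*ˡ : ∀ m a (f : Fin m → ℤ) → sumℤ m (λ i → a ℤ.* f i) ≡ a ℤ.* sumℤ m f
sumℤ-*ˡ zero    a f = sym (ℤ.*-zeroʳ a)
sumℤ-*ˡ (suc m) a f =
  trans (cong₂ ℤ._+_ (refl {x = a ℤ.* f zero}) (sumℤ-*ˡ m a (λ i → f (suc i)))) (sym (ℤ.*-distribˡ-+ a (f zero) _))

sumℤ-swap : ∀ n m (F : Fin n → Fin m → ℤ) →
            sumℤ n (λ v → sumℤ m (F v)) ≡ sumℤ m (λ e → sumℤ n (λ v → F v e))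
sumℤ-swap zero    m F = sym (sumℤ-0 m)
sumℤ-swap (suc n) m F =
  trans (cong₂ ℤ._+_ (refl {x = sumℤ m (F zero)}) (sumℤ-swap n m (λ v → F (suc v))))
        (sym (sumℤ-+ m (F zero) _))

sumℤ-δ : ∀ {m} (i : Fin m) (f : Fin m → ℤ) →
         sumℤ m (λ j → if does (i ≟ j) then f j else 0ℤ) ≡ f i
sumℤ-δ {suc m} zero    f = trans (cong₂ ℤ._+_ (refl {x = f zero}) (sumℤ-0 m)) (ℤ.+-identityʳ (f zero))
sumℤ-δ {suc m} (suc i) f = trans (ℤ.+-identityˡ _) (sumℤ-δ i (λ j → f (suc j)))

sumℤ-∣ : ∀ {k} m {f : Fin m → ℤ} → (∀ i → k ∣ℤ f i) → k ∣ℤ sumℤ m f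
sumℤ-∣ {k} zero    k∣f = ∣ℤ.∣ᵤ⇒∣ (divides 0 refl)
sumℤ-∣ (suc m) k∣f = ∣ℤ.∣m∣n⇒∣m+n (k∣f zero) (sumℤ-∣ m (λ i → k∣f (suc i)))

≟-refl : ∀ {n} (i : Fin n) → does (i ≟ i) ≡ true
≟-refl zero    = refl
≟-refl (suc i) = ≟-refl i

≟-true : ∀ {n} {i j : Fin n} → does (i ≟ j) ≡ true → i ≡ j
≟-true {i = i} {j} eq with yes p ← i ≟ j = p

≟-false : ∀ {n} {i j : Fin n} → i ≢ j → does (i ≟ j) ≡ false
≟-false {i = i} {j} i≢j with i ≟ j
... | yes p = ⊥-elim (i≢j p)
... | no  _ = refl

-- Signed values placed at vertices

turn : Bool → ℤ → ℤ
turn true  a = a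
turn false a = - a

turn-+ : ∀ s a b → turn s (a ℤ.+ b) ≡ turn s a ℤ.+ turn s b
turn-+ true  a b = refl
turn-+ false a b = ℤ.neg-distrib-+ a b

turn-0 : ∀ s → turn s 0ℤ ≡ 0ℤ
turn-0 true  = refl
turn-0 false = refl

turn-turn : ∀ s a → turn s (turn s a) ≡ a
turn-turn true  a = refl
turn-turn false a = ℤ.neg-involutive a

∣turn∣ : ∀ s a → ∣ turn s a ∣ ≡ ∣ a ∣
∣turn∣ true  a = refl
∣turn∣ false a = ℤ.∣-i∣≡∣i∣ a

opp : Fin 2 → Fin 2
opp zero       = suc zero
opp (suc zero) = zero

opp-opp : ∀ h → opp (opp h) ≡ h
opp-opp zero       = refl
opp-opp (suc zero) = refl

at : ∀ {n} → Fin n → Fin n → ℤ → ℤ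
at v w a = if does (w ≟ v) then a else 0ℤ

at-+ : ∀ {n} (v w : Fin n) a b → at v w (a ℤ.+ b) ≡ at v w a ℤ.+ at v w b
at-+ v w a b with does (w ≟ v)
... | true  = refl
... | false = refl

at-0 : ∀ {n} (v w : Fin n) → at v w 0ℤ ≡ 0ℤ
at-0 v w with does (w ≟ v)
... | true  = refl
... | false = refl

at-neg : ∀ {n} (v w : Fin n) a → at v w (- a) ≡ - at v w a
at-neg v w a with does (w ≟ v)
... | true  = refl
... | false = refl

at-* : ∀ {n} (v w : Fin n) c a → at v w (c ℤ.* a) ≡ c ℤ.* at v w a
at-* v w c a with does (w ≟ v)
... | true  = refl
... | false = sym (ℤ.*-zeroʳ c)

-- Flows without orientations, darts and walks

module _ {n m : ℕ} (G : SignedGraph n m) where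

  -- An orientation-free description of a flow: x e is the value leaving the
  -- half-edge 0, and half e h (x e) the value leaving the half-edge h.
  half : Fin m → Fin 2 → ℤ → ℤ
  half e zero       a = a
  half e (suc zero) a = turn (negative G e) a

  net : (Fin m → ℤ) → Fin n → ℤ
  net x v = sumℤ m (λ e → at v (end G e zero) (half e zero (x e))
                      ℤ.+ at v (end G e (suc zero)) (half e (suc zero) (x e)))

  ∣half∣ : ∀ e h a → ∣ half e h a ∣ ≡ ∣ a ∣
  ∣half∣ e zero       a = refl
  ∣half∣ e (suc zero) a = ∣turn∣ (negative G e) a

  half-+ : ∀ e h a b → half e h (a ℤ.+ b) ≡ half e h a ℤ.+ half e h b
  half-+ e zero       a b = refl
  half-+ e (suc zero) a b = turn-+ (negative G e) a b

  private
    orient : Bool → ℤ → ℤ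
    orient t a = if t then - a else a

    valid⇒turn : ∀ s t t′ a → (s ≡ false → (t xor t′) ≡ true) × (s ≡ true → t ≡ t′) →
                 turn s (orient t a) ≡ orient t′ a
    valid⇒turn true  t     t′    a (_ , q) = cong (λ b → orient b a) (q refl)
    valid⇒turn false true  false a _       = ℤ.neg-involutive a
    valid⇒turn false false true  a _       = refl
    valid⇒turn false true  true  a (p , _) with () ← p refl
    valid⇒turn false false false a (p , _) with () ← p refl

    ∣orient∣ : ∀ t a → ∣ orient t a ∣ ≡ ∣ a ∣
    ∣orient∣ true  a = ℤ.∣-i∣≡∣i∣ a
    ∣orient∣ false a = refl

  module _ (τ : Orientation G) (ξ : Fin m → ℤ) where

    normalise : Fin m → ℤ
    normalise e = orient (τ e zero) (ξ e)

    ∣normalise∣ : ∀ e → ∣ normalise e ∣ ≡ ∣ ξ e ∣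
    ∣normalise∣ e = ∣orient∣ (τ e zero) (ξ e)

    net-normalise : ValidOrientation G τ → ∀ v → net normalise v ≡ netOut G τ ξ v
    net-normalise ok v = sumℤ-cong m λ e →
      cong (λ a → at v (end G e zero) (normalise e) ℤ.+ at v (end G e (suc zero)) a)
           (valid⇒turn (negative G e) (τ e zero) (τ e (suc zero)) (ξ e) (ok e))

  -- Half-edge 0 always points away from its end, so that `x e` is the flow value itself; the
  -- direction of half-edge 1 is then forced by the sign of the edge.
  standard : Orientation G
  standard e zero       = false
  standard e (suc zero) = not (negative G e)

  standard-valid : ValidOrientation G standard
  standard-valid e with negative G e
  ... | true  = (λ ()) , (λ _ → refl)
  ... | false = (λ _ → refl) , (λ ())

  net-standard : ∀ x v → netOut G standard x v ≡ net x v
  net-standard x v = sumℤ-cong m λ e →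
    cong (λ a → at v (end G e zero) (x e) ℤ.+ at v (end G e (suc zero)) a) (eq (negative G e) (x e))
    where
    eq : ∀ s a → orient (not s) a ≡ turn s a
    eq true  a = refl
    eq false a = refl

  ∣∣≢0 : ∀ {a b} → ∣ a ∣ ≡ ∣ b ∣ → b ≢ 0ℤ → a ≢ 0ℤ
  ∣∣≢0 eq b≢0 refl = b≢0 (ℤ.∣i∣≡0⇒i≡0 (sym eq))

  intFlow⇒ : HasNZIntFlow G → Σ (Fin m → ℤ) λ x → (∀ v → net x v ≡ 0ℤ) × NowhereZero G x
  intFlow⇒ (τ , ok , ξ , fl , nz) = normalise τ ξ ,
    (λ v → trans (net-normalise τ ξ ok v) (fl v)) , λ e → ∣∣≢0 (∣normalise∣ τ ξ e) (nz e)

  kFlow⇒ : ∀ {k} → HasNZkFlow G k →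
           Σ (Fin m → ℤ) λ x → (∀ v → net x v ≡ 0ℤ) × NowhereZero G x × (∀ e → ∣ x e ∣ < k)
  kFlow⇒ {k} (τ , ok , ξ , fl , nz , bd) = normalise τ ξ ,
    (λ v → trans (net-normalise τ ξ ok v) (fl v)) , (λ e → ∣∣≢0 (∣normalise∣ τ ξ e) (nz e)) ,
    λ e → subst (_< k) (sym (∣normalise∣ τ ξ e)) (bd e)

  ⇒kFlow : ∀ {k} x → (∀ v → net x v ≡ 0ℤ) → NowhereZero G x → (∀ e → ∣ x e ∣ < k) → HasNZkFlow G k
  ⇒kFlow x fl nz bd = standard , standard-valid , x , (λ v → trans (net-standard x v) (fl v)) , nz , bd

  net-+ : ∀ x y v → net (λ e → x e ℤ.+ y e) v ≡ net x v ℤ.+ net y v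
  net-+ x y v = trans (sumℤ-cong m eq) (sumℤ-+ m _ _)
    where
    eq : ∀ e → _
    eq e = trans (cong₂ ℤ._+_ (at-+ v (end G e zero) (x e) (y e))
                   (trans (cong (at v (end G e (suc zero))) (turn-+ (negative G e) (x e) (y e)))
                          (at-+ v (end G e (suc zero)) _ _)))
                 (ℤ+.interchange (at v (end G e zero) (x e)) (at v (end G e zero) (y e)) _ _)

  net-0 : ∀ v → net (λ _ → 0ℤ) v ≡ 0ℤ
  net-0 v = trans (sumℤ-cong m eq) (sumℤ-0 m)
    where
    eq : ∀ e → _
    eq e = cong₂ ℤ._+_ (at-0 v (end G e zero))
                       (trans (cong (at v (end G e (suc zero))) (turn-0 (negative G e))) (at-0 v (end G e (suc zero))))

  -- Double counting over vertices and edges. Both obstructions to flows come from it: with the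
  -- weight 1 the positive edges cancel, and with the signs of a potential every consistent edge
  -- cancels.
  weighted-net : ∀ (φ : Fin n → ℤ) x →
    sumℤ n (λ v → φ v ℤ.* net x v) ≡
    sumℤ m (λ e → φ (end G e zero) ℤ.* x e ℤ.+ φ (end G e (suc zero)) ℤ.* turn (negative G e) (x e))
  weighted-net φ x =
    trans (sumℤ-cong n (λ v → sym (sumℤ-*ˡ m (φ v) _)))
      (trans (sumℤ-swap n m _) (sumℤ-cong m λ e →
        trans (sumℤ-cong n λ v → ℤ.*-distribˡ-+ (φ v) _ _)
          (trans (sumℤ-+ n _ _) (cong₂ ℤ._+_ (pick (end G e zero) (x e)) (pick (end G e (suc zero)) _)))))
    where
    pick : ∀ w a → sumℤ n (λ v → φ v ℤ.* at v w a) ≡ φ w ℤ.* a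
    pick w a = trans (sumℤ-cong n λ v → eq v) (sumℤ-δ w (λ v → φ v ℤ.* a))
      where
      eq : ∀ v → φ v ℤ.* at v w a ≡ (if does (w ≟ v) then φ v ℤ.* a else 0ℤ)
      eq v with does (w ≟ v)
      ... | true  = refl
      ... | false = ℤ.*-zeroʳ (φ v)

  Dart : Set
  Dart = Fin m × Fin 2

  src tgt : Dart → Fin n
  src (e , h) = end G e h
  tgt (e , h) = end G e (opp h)

  neg : Dart → Bool
  neg (e , _) = negative G e

  -- `half e h` is an involution, so the entry `half e h a` is the one for which the value leaving
  -- half-edge `h` is `a`.
  unit : Dart → ℤ → Fin m → ℤ
  unit (e , h) a f = if does (e ≟ f) then half e h a else 0ℤ

  net-unit : ∀ d a v → net (unit d a) v ≡ at v (src d) a ℤ.+ at v (tgt d) (turn (neg d) a)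
  net-unit (e , h) a v = trans (sumℤ-cong m eq) (trans (sumℤ-δ e _) (ends h))
    where
    eq : ∀ f → at v (end G f zero) (unit (e , h) a f)
                 ℤ.+ at v (end G f (suc zero)) (turn (negative G f) (unit (e , h) a f))
             ≡ (if does (e ≟ f) then at v (end G f zero) (half e h a)
                 ℤ.+ at v (end G f (suc zero)) (turn (negative G f) (half e h a)) else 0ℤ)
    eq f with does (e ≟ f)
    ... | true  = refl
    ... | false = cong₂ ℤ._+_ (at-0 v (end G f zero))
                       (trans (cong (at v (end G f (suc zero))) (turn-0 (negative G f))) (at-0 v (end G f (suc zero))))
    ends : ∀ h → at v (end G e zero) (half e h a)
                 ℤ.+ at v (end G e (suc zero)) (turn (negative G e) (half e h a))
               ≡ at v (end G e h) a ℤ.+ at v (end G e (opp h)) (turn (negative G e) a)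
    ends zero       = refl
    ends (suc zero) = trans (cong (λ b → at v (end G e zero) (turn (negative G e) a) ℤ.+ at v (end G e (suc zero)) b)
                                  (turn-turn (negative G e) a))
                            (ℤ.+-comm (at v (end G e zero) (turn (negative G e) a)) (at v (end G e (suc zero)) a))

  IsWalk : Fin n → List Dart → Fin n → Set
  IsWalk u []      w = u ≡ w
  IsWalk u (d ∷ L) w = src d ≡ u × IsWalk (tgt d) L w

  walk-++ : ∀ {u v w} L {L′} → IsWalk u L v → IsWalk v L′ w → IsWalk u (L ++ L′) w
  walk-++ []      refl     q = q
  walk-++ (d ∷ L) (eq , p) q = eq , walk-++ L p q

  par : List Dart → Bool
  par []      = false
  par (d ∷ L) = neg d xor par L

  par-++ : ∀ L L′ → par (L ++ L′) ≡ par L xor par L′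
  par-++ []      L′ = refl
  par-++ (d ∷ L) L′ = trans (cong (neg d xor_) (par-++ L L′)) (sym (Bool.xor-assoc (neg d) (par L) (par L′)))

  cnt : Fin m → List Dart → ℕ
  cnt e []      = 0
  cnt e (d ∷ L) = ind (does (proj₁ d ≟ e)) + cnt e L

  cnt-++ : ∀ e L L′ → cnt e (L ++ L′) ≡ cnt e L + cnt e L′
  cnt-++ e []      L′ = refl
  cnt-++ e (d ∷ L) L′ = trans (cong (ind (does (proj₁ d ≟ e)) +_) (cnt-++ e L L′))
                              (sym (ℕ.+-assoc (ind (does (proj₁ d ≟ e))) _ _))

  sumL : (Fin m → ℕ) → List Dart → ℕ
  sumL f []      = 0
  sumL f (d ∷ L) = f (proj₁ d) + sumL f L

  sumL-cnt : ∀ f L → sumL f L ≡ sumℕ m (λ e → cnt e L * f e)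
  sumL-cnt f []      = sym (sumℕ-0 m)
  sumL-cnt f (d ∷ L) = sym
    (trans (sumℕ-cong m λ e → ℕ.*-distribʳ-+ (f e) (ind (does (proj₁ d ≟ e))) (cnt e L))
      (trans (sumℕ-+ m _ _) (cong₂ _+_ (sumℕ-δ (proj₁ d) f) (sym (sumL-cnt f L)))))

  par-sumL : ∀ L → par L ≡ odd? (sumL (λ e → ind (negative G e)) L)
  par-sumL []      = refl
  par-sumL (d ∷ L) = sym (trans (odd?-+ (ind (neg d)) _) (cong₂ _xor_ (odd?-ind (neg d)) (sym (par-sumL L))))

  par-cnt : ∀ L → par L ≡ odd? (sumℕ m (λ e → cnt e L * ind (negative G e)))
  par-cnt L = trans (par-sumL L) (cong odd? (sumL-cnt _ L))

  halfEdgesAt-dart : ∀ v d → halfEdgesAt G v (proj₁ d) ≡ ind (does (src d ≟ v)) + ind (does (tgt d ≟ v))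
  halfEdgesAt-dart v (e , zero)       = refl
  halfEdgesAt-dart v (e , (suc zero)) = ℕ.+-comm (ind (does (end G e zero ≟ v))) _

  -- Each passage through an inner vertex uses two half-edges, so only the two ends of the walk can
  -- contribute an odd number.
  walk-valency : ∀ v {u w} L → IsWalk u L w →
    odd? (sumL (halfEdgesAt G v) L) ≡ does (u ≟ v) xor does (w ≟ v)
  walk-valency v {u} []      refl       = sym (Bool.xor-same (does (u ≟ v)))
  walk-valency v {w = w} (d ∷ L) (refl , p) =
    trans (odd?-+ (halfEdgesAt G v (proj₁ d)) _)
      (trans (cong₂ _xor_ (trans (cong odd? (halfEdgesAt-dart v d))
                 (trans (odd?-+ (ind (does (src d ≟ v))) _)
                        (cong₂ _xor_ (odd?-ind (does (src d ≟ v))) (odd?-ind (does (tgt d ≟ v))))))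
               (walk-valency v L p))
        (cancel (does (src d ≟ v)) (does (tgt d ≟ v)) (does (w ≟ v))))
    where
    cancel : ∀ a b c → (a xor b) xor (b xor c) ≡ a xor c
    cancel true  true  c = refl
    cancel true  false c = refl
    cancel false true  c = Bool.not-involutive c
    cancel false false c = refl

  -- Propagating the value a along a walk so that it is conserved at the inner vertices.

  along : ℤ → List Dart → Fin m → ℤ
  along a []      f = 0ℤ
  along a (d ∷ L) f = unit d a f ℤ.+ along (- turn (neg d) a) L f

  -- The sign of the walk decides what a closed walk leaves at its base: nothing if it is even,
  -- which gives 2-flows, and `2a` if it is odd, which gives 3-flows from three odd tours.
  net-along : ∀ v {u w} a L → IsWalk u L w →
    net (along a L) v ≡ at v u a ℤ.+ at v w (turn (par L) a)
  net-along v {u} a [] refl = trans (net-0 v) (sym (trans (sym (at-+ v u a (- a)))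
                                              (trans (cong (at v u) (ℤ.+-inverseʳ a)) (at-0 v u))))
  net-along v {w = w} a (d ∷ L) (refl , p) =
    trans (net-+ (unit d a) (along b L) v)
      (trans (cong₂ ℤ._+_ (net-unit d a v) (net-along v b L p))
        (trans (ℤ.+-assoc (at v (src d) a) _ _)
          (cong₂ ℤ._+_ (refl {x = at v (src d) a})
            (trans (sym (ℤ.+-assoc (at v (tgt d) (turn (neg d) a)) _ _))
              (trans (cong₂ ℤ._+_
                        (trans (sym (at-+ v (tgt d) (turn (neg d) a) b))
                          (trans (cong (at v (tgt d)) (ℤ.+-inverseʳ (turn (neg d) a))) (at-0 v (tgt d))))
                        (cong (at v w) (turn-xor (neg d) (par L) a)))
                     (ℤ.+-identityˡ _))))))
    where
    b : ℤ
    b = - turn (neg d) a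
    turn-xor : ∀ s t a → turn t (- turn s a) ≡ turn (s xor t) a
    turn-xor true  true  a = refl
    turn-xor true  false a = ℤ.neg-involutive a
    turn-xor false true  a = ℤ.neg-involutive a
    turn-xor false false a = cong -_ (ℤ.neg-involutive a)

-- Euler tours

ind-true : ∀ b → ind b ≢ 0 → b ≡ true
ind-true true  _ = refl
ind-true false p = ⊥-elim (p refl)

xor-solve : ∀ a b c → a ≡ b xor c → c ≡ b xor a
xor-solve _ true  c refl = sym (Bool.not-involutive c)
xor-solve _ false c refl = refl

remove : ∀ {m} → Fin m → EdgeSet m → EdgeSet m
remove e U f = if does (e ≟ f) then false else U f

remove-split : ∀ {m} (e : Fin m) U → U e ≡ true → ∀ f → ind (U f) ≡ ind (does (e ≟ f)) + ind (remove e U f)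
remove-split e U eq f with e ≟ f
... | yes refl = cong ind eq
... | no  _    = refl

size : ∀ {m} → EdgeSet m → ℕ
size {m} U = sumℕ m (λ e → ind (U e))

size-remove : ∀ {m} (e : Fin m) U → U e ≡ true → size U ≡ suc (size (remove e U))
size-remove {m} e U eq = trans (sumℕ-cong m (remove-split e U eq)) (trans (sumℕ-+ m _ _)
  (cong (_+ size (remove e U))
    (trans (sumℕ-cong m (λ f → sym (ℕ.*-identityʳ (ind (does (e ≟ f)))))) (sumℕ-δ e (λ _ → 1)))))

module _ {n m : ℕ} (G : SignedGraph n m) where

  ∣along∣₀ : ∀ e a L → cnt G e L ≡ 0 → along G a L e ≡ 0ℤ
  ∣along∣₀ e a []      _ = refl
  ∣along∣₀ e a (d ∷ L) p with does (proj₁ d ≟ e)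
  ... | false = trans (ℤ.+-identityˡ _) (∣along∣₀ e (- turn (neg G d) a) L p)

  ∣along∣₁ : ∀ e a L → cnt G e L ≡ 1 → ∣ along G a L e ∣ ≡ ∣ a ∣
  ∣along∣₁ e a (d ∷ L) p with does (proj₁ d ≟ e)
  ... | true  = trans (cong ∣_∣ (trans (cong₂ ℤ._+_ (refl {x = half G (proj₁ d) (proj₂ d) a}) (∣along∣₀ e (- turn (neg G d) a) L (ℕ.suc-injective p)))
                                       (ℤ.+-identityʳ (half G (proj₁ d) (proj₂ d) a)))) (∣half∣ G (proj₁ d) (proj₂ d) a)
  ... | false = trans (cong ∣_∣ (ℤ.+-identityˡ (along G (- turn (neg G d) a) L e)))
                 (trans (∣along∣₁ e _ L p) (trans (ℤ.∣-i∣≡∣i∣ (turn (neg G d) a)) (∣turn∣ (neg G d) a)))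

  valency-split : ∀ {S U : EdgeSet m} L → (∀ e → ind (S e) ≡ cnt G e L + ind (U e)) → ∀ v →
                  valency G S v ≡ sumL G (halfEdgesAt G v) L + valency G U v
  valency-split {S} {U} L eq v =
    trans (sumℕ-cong m λ e → trans (cong (_* halfEdgesAt G v e) (eq e))
                                   (ℕ.*-distribʳ-+ (halfEdgesAt G v e) (cnt G e L) (ind (U e))))
      (trans (sumℕ-+ m _ _) (cong (_+ valency G U v) (sym (sumL-cnt G (halfEdgesAt G v) L))))

  dart-at : ∀ v e → odd? (halfEdgesAt G v e) ≡ true → Σ (Fin 2) λ h → end G e h ≡ v
  dart-at v e p with end G e zero ≟ v | end G e (suc zero) ≟ v
  ... | yes q | _     = zero , q
  ... | no  _ | yes q = suc zero , q

  remove-valency : ∀ U (d : Dart G) → U (proj₁ d) ≡ true → ∀ v →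
    odd? (valency G (remove (proj₁ d) U) v) ≡ (does (src G d ≟ v) xor does (tgt G d ≟ v)) xor odd? (valency G U v)
  remove-valency U d p v =
    xor-solve (odd? (valency G U v)) (does (src G d ≟ v) xor does (tgt G d ≟ v)) _ (trans (cong odd? (valency-split {U} {remove (proj₁ d) U} (d ∷ [])
        (λ f → trans (remove-split (proj₁ d) U p f) (cong (_+ ind (remove (proj₁ d) U f)) (sym (ℕ.+-identityʳ (ind (does (proj₁ d ≟ f))))))) v))
      (trans (odd?-+ (sumL G (halfEdgesAt G v) (d ∷ [])) _)
        (cong (_xor odd? (valency G (remove (proj₁ d) U) v)) (walk-valency G v (d ∷ []) (refl , refl)))))

  EvenSet : EdgeSet m → Set
  EvenSet U = ∀ v → odd? (valency G U v) ≡ false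

  -- An odd vertex always has an unused edge, so a greedy trail from x can only get stuck at y.
  trail : ∀ k U x y → size U ≡ k → (∀ v → odd? (valency G U v) ≡ does (x ≟ v) xor does (y ≟ v)) →
    Σ (List (Dart G)) λ L → Σ (EdgeSet m) λ U′ →
      IsWalk G x L y × (∀ e → ind (U e) ≡ cnt G e L + ind (U′ e)) × EvenSet U′
  trail k U x y size≡ odd with x ≟ y
  ... | yes refl = [] , U , refl , (λ _ → refl) , λ v → trans (odd v) (Bool.xor-same (does (x ≟ v)))
  ... | no  x≢y with sumℕ-odd-term m (λ e → ind (U e) * halfEdgesAt G x e)
                       (trans (odd x) (cong₂ _xor_ (≟-refl x) (≟-false (λ eq → x≢y (sym eq)))))
  ... | e , p with U e in Ue
  ... | true with h , refl ← dart-at x e (trans (cong odd? (sym (ℕ.+-identityʳ (halfEdgesAt G x e)))) p) with k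
  ... | zero with () ← trans (sym size≡) (size-remove e U Ue)
  ... | suc k′ with trail k′ (remove e U) (end G e (opp h)) y
                    (ℕ.suc-injective (trans (sym (size-remove e U Ue)) size≡))
                    (λ v → trans (remove-valency U (e , h) Ue v)
                       (trans (cong ((does (end G e h ≟ v) xor does (end G e (opp h) ≟ v)) xor_) (odd v))
                          (cancel (does (end G e h ≟ v)) (does (end G e (opp h) ≟ v)) (does (y ≟ v)))))
    where
    cancel : ∀ a b c → (a xor b) xor (a xor c) ≡ b xor c
    cancel true  true  true  = refl
    cancel true  true  false = refl
    cancel true  false true  = refl
    cancel true  false false = refl
    cancel false b     c     = refl
  ... | L , U′ , w , split , even =
    (e , h) ∷ L , U′ , (refl , w) ,
    (λ f → trans (remove-split e U Ue f) (trans (cong (ind (does (e ≟ f)) +_) (split f)) (sym (ℕ.+-assoc (ind (does (e ≟ f))) _ _)))) , even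

  On : Fin n → List (Dart G) → Fin n → Fin n → Set
  On u L w a = Σ (List (Dart G)) λ A → Σ (List (Dart G)) λ B → L ≡ A ++ B × IsWalk G u A a × IsWalk G a B w

  on-∷ : ∀ {u w a} d L → src G d ≡ u → On (tgt G d) L w a → On u (d ∷ L) w a
  on-∷ d L eq (A , B , refl , p , q) = d ∷ A , B , refl , (eq , p) , q

  on-ends : ∀ f h {u w} L → IsWalk G u L w → cnt G f L ≢ 0 → On u L w (end G f h)
  on-ends f h []      p             c = ⊥-elim (c refl)
  on-ends f h (d ∷ L) (refl , p) c with proj₁ d ≟ f
  ... | no  _    = on-∷ d L refl (on-ends f h L p c)
  ... | yes refl = ends (proj₂ d) h refl
    where
    ends : ∀ k h → k ≡ proj₂ d → On (src G d) (d ∷ L) _ (end G (proj₁ d) h)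
    ends zero       zero       refl = [] , d ∷ L , refl , refl , (refl , p)
    ends zero       (suc zero) refl = d ∷ [] , L , refl , (refl , refl) , p
    ends (suc zero) zero       refl = d ∷ [] , L , refl , (refl , refl) , p
    ends (suc zero) (suc zero) refl = [] , d ∷ L , refl , refl , (refl , p)

  step-dart : ∀ {S a b} → Adj G S a b → Σ (Dart G) λ d → S (proj₁ d) ≡ true × src G d ≡ a × tgt G d ≡ b
  step-dart (e , s , inj₁ (p , q)) = (e , zero)     , s , p , q
  step-dart (e , s , inj₂ (p , q)) = (e , suc zero) , s , q , p

  -- Follow the given walk up to its first edge outside `L`. All earlier edges belong to `L`, hence
  -- so do their ends, and the new edge starts on `L`. If there is no such edge, the walk stays on
  -- `L` until it reaches `e` itself.
  leave : ∀ {S U : EdgeSet m} {r} L → IsWalk G r L r → (∀ e → ind (S e) ≡ cnt G e L + ind (U e)) →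
    ∀ {a} e → U e ≡ true → On r L r a → Walk G S a (end G e zero) →
    Σ (Dart G) λ d → U (proj₁ d) ≡ true × On r L r (src G d)
  leave L w split e Ue on ε = (e , zero) , Ue , on
  leave {S} {U} L w split e Ue on (s ◅ W) with step-dart s
  ... | d , Sd , refl , refl with U (proj₁ d) in Ud
  ... | true  = d , Ud , on
  ... | false = leave L w split e Ue (on-ends (proj₁ d) (opp (proj₂ d)) L w used) W
    where
    used : cnt G (proj₁ d) L ≢ 0
    used c≡0 with () ← trans (sym (cong ind Sd)) (trans (split (proj₁ d)) (cong₂ _+_ c≡0 (cong ind Ud)))

  euler : ∀ (S : EdgeSet m) r → EvenSet S → (∀ e → S e ≡ true → Walk G S r (end G e zero)) →
    Σ (List (Dart G)) λ L → IsWalk G r L r × (∀ e → cnt G e L ≡ ind (S e))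
  euler S r evenS reach = grow (size S) [] S ℕ.≤-refl refl (λ _ → refl) evenS
    where
    grow : ∀ k L U → size U ≤ k → IsWalk G r L r → (∀ e → ind (S e) ≡ cnt G e L + ind (U e)) → EvenSet U →
           Σ (List (Dart G)) λ L → IsWalk G r L r × (∀ e → cnt G e L ≡ ind (S e))
    grow k L U size≤ w split even with any? (λ e → U e ≟ᵇ true)
    ... | no  none = L , w , λ e → sym (trans (split e) (trans (cong (cnt G e L +_) (unused e)) (ℕ.+-identityʳ _)))
      where
      unused : ∀ e → ind (U e) ≡ 0
      unused e with U e in Ue
      ... | true  = ⊥-elim (none (e , Ue))
      ... | false = refl
    ... | yes (e , Ue) with leave L w split e Ue ([] , L , refl , refl , w) (reach e Se)
      where
      Se : S e ≡ true
      Se = ind-true (S e) (λ p → ℕ.1+n≢0 (trans (ℕ.+-comm 1 (cnt G e L))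
                              (trans (cong (cnt G e L +_) (sym (cong ind Ue))) (trans (sym (split e)) p))))
    ... | d , Ud , A , B , refl , wA , wB
      -- Removing `d` from an even set makes at most its two ends odd, so the greedy trail from the
      -- target of `d` ends at its source and closes the detour.
      with trail (size (remove (proj₁ d) U)) (remove (proj₁ d) U) (tgt G d) (src G d) refl
             (λ v → trans (remove-valency U d Ud v) (trans (cong ((does (src G d ≟ v) xor does (tgt G d ≟ v)) xor_) (even v))
                      (trans (Bool.xor-identityʳ _) (Bool.xor-comm (does (src G d ≟ v)) _))))
    ... | Z , U′ , wZ , splitZ , even′ with k
    ... | zero with () ← ℕ.≤-trans (ℕ.≤-reflexive (sym (size-remove (proj₁ d) U Ud))) size≤
    ... | suc k′ = grow k′ (A ++ d ∷ Z ++ B) U′ smaller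
                     (walk-++ G A wA (refl , walk-++ G Z wZ wB)) split′ even′
      where
      smaller : size U′ ≤ k′
      smaller = ℕ.≤-trans (sumℕ-mono m λ f → ℕ.≤-trans (ℕ.m≤n+m (ind (U′ f)) (cnt G f Z)) (ℕ.≤-reflexive (sym (splitZ f))))
                          (ℕ.≤-pred (ℕ.≤-trans (ℕ.≤-reflexive (sym (size-remove (proj₁ d) U Ud))) size≤))
      split′ : ∀ f → ind (S f) ≡ cnt G f (A ++ d ∷ Z ++ B) + ind (U′ f)
      split′ f = begin
        ind (S f)                                                       ≡⟨ split f ⟩
        cnt G f (A ++ B) + ind (U f)                                    ≡⟨ cong₂ _+_ (cnt-++ G f A B) (trans (remove-split (proj₁ d) U Ud f) (cong (ind (does (proj₁ d ≟ f)) +_) (splitZ f))) ⟩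
        (cnt G f A + cnt G f B) + (δ + (cnt G f Z + ind (U′ f)))        ≡⟨ rearrange (cnt G f A) (cnt G f B) δ (cnt G f Z) (ind (U′ f)) ⟩
        (cnt G f A + (δ + (cnt G f Z + cnt G f B))) + ind (U′ f)        ≡⟨ cong (_+ ind (U′ f)) (sym (trans (cnt-++ G f A (d ∷ Z ++ B)) (cong (λ x → cnt G f A + (δ + x)) (cnt-++ G f Z B)))) ⟩
        cnt G f (A ++ d ∷ Z ++ B) + ind (U′ f)                          ∎
        where
        open ≡-Reasoning
        δ : ℕ
        δ = ind (does (proj₁ d ≟ f))
        rearrange : ∀ a b c z u → (a + b) + (c + (z + u)) ≡ (a + (c + (z + b))) + u
        rearrange = ℕS.solve-∀

-- Potentials

Consistent : ∀ {n m} → SignedGraph n m → (Fin n → Bool) → Fin m → Set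
Consistent G φ e = negative G e ≡ φ (end G e zero) xor φ (end G e (suc zero))

Potential : ∀ {n m} → SignedGraph n m → (Fin n → Bool) → Set
Potential G φ = ∀ e → Consistent G φ e

odd?-2* : ∀ k → odd? (2 * k) ≡ false
odd?-2* k = trans (cong (λ x → odd? (k + x)) (ℕ.+-identityʳ k)) (odd?-double k)

module _ {n m : ℕ} (G : SignedGraph n m) where

  adj-sym : ∀ {S u v} → Adj G S u v → Adj G S v u
  adj-sym (e , s , inj₁ p) = e , s , inj₂ p
  adj-sym (e , s , inj₂ p) = e , s , inj₁ p

  walk-sym : ∀ {S u v} → Walk G S u v → Walk G S v u
  walk-sym = reverse adj-sym

  walk-mono : ∀ {S T u v} → (∀ e → S e ≡ true → T e ≡ true) → Walk G S u v → Walk G T u v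
  walk-mono S⊆T = gmap (λ v → v) λ { (e , s , p) → e , S⊆T e s , p }

  touches⇒valency : ∀ {S v} → Touches G S v → valency G S v ≢ 0
  touches⇒valency {S} {v} (e , Se , h , refl) val≡0 = halfEdge h (ℕ.n≤0⇒n≡0
      (ℕ.≤-trans (ℕ.≤-reflexive (sym (trans (cong (λ b → ind b * halfEdgesAt G v e) Se) (ℕ.*-identityˡ _))))
        (ℕ.≤-trans (term≤sumℕ (λ f → ind (S f) * halfEdgesAt G v f) e) (ℕ.≤-reflexive val≡0))))
    where
    halfEdge : ∀ h → halfEdgesAt G (end G e h) e ≢ 0
    halfEdge zero       p with () ← trans (sym (cong (λ b → ind b + ind (does (end G e (suc zero) ≟ end G e zero))) (≟-refl (end G e zero)))) p
    halfEdge (suc zero) p with () ← trans (sym (trans (ℕ.+-comm (ind (does (end G e zero ≟ end G e (suc zero)))) _) (cong (λ b → ind b + ind (does (end G e zero ≟ end G e (suc zero)))) (≟-refl (end G e (suc zero)))))) p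

  -- `Circuit` prescribes the valency at touched vertices only, but a vertex of odd valency is
  -- touched.
  circuit⇒even : ∀ {S} → Circuit G S → EvenSet G S
  circuit⇒even {S} (_ , _ , two) v with odd? (valency G S v) in eq
  ... | false = refl
  ... | true with sumℕ-odd-term m _ eq
  ... | e , p with S e in Se
  ... | true with h , q ← dart-at G v e (trans (cong odd? (sym (ℕ.+-identityʳ (halfEdgesAt G v e)))) p)
      with () ← trans (sym eq) (cong odd? (two v (e , Se , h , q)))

  -- An edge is negative iff exactly one of its ends has `φ` true. Modulo 2 the negative edges of
  -- `S` are therefore counted by the half-edges of `S` at such vertices.
  negCount-potential : ∀ φ → Potential G φ → ∀ S →
    odd? (negCount G S) ≡ odd? (sumℕ n (λ v → ind (φ v) * valency G S v))
  negCount-potential φ pot S = trans (odd?-sumℕ-cong m edge) (cong odd? (sym count))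
    where
    φφ : Fin m → ℕ
    φφ e = ind (φ (end G e zero)) + ind (φ (end G e (suc zero)))
    edge : ∀ e → odd? (ind (S e) * ind (negative G e)) ≡ odd? (ind (S e) * φφ e)
    edge e with S e
    ... | false = refl
    ... | true  = trans (cong odd? (ℕ.+-identityʳ (ind (negative G e)))) (trans (odd?-ind (negative G e)) (trans (pot e)
                    (sym (trans (cong odd? (ℕ.+-identityʳ (φφ e)))
                      (trans (odd?-+ (ind (φ (end G e zero))) _)
                        (cong₂ _xor_ (odd?-ind (φ (end G e zero))) (odd?-ind (φ (end G e (suc zero))))))))))
    pick : ∀ w → sumℕ n (λ v → ind (φ v) * ind (does (w ≟ v))) ≡ ind (φ w)
    pick w = trans (sumℕ-cong n λ v → ℕ.*-comm (ind (φ v)) _) (sumℕ-δ w (λ v → ind (φ v)))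
    count : sumℕ n (λ v → ind (φ v) * valency G S v) ≡ sumℕ m (λ e → ind (S e) * φφ e)
    count = trans (sumℕ-cong n λ v → sym (sumℕ-*ˡ m (ind (φ v)) _))
      (trans (sumℕ-swap n m _) (sumℕ-cong m λ e →
        trans (sumℕ-cong n λ v → rearrange (ind (φ v)) (ind (S e)) _)
          (trans (sumℕ-*ˡ n (ind (S e)) _)
            (cong (ind (S e) *_)
              (trans (sumℕ-cong n λ v → ℕ.*-distribˡ-+ (ind (φ v)) (ind (does (end G e zero ≟ v))) _)
                (trans (sumℕ-+ n _ _) (cong₂ _+_ (pick (end G e zero)) (pick (end G e (suc zero))))))))))
      where
      rearrange : ∀ a b c → a * (b * c) ≡ b * (a * c)
      rearrange = ℕS.solve-∀

  potential⇒even : ∀ φ → Potential G φ → ∀ S → EvenSet G S → odd? (negCount G S) ≡ false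
  potential⇒even φ pot S even = trans (negCount-potential φ pot S) (odd?-sumℕ-false n vertex)
    where
    vertex : ∀ v → odd? (ind (φ v) * valency G S v) ≡ false
    vertex v with φ v
    ... | false = refl
    ... | true  = trans (cong odd? (ℕ.+-identityʳ (valency G S v))) (even v)

  potential⇒balanced : ∀ φ → Potential G φ → Balanced G
  potential⇒balanced φ pot S c = odd?≡false⇒even _ (potential⇒even φ pot S (circuit⇒even c))

  -- A simple path, as its edge set and vertex set: adding both ends to the valencies makes
  -- every vertex of the path have valency two.
  record SimplePath (u w : Fin n) : Set where
    field
      edges    : EdgeSet m
      vertices : Fin n → Bool
      degrees  : ∀ v → valency G edges v + (ind (does (u ≟ v)) + ind (does (w ≟ v))) ≡ 2 * ind (vertices v)
      joined   : ∀ v → vertices v ≡ true → Walk G edges u v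

  -- The invariant of the edge-by-edge construction: `comp` labels the components, and the simple
  -- paths inside them, as in a spanning forest, are kept so that a later inconsistent edge can be
  -- closed to a circuit. The graph itself may contain cycles.
  record Forest : Set where
    field
      φ         : Fin n → Bool
      potential : Potential G φ
      comp      : Fin n → Fin n
      comp-edge : ∀ e → comp (end G e zero) ≡ comp (end G e (suc zero))
      path      : ∀ u w → comp u ≡ comp w → Σ (SimplePath u w) λ p →
                    ∀ v → SimplePath.vertices p v ≡ true → comp v ≡ comp u

  path-negCount : ∀ φ → Potential G φ → ∀ {u w} (p : SimplePath u w) →
                  odd? (negCount G (SimplePath.edges p)) ≡ φ u xor φ w
  path-negCount φ pot {u} {w} p = trans (negCount-potential φ pot edges)
      (trans (odd?-sumℕ-cong n vertex)
        (trans (cong odd? (trans (sumℕ-+ n _ _) (cong₂ _+_ (sumℕ-δ u (λ v → ind (φ v))) (sumℕ-δ w (λ v → ind (φ v))))))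
          (trans (odd?-+ (ind (φ u)) _) (cong₂ _xor_ (odd?-ind (φ u)) (odd?-ind (φ w))))))
    where
    open SimplePath p
    same : ∀ a b → odd? (a + b) ≡ false → odd? a ≡ odd? b
    same a b eq = trans (sym (Bool.xor-identityʳ (odd? a)))
      (trans (cong (odd? a xor_) (trans (sym eq) (odd?-+ a b)))
        (trans (sym (Bool.xor-assoc (odd? a) (odd? a) (odd? b))) (cong (_xor odd? b) (Bool.xor-same (odd? a)))))
    vertex : ∀ v → odd? (ind (φ v) * valency G edges v) ≡
                   odd? (ind (does (u ≟ v)) * ind (φ v) + ind (does (w ≟ v)) * ind (φ v))
    vertex v with φ v
    ... | true  = trans (cong odd? (ℕ.+-identityʳ (valency G edges v)))
                    (trans (same (valency G edges v) _ (trans (cong odd? (degrees v)) (odd?-2* (ind (vertices v)))))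
                      (cong odd? (cong₂ _+_ (sym (ℕ.*-identityʳ (ind (does (u ≟ v))))) (sym (ℕ.*-identityʳ (ind (does (w ≟ v))))))))
    ... | false = cong odd? (sym (cong₂ _+_ (ℕ.*-zeroʳ (ind (does (u ≟ v)))) (ℕ.*-zeroʳ (ind (does (w ≟ v))))))

tail : ∀ {n m} → SignedGraph n (suc m) → SignedGraph n m
tail G = record { end = λ e → end G (suc e) ; negative = λ e → negative G (suc e) }

infixr 5 _∷ˢ_
_∷ˢ_ : ∀ {m} → Bool → EdgeSet m → EdgeSet (suc m)
(b ∷ˢ S) zero    = b
(b ∷ˢ S) (suc e) = S e

module _ {n m : ℕ} (G : SignedGraph n (suc m)) where

  tail-walk : ∀ {b S u v} → Walk (tail G) S u v → Walk G (b ∷ˢ S) u v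
  tail-walk = gmap (λ v → v) λ { (e , s , p) → suc e , s , p }

  tail-touches : ∀ {S v} → Touches G (false ∷ˢ S) v → Touches (tail G) S v
  tail-touches (suc e , s , p) = e , s , p

  tail-circuit : ∀ {S} → Circuit (tail G) S → Circuit G (false ∷ˢ S)
  tail-circuit ((e , s) , conn , two) =
    (suc e , s) , (λ u v tu tv → tail-walk (conn u v (tail-touches tu) (tail-touches tv))) ,
    λ v tv → two v (tail-touches tv)

  private
    a b : Fin n
    a = end G zero zero
    b = end G zero (suc zero)

  tail-path : ∀ {u w} → SimplePath (tail G) u w → SimplePath G u w
  tail-path p = record { edges = false ∷ˢ edges ; vertices = vertices ; degrees = degrees
                       ; joined = λ v q → tail-walk (joined v q) }
    where open SimplePath p

  -- Disjoint vertex sets force disjoint edge sets, since an edge of a path touches a vertex of it.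
  -- So the valencies add up, and the new edge supplies what the ends `x` and `y` lack.
  join : ∀ {u x y w} → (Adj G (true ∷ˢ λ _ → false) x y) →
         (∀ v → halfEdgesAt G v zero ≡ ind (does (x ≟ v)) + ind (does (y ≟ v))) →
         (p : SimplePath (tail G) u x) (q : SimplePath (tail G) y w) →
         (∀ v → SimplePath.vertices p v ≡ true → SimplePath.vertices q v ≡ true → ⊥) → SimplePath G u w
  join {u} {x} {y} {w} xy ends p q disjoint = record
    { edges    = E
    ; vertices = V
    ; degrees  = deg
    ; joined   = walk }
    where
    module p = SimplePath p
    module q = SimplePath q
    E : EdgeSet (suc m)
    E = true ∷ˢ λ e → p.edges e ∨ q.edges e
    V : Fin n → Bool
    V v = p.vertices v ∨ q.vertices v
    ⊆p : ∀ e → (false ∷ˢ p.edges) e ≡ true → E e ≡ true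
    ⊆p (suc e) eq = cong (_∨ q.edges e) eq
    ⊆q : ∀ e → (false ∷ˢ q.edges) e ≡ true → E e ≡ true
    ⊆q (suc e) eq = trans (cong (p.edges e ∨_) eq) (Bool.∨-zeroʳ (p.edges e))
    px : p.vertices x ≡ true
    px with p.vertices x in eq
    ... | true  = refl
    ... | false with () ← ℕ.m+n≡0⇒n≡0 (ind (does (u ≟ x))) (ℕ.m+n≡0⇒n≡0 (valency (tail G) p.edges x)
                    (trans (cong (λ z → valency (tail G) p.edges x + (ind (does (u ≟ x)) + ind z)) (sym (≟-refl x))) (trans (p.degrees x) (cong (λ z → 2 * ind z) eq))))
    walk : ∀ v → V v ≡ true → Walk G E u v
    walk v eq with p.vertices v in pv
    ... | true  = walk-mono G ⊆p (tail-walk (p.joined v pv))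
    ... | false = walk-mono G ⊆p (tail-walk (p.joined x px))
                    ◅◅ (walk-mono G (λ { zero _ → refl ; (suc e) () }) (xy ◅ ε) ◅◅ walk-mono G ⊆q (tail-walk (q.joined v eq)))
    disjointE : ∀ e → p.edges e ≡ true → q.edges e ≡ true → ⊥
    disjointE e pe qe = disjoint v (touched p v (e , pe , zero , refl)) (touched q v (e , qe , zero , refl))
      where
      v : Fin n
      v = end G (suc e) zero
      touched : ∀ {u w} (r : SimplePath (tail G) u w) v → Touches (tail G) (SimplePath.edges r) v → SimplePath.vertices r v ≡ true
      touched {u} {w} r v t with SimplePath.vertices r v in eq
      ... | true  = refl
      ... | false = ⊥-elim (touches⇒valency (tail G) t (ℕ.m+n≡0⇒m≡0 (valency (tail G) (SimplePath.edges r) v)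
                                  (trans (SimplePath.degrees r v) (cong (λ z → 2 * ind z) eq))))
    ind-∨ : ∀ b c → (b ≡ true → c ≡ true → ⊥) → ind (b ∨ c) ≡ ind b + ind c
    ind-∨ true  true  dis = ⊥-elim (dis refl refl)
    ind-∨ true  false _ = refl
    ind-∨ false c     _ = refl
    deg : ∀ v → valency G E v + (ind (does (u ≟ v)) + ind (does (w ≟ v))) ≡ 2 * ind (V v)
    deg v = begin
      (1 * halfEdgesAt G v zero + valency (tail G) (λ e → p.edges e ∨ q.edges e) v) + (iu + iw)
        ≡⟨ cong₂ (λ s t → (1 * s + t) + (iu + iw)) (ends v)
             (trans (sumℕ-cong m λ e → trans (cong (_* halfEdgesAt (tail G) v e) (ind-∨ _ _ (disjointE e)))
                                             (ℕ.*-distribʳ-+ (halfEdgesAt (tail G) v e) (ind (p.edges e)) (ind (q.edges e))))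
                    (sumℕ-+ m _ _)) ⟩
      (1 * (ix + iy) + (valency (tail G) p.edges v + valency (tail G) q.edges v)) + (iu + iw)
        ≡⟨ rearrange ix iy (valency (tail G) p.edges v) (valency (tail G) q.edges v) iu iw ⟩
      (valency (tail G) p.edges v + (iu + ix)) + (valency (tail G) q.edges v + (iy + iw))
        ≡⟨ cong₂ _+_ (p.degrees v) (q.degrees v) ⟩
      2 * ind (p.vertices v) + 2 * ind (q.vertices v)
        ≡⟨ sym (ℕ.*-distribˡ-+ 2 (ind (p.vertices v)) _) ⟩
      2 * (ind (p.vertices v) + ind (q.vertices v))
        ≡⟨ cong (2 *_) (sym (ind-∨ _ _ (disjoint v))) ⟩
      2 * ind (V v) ∎
      where
      open ≡-Reasoning
      iu ix iy iw : ℕ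
      iu = ind (does (u ≟ v))
      ix = ind (does (x ≟ v))
      iy = ind (does (y ≟ v))
      iw = ind (does (w ≟ v))
      rearrange : ∀ x y p q u w → (1 * (x + y) + (p + q)) + (u + w) ≡ (p + (u + x)) + (q + (y + w))
      rearrange = ℕS.solve-∀

  -- The terms for the ends in `degrees` are exactly the half-edges of edge 0, so adding this edge
  -- gives valency two on the whole path; a loop is covered as well. The path has the sign predicted
  -- by `φ`, and the edge has the opposite one.
  close-path : ∀ φ → Potential (tail G) φ → ¬ Consistent G φ zero → SimplePath (tail G) a b →
               Σ (EdgeSet (suc m)) λ S → Circuit G S × odd? (negCount G S) ≡ true
  close-path φ pot bad p = S , ((zero , refl) , conn , λ v tv → two v (touched v tv)) , odd
    where
    open SimplePath p
    S : EdgeSet (suc m)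
    S = true ∷ˢ edges
    val : ∀ v → valency G S v ≡ 2 * ind (vertices v)
    val v = trans (trans (ℕ.+-comm (1 * halfEdgesAt G v zero) _) (cong (valency (tail G) edges v +_) (ℕ.*-identityˡ _))) (degrees v)
    touched : ∀ v → Touches G S v → vertices v ≡ true
    touched v t with vertices v in eq
    ... | true  = refl
    ... | false = ⊥-elim (touches⇒valency G t (trans (val v) (cong (λ z → 2 * ind z) eq)))
    two : ∀ v → vertices v ≡ true → valency G S v ≡ 2
    two v eq = trans (val v) (cong (λ z → 2 * ind z) eq)
    conn : ConnectedOn G S
    conn u v tu tv = walk-sym G (tail-walk (joined u (touched u tu))) ◅◅ tail-walk (joined v (touched v tv))
    ≢⇒xor : ∀ x y → x ≢ y → x xor y ≡ true
    ≢⇒xor true  true  ne = ⊥-elim (ne refl)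
    ≢⇒xor true  false ne = refl
    ≢⇒xor false true  ne = refl
    ≢⇒xor false false ne = ⊥-elim (ne refl)
    odd : odd? (negCount G S) ≡ true
    odd = trans (odd?-+ (1 * ind (negative G zero)) _)
      (trans (cong₂ _xor_ (trans (cong odd? (ℕ.*-identityˡ (ind (negative G zero)))) (odd?-ind (negative G zero)))
                          (path-negCount (tail G) φ pot p))
        (≢⇒xor _ _ bad))

  grow-forest : Forest (tail G) → Forest G ⊎ Σ (EdgeSet (suc m)) λ S → Circuit G S × odd? (negCount G S) ≡ true
  grow-forest F = extend (comp a ≟ comp b) (negative G zero ≟ᵇ (φ a xor φ b))
    where
    open Forest F
    extend : Dec (comp a ≡ comp b) → Dec (Consistent G φ zero) → _
    extend (yes same) (yes ok) = inj₁ record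
      { φ = φ
      ; potential = λ { zero → ok ; (suc e) → potential e }
      ; comp = comp
      ; comp-edge = λ { zero → same ; (suc e) → comp-edge e }
      ; path = λ u w eq → tail-path (proj₁ (path u w eq)) , proj₂ (path u w eq) }
    extend (yes same) (no bad) = inj₂ (close-path φ potential bad (proj₁ (path a b same)))
    extend (no diff) _ = inj₁ record
      { φ = φ′ ; potential = pot′ ; comp = comp′
      ; comp-edge = λ { zero → trans (comp′-out a diff) (sym (comp′-in b refl)) ; (suc e) → cong merge (comp-edge e) }
      ; path = path′ }
      where
      -- True iff the new edge is inconsistent. In that case the whole component of `b` is switched,
      -- which keeps the old edges consistent because by `comp-edge` none of them leaves the
      -- component.
      δ : Bool
      δ = negative G zero xor (φ a xor φ b)
      φ′ : Fin n → Bool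
      φ′ v = φ v xor (does (comp v ≟ comp b) ∧ δ)
      pot′ : Potential G φ′
      pot′ zero = trans (eq (negative G zero) (φ a) (φ b))
                    (sym (cong₂ (λ s t → (φ a xor (s ∧ δ)) xor (φ b xor (t ∧ δ))) (≟-false diff) (≟-refl (comp b))))
        where
        eq : ∀ s x y → s ≡ (x xor false) xor (y xor (s xor (x xor y)))
        eq true  true  true  = refl
        eq true  true  false = refl
        eq true  false true  = refl
        eq true  false false = refl
        eq false true  true  = refl
        eq false true  false = refl
        eq false false true  = refl
        eq false false false = refl
      pot′ (suc e) = trans (potential e) (trans (eq (φ (end G (suc e) zero)) _ (does (comp (end G (suc e) zero) ≟ comp b) ∧ δ))
          (cong (λ c → φ′ (end G (suc e) zero) xor (φ (end G (suc e) (suc zero)) xor (does (c ≟ comp b) ∧ δ))) (comp-edge e)))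
        where
        eq : ∀ x y d → x xor y ≡ (x xor d) xor (y xor d)
        eq true  true  true  = refl
        eq true  true  false = refl
        eq true  false true  = refl
        eq true  false false = refl
        eq false true  true  = refl
        eq false true  false = refl
        eq false false true  = refl
        eq false false false = refl
      merge : Fin n → Fin n
      merge c = if does (c ≟ comp b) then comp a else c
      comp′ : Fin n → Fin n
      comp′ v = merge (comp v)
      comp′-in : ∀ v → comp v ≡ comp b → comp′ v ≡ comp a
      comp′-in v eq = trans (cong merge eq) (cong (if_then comp a else comp b) (≟-refl (comp b)))
      comp′-out : ∀ v → comp v ≢ comp b → comp′ v ≡ comp v
      comp′-out v ne = cong (if_then comp a else comp v) (≟-false ne)
      path′ : ∀ u w → comp′ u ≡ comp′ w → Σ (SimplePath G u w) λ p →
                ∀ v → SimplePath.vertices p v ≡ true → comp′ v ≡ comp′ u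
      path′ u w eq with comp u ≟ comp w
      ... | yes same = tail-path (proj₁ (path u w same)) , λ v q → cong merge (proj₂ (path u w same) v q)
      ... | no  ne with comp u ≟ comp b | comp w ≟ comp b
      ... | yes ub | yes wb = ⊥-elim (ne (trans ub (sym wb)))
      ... | no  u≁ | no  w≁ = ⊥-elim (ne eq)
      ... | yes ub | no  w≁ =
        join (zero , refl , inj₂ (refl , refl)) (λ v → ℕ.+-comm (ind (does (a ≟ v))) _) (proj₁ pu) (proj₁ pw)
             (λ v p q → diff (trans (sym (proj₂ pw v q)) (trans (proj₂ pu v p) ub))) , inside
        where
        pu : _
        pu = path u b ub
        pw : _
        pw = path a w eq
        inside : ∀ v → SimplePath.vertices (proj₁ pu) v ∨ SimplePath.vertices (proj₁ pw) v ≡ true → comp′ v ≡ comp a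
        inside v q with SimplePath.vertices (proj₁ pu) v in pv
        ... | true  = comp′-in v (trans (proj₂ pu v pv) ub)
        ... | false = trans (comp′-out v (λ eq → diff (trans (sym (proj₂ pw v q)) eq))) (proj₂ pw v q)
      ... | no  u≁ | yes wb =
        join (zero , refl , inj₁ (refl , refl)) (λ v → refl) (proj₁ pu) (proj₁ pw)
             (λ v p q → diff (trans (sym eq) (trans (sym (proj₂ pu v p)) (proj₂ pw v q)))) , inside
        where
        pu : _
        pu = path u a eq
        pw : _
        pw = path b w (sym wb)
        inside : ∀ v → SimplePath.vertices (proj₁ pu) v ∨ SimplePath.vertices (proj₁ pw) v ≡ true → comp′ v ≡ comp u
        inside v q with SimplePath.vertices (proj₁ pu) v in pv
        ... | true  = trans (comp′-out v (λ e → diff (trans (sym eq) (trans (sym (proj₂ pu v pv)) e)))) (proj₂ pu v pv)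
        ... | false = trans (comp′-in v (proj₂ pw v q)) (sym eq)

-- Harary's characterisation of balance in a constructive form: the failure of a potential is
-- witnessed by an explicit unbalanced circuit.
forest : ∀ {n} m (G : SignedGraph n m) → Forest G ⊎ Σ (EdgeSet m) λ S → Circuit G S × odd? (negCount G S) ≡ true
forest {n} zero G = inj₁ record
  { φ = λ _ → false ; potential = λ () ; comp = λ v → v ; comp-edge = λ ()
  ; path = λ { u w refl → record { edges = λ () ; vertices = λ v → does (u ≟ v)
                                 ; degrees = λ v → cong (ind (does (u ≟ v)) +_) (sym (ℕ.+-identityʳ _))
                                 ; joined = λ v eq → subst (Walk G (λ ()) u) (≟-true eq) ε }
                        , λ v eq → sym (≟-true eq) } }
forest (suc m) G with forest m (tail G)
... | inj₁ F              = grow-forest G F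
... | inj₂ (S , c , odd) = inj₂ (false ∷ˢ S , tail-circuit G c , odd)

balanced⇒potential : ∀ {n m} (G : SignedGraph n m) → Balanced G → Σ (Fin n → Bool) (Potential G)
balanced⇒potential {m = m} G bal with forest m G
... | inj₁ F              = Forest.φ F , Forest.potential F
... | inj₂ (S , c , odd) with () ← trans (sym odd) (even⇒odd?≡false (bal S c))

-- Covering the universal cover of a closed walk by balanced arcs

-- The indicator of `k < b`. The indicator of an arc is a difference of two of these, and each of
-- them telescopes.
H : ℕ → ℕ → ℤ
H zero    _       = 0ℤ
H (suc b) zero    = 1ℤ
H (suc b) (suc k) = H b k

H-< : ∀ {b k} → k < b → H b k ≡ 1ℤ
H-< {suc b} {zero}  _         = refl
H-< {suc b} {suc k} (s≤s k<b) = H-< k<b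

H-≥ : ∀ {b k} → b ≤ k → H b k ≡ 0ℤ
H-≥ {zero}  {k}     _         = refl
H-≥ {suc b} {suc k} (s≤s b≤k) = H-≥ b≤k

sumTo : ℕ → (ℕ → ℤ) → ℤ
sumTo zero    f = 0ℤ
sumTo (suc N) f = f zero ℤ.+ sumTo N (f ∘ suc)

sumTo-cong : ∀ N {f g} → (∀ k → k < N → f k ≡ g k) → sumTo N f ≡ sumTo N g
sumTo-cong zero    eq = refl
sumTo-cong (suc N) eq = cong₂ ℤ._+_ (eq 0 (s≤s z≤n)) (sumTo-cong N (λ k k<N → eq (suc k) (s≤s k<N)))

sumTo-0 : ∀ N → sumTo N (λ _ → 0ℤ) ≡ 0ℤ
sumTo-0 zero    = refl
sumTo-0 (suc N) = trans (ℤ.+-identityˡ _) (sumTo-0 N)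

sumTo-+ : ∀ N f g → sumTo N (λ k → f k ℤ.+ g k) ≡ sumTo N f ℤ.+ sumTo N g
sumTo-+ zero    f g = refl
sumTo-+ (suc N) f g = trans (cong₂ ℤ._+_ (refl {x = f 0 ℤ.+ g 0}) (sumTo-+ N (f ∘ suc) (g ∘ suc)))
                            (ℤ+.interchange (f 0) (g 0) _ _)

sumTo-* : ∀ N a f → sumTo N (λ k → a ℤ.* f k) ≡ a ℤ.* sumTo N f
sumTo-* zero    a f = sym (ℤ.*-zeroʳ a)
sumTo-* (suc N) a f = trans (cong₂ ℤ._+_ (refl {x = a ℤ.* f 0}) (sumTo-* N a (f ∘ suc)))
                            (sym (ℤ.*-distribˡ-+ a (f 0) _))

sumTo-telescope : ∀ N b (X : ℕ → ℤ) → b ≤ N → sumTo N (λ k → H b k ℤ.* (X k ℤ.- X (suc k))) ≡ X 0 ℤ.- X b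
sumTo-telescope N zero X _ = trans (trans (sumTo-cong N (λ k _ → ℤ.*-zeroˡ (X k ℤ.- X (suc k)))) (sumTo-0 N)) (sym (ℤ.+-inverseʳ (X 0)))
sumTo-telescope (suc N) (suc b) X (s≤s b≤N) =
  trans (cong₂ ℤ._+_ (ℤ.*-identityˡ (X 0 ℤ.- X 1)) (sumTo-telescope N b (X ∘ suc) b≤N))
        (lemma (X 0) (X 1) (X (suc b)))
  where
  lemma : ∀ x y z → (x ℤ.- y) ℤ.+ (y ℤ.- z) ≡ x ℤ.- z
  lemma = ℤS.solve-∀

maxBelow : ∀ {P : ℕ → Set} → (∀ b → Dec (P b)) → ∀ N → (∃ λ b → b < N × P b) →
           ∃ λ b → P b × (∀ b′ → b′ < N → P b′ → b′ ≤ b)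
maxBelow {P} P? (suc N) (b , s≤s b≤N , Pb) with P? N
... | yes PN = N , PN , λ { b′ (s≤s b′≤N) _ → b′≤N }
... | no ¬PN with maxBelow P? N (b , ℕ.≤∧≢⇒< b≤N (λ { refl → ¬PN Pb }) , Pb)
... | c , Pc , max = c , Pc , λ b′ b′<1+N Pb′ → max b′ (ℕ.≤∧≢⇒< (ℕ.≤-pred b′<1+N) (λ { refl → ¬PN Pb′ })) Pb′

Small : ℤ → Set
Small x = x ≢ 0ℤ × ∣ x ∣ < 4

State : ℕ → Set
State n = Fin n × Bool

flip : ∀ {n} → State n → State n
flip (v , s) = v , not s

flip-injective : ∀ {n} {σ ρ : State n} → flip σ ≡ flip ρ → σ ≡ ρ
flip-injective {σ = v , s} {w , t} eq = cong₂ _,_ (cong proj₁ eq) (Bool.not-injective (cong proj₂ eq))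

_≟ˢ_ : ∀ {n} (σ ρ : State n) → Dec (σ ≡ ρ)
_≟ˢ_ = ≡-dec _≟_ _≟ᵇ_

sg : Bool → ℤ
sg true  = - 1ℤ
sg false = 1ℤ

∣sg*∣ : ∀ s x → ∣ sg s ℤ.* x ∣ ≡ ∣ x ∣
∣sg*∣ true  x = trans (cong ∣_∣ (ℤ.-1*i≡-i x)) (ℤ.∣-i∣≡∣i∣ x)
∣sg*∣ false x = cong ∣_∣ (ℤ.*-identityˡ x)

module Cover {n : ℕ} (M : ℕ) (st : ℕ → State n) (st-M : ∀ k → st (k + M) ≡ flip (st k)) where

  -- Equal states make the stretch a balanced closed trail; the bound `b < a + M` keeps it from
  -- using an edge twice.
  Arc : ℕ → ℕ → Set
  Arc a b = a < b × b < a + M × st a ≡ st b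

  Cov : ℕ → ℕ → Set
  Cov p b = ∃ λ a → a < suc p × p < b × Arc a b

  -- The bound on `b` makes the search finite, and by `cov-bound` it excludes no arc.
  Covered : ℕ → Set
  Covered p = ∃ λ b → b < suc (p + M) × Cov p b

  cov? : ∀ p b → Dec (Cov p b)
  cov? p b = ℕ.anyUpTo? (λ a → (p ℕ.<? b) ×-dec ((a ℕ.<? b) ×-dec ((b ℕ.<? a + M) ×-dec (st a ≟ˢ st b)))) (suc p)

  covered? : ∀ p → Dec (Covered p)
  covered? p = ℕ.anyUpTo? (cov? p) (suc (p + M))

  cov-bound : ∀ {p b} → Cov p b → b < suc (p + M)
  cov-bound (a , a≤p , _ , _ , b< , _) = ℕ.m≤n⇒m≤1+n (ℕ.≤-trans b< (ℕ.+-monoˡ-≤ M (ℕ.≤-pred a≤p)))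

  furthest : ∀ p → Covered p → ∃ λ b → Cov p b × (∀ b′ → Cov p b′ → b′ ≤ b)
  furthest p c with maxBelow (cov? p) (suc (p + M)) c
  ... | b , cov , max = b , cov , λ b′ cov′ → max b′ (cov-bound cov′) cov′

  X : Fin n → State n → ℤ
  X v (w , s) = if does (w ≟ v) then sg s else 0ℤ

  -- Conservation on the cover: step `k` leaves one state and enters the next with the value `c k`.
  -- Four periods are enough, as the chain starts before `2 * M` and extends over at most two
  -- periods.
  Balancedᶜ : (ℕ → ℤ) → Set
  Balancedᶜ c = ∀ v → sumTo (4 * M) (λ k → c k ℤ.* (X v (st k) ℤ.- X v (st (suc k)))) ≡ 0ℤ

  arcf : ℕ → ℕ → ℕ → ℤ
  arcf a b k = H b k ℤ.- H a k

  arcf-in : ∀ {a b k} → a ≤ k → k < b → arcf a b k ≡ 1ℤ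
  arcf-in a≤k k<b = cong₂ ℤ._-_ (H-< k<b) (H-≥ a≤k)

  arcf-left : ∀ {a b k} → a ≤ b → k < a → arcf a b k ≡ 0ℤ
  arcf-left a≤b k<a = cong₂ ℤ._-_ (H-< (ℕ.<-≤-trans k<a a≤b)) (H-< k<a)

  arcf-right : ∀ {a b k} → a ≤ b → b ≤ k → arcf a b k ≡ 0ℤ
  arcf-right a≤b b≤k = cong₂ ℤ._-_ (H-≥ b≤k) (H-≥ (ℕ.≤-trans a≤b b≤k))

  balanced-arc : ∀ {a b} → Arc a b → b ≤ 4 * M → Balancedᶜ (arcf a b)
  balanced-arc {a} {b} (a<b , _ , eq) b≤ v = begin
    sumTo N (λ k → arcf a b k ℤ.* Y k)
      ≡⟨ sumTo-cong N (λ k _ → expand (H b k) (H a k) (Y k)) ⟩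
    sumTo N (λ k → H b k ℤ.* Y k ℤ.+ - 1ℤ ℤ.* (H a k ℤ.* Y k))
      ≡⟨ sumTo-+ N _ _ ⟩
    sumTo N (λ k → H b k ℤ.* Y k) ℤ.+ sumTo N (λ k → - 1ℤ ℤ.* (H a k ℤ.* Y k))
      ≡⟨ cong₂ ℤ._+_ (sumTo-telescope N b Xk b≤)
           (trans (sumTo-* N (- 1ℤ) _) (cong (- 1ℤ ℤ.*_) (sumTo-telescope N a Xk (ℕ.≤-trans (ℕ.<⇒≤ a<b) b≤)))) ⟩
    (Xk 0 ℤ.- Xk b) ℤ.+ - 1ℤ ℤ.* (Xk 0 ℤ.- Xk a)
      ≡⟨ cong (λ y → (Xk 0 ℤ.- Xk b) ℤ.+ - 1ℤ ℤ.* (Xk 0 ℤ.- y)) (cong (X v) eq) ⟩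
    (Xk 0 ℤ.- Xk b) ℤ.+ - 1ℤ ℤ.* (Xk 0 ℤ.- Xk b)
      ≡⟨ cancel (Xk 0 ℤ.- Xk b) ⟩
    0ℤ ∎
    where
    open ≡-Reasoning
    N : ℕ
    N = 4 * M
    Xk Y : ℕ → ℤ
    Xk k = X v (st k)
    Y k  = Xk k ℤ.- Xk (suc k)
    expand : ∀ x y z → (x ℤ.- y) ℤ.* z ≡ x ℤ.* z ℤ.+ - 1ℤ ℤ.* (y ℤ.* z)
    expand = ℤS.solve-∀
    cancel : ∀ x → x ℤ.+ - 1ℤ ℤ.* x ≡ 0ℤ
    cancel = ℤS.solve-∀

  balanced-+ : ∀ {c c′} x → Balancedᶜ c → Balancedᶜ c′ → Balancedᶜ (λ k → c k ℤ.+ x ℤ.* c′ k)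
  balanced-+ {c} {c′} x p q v =
    trans (sumTo-cong (4 * M) (λ k _ → expand (c k) x (c′ k) (X v (st k) ℤ.- X v (st (suc k)))))
      (trans (sumTo-+ (4 * M) _ _)
        (cong₂ ℤ._+_ (p v) (trans (sumTo-* (4 * M) x _) (trans (cong (x ℤ.*_) (q v)) (ℤ.*-zeroʳ x)))))
    where
    expand : ∀ a b d e → (a ℤ.+ b ℤ.* d) ℤ.* e ≡ a ℤ.* e ℤ.+ b ℤ.* (d ℤ.* e)
    expand = ℤS.solve-∀

  -- Links E p q z continues a chain of arcs whose current end is q until it reaches z ≥ E;
  -- p is the previous end, before which no further arc may start.
  data Links (E : ℕ) : ℕ → ℕ → ℕ → Set where
    last : ∀ {p q} a z → Arc a z → p ≤ a → a ≤ q → q < E → E ≤ z → Links E p q z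
    more : ∀ {p q z} a b → Arc a b → p ≤ a → a ≤ q → q < b → b < E → Links E q b z → Links E p q z

  firstStart : ∀ {E p q z} → Links E p q z → ℕ
  firstStart (last a _ _ _ _ _ _)     = a
  firstStart (more a _ _ _ _ _ _ _)   = a

  firstStart-≥ : ∀ {E p q z} (L : Links E p q z) → p ≤ firstStart L
  firstStart-≥ (last _ _ _ p≤a _ _ _)   = p≤a
  firstStart-≥ (more _ _ _ p≤a _ _ _ _) = p≤a

  firstStart-≤ : ∀ {E p q z} (L : Links E p q z) → firstStart L ≤ q
  firstStart-≤ (last _ _ _ _ a≤q _ _)   = a≤q
  firstStart-≤ (more _ _ _ _ a≤q _ _ _) = a≤q

  raise : ∀ {E E′ p q z} → E ≤ E′ → E′ ≤ z → Links E p q z → Links E′ p q z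
  raise E≤ ≤z (last a z arc l r q<E _)     = last a z arc l r (ℕ.<-≤-trans q<E E≤) ≤z
  raise E≤ ≤z (more a b arc l r q<b b<E L) = more a b arc l r q<b (ℕ.<-≤-trans b<E E≤) (raise E≤ ≤z L)

  weaken : ∀ {E p p′ q z} → p′ ≤ p → Links E p q z → Links E p′ q z
  weaken p′≤p (last a z arc l r q<E E≤z)   = last a z arc (ℕ.≤-trans p′≤p l) r q<E E≤z
  weaken p′≤p (more a b arc l r q<b b<E L) = more a b arc (ℕ.≤-trans p′≤p l) r q<b b<E L

  -- Neighbouring arcs get different weights with sum 3: on an overlap neither the sum nor the
  -- difference vanishes, and both stay below 4 in absolute value.
  weight : Bool → ℤ
  weight false = 1ℤ
  weight true  = ℤ.+ 2

  module _ (a₀ : ℕ) (a₀< : a₀ < 2 * M) where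

    E : ℕ
    E = a₀ + M

    -- The state of the construction after an arc of weight `κ` ending at `q`; from `p` on only this
    -- arc counts. Before `r` the first arc is alone with its weight 1, which leaves room there for
    -- the overrun of the last arc.
    record Partial (p q : ℕ) (κ : Bool) (r : ℕ) : Set where
      field
        c        : ℕ → ℤ
        balanced : Balancedᶜ c
        initial  : ∀ k → a₀ ≤ k → k < r → c k ≡ 1ℤ
        small    : ∀ k → a₀ ≤ k → k < q → Small (c k)
        current  : ∀ k → p ≤ k → k < q → c k ≡ weight κ
        before   : ∀ k → k < a₀ → c k ≡ 0ℤ
        after    : ∀ k → q ≤ k → c k ≡ 0ℤ

    -- Positions `k` and `k + M` are the same edge with opposite accumulated signs, so the
    -- difference of their coefficients is what the flow sees.
    record Complete (z : ℕ) : Set where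
      field
        c        : ℕ → ℤ
        balanced : Balancedᶜ c
        before   : ∀ k → k < a₀ → c k ≡ 0ℤ
        after    : ∀ k → z ≤ k → c k ≡ 0ℤ
        small    : ∀ k → a₀ ≤ k → k < E → Small (c k ℤ.- c (k + M))

    E≤3M : E ≤ 3 * M
    E≤3M = ℕ.≤-trans (ℕ.+-monoˡ-≤ M (ℕ.<⇒≤ a₀<)) (ℕ.≤-reflexive (ℕ.+-comm (2 * M) M))

    step-sum : ∀ κ → Small (weight κ ℤ.+ weight (not κ) ℤ.* 1ℤ)
    step-sum true  = (λ ()) , ℕ.≤-refl
    step-sum false = (λ ()) , ℕ.≤-refl

    step-new : ∀ κ → Small (weight κ)
    step-new true  = (λ ()) , s≤s (s≤s (s≤s z≤n))
    step-new false = (λ ()) , s≤s (s≤s z≤n)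

    last-sum : ∀ κ → Small ((weight κ ℤ.+ - weight (not κ) ℤ.* 1ℤ) ℤ.- 0ℤ)
    last-sum true  = (λ ()) , s≤s (s≤s z≤n)
    last-sum false = (λ ()) , s≤s (s≤s z≤n)

    last-new : ∀ κ → Small ((0ℤ ℤ.+ - weight κ ℤ.* 1ℤ) ℤ.- 0ℤ)
    last-new true  = (λ ()) , s≤s (s≤s (s≤s z≤n))
    last-new false = (λ ()) , s≤s (s≤s z≤n)

    last-wrap : ∀ κ → Small ((1ℤ ℤ.+ - weight κ ℤ.* 0ℤ) ℤ.- (0ℤ ℤ.+ - weight κ ℤ.* 1ℤ))
    last-wrap true  = (λ ()) , ℕ.≤-refl
    last-wrap false = (λ ()) , s≤s (s≤s (s≤s z≤n))

    +0* : ∀ x y → x ℤ.+ y ℤ.* 0ℤ ≡ x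
    +0* = ℤS.solve-∀

    0+*1 : ∀ y → 0ℤ ℤ.+ y ℤ.* 1ℤ ≡ y
    0+*1 = ℤS.solve-∀

    complete : ∀ {p q z κ r} → a₀ ≤ p → p ≤ q → Partial p q κ r → (L : Links E p q z) → r ≤ firstStart L → z ≤ r + M → Complete z
    complete {p} {q} {z} {κ} {r} a₀≤p p≤q P (more a b arc p≤a a≤q q<b b<E L) r≤a z≤ =
      complete (ℕ.≤-trans a₀≤p p≤q) (ℕ.<⇒≤ q<b) P′ L (ℕ.≤-trans r≤a (ℕ.≤-trans a≤q (firstStart-≥ L))) z≤
      where
      open Partial P
      a≤b : a ≤ b
      a≤b = ℕ.<⇒≤ (proj₁ arc)
      x : ℤ
      x = weight (not κ)
      c′ : ℕ → ℤ
      c′ k = c k ℤ.+ x ℤ.* arcf a b k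
      left : ∀ k → k < a → c′ k ≡ c k
      left k k<a = trans (cong (λ y → c k ℤ.+ x ℤ.* y) (arcf-left a≤b k<a)) (+0* (c k) x)
      new : ∀ k → q ≤ k → k < b → c′ k ≡ weight (not κ)
      new k q≤k k<b = trans (cong₂ (λ s t → s ℤ.+ x ℤ.* t) (after k q≤k) (arcf-in (ℕ.≤-trans a≤q q≤k) k<b)) (0+*1 x)
      small′ : ∀ k → a₀ ≤ k → k < b → Small (c′ k)
      small′ k a₀≤k k<b with k ℕ.<? a
      ... | yes k<a = subst Small (sym (left k k<a)) (small k a₀≤k (ℕ.<-≤-trans k<a a≤q))
      ... | no  k≮a with k ℕ.<? q
      ... | yes k<q = subst Small (sym (cong₂ (λ s t → s ℤ.+ x ℤ.* t) (current k (ℕ.≤-trans p≤a (ℕ.≮⇒≥ k≮a)) k<q)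
                                                                       (arcf-in (ℕ.≮⇒≥ k≮a) k<b))) (step-sum κ)
      ... | no  k≮q = subst Small (sym (new k (ℕ.≮⇒≥ k≮q) k<b)) (step-new (not κ))
      P′ : Partial q b (not κ) r
      P′ = record
        { c        = c′
        ; balanced = balanced-+ {c} {arcf a b} x balanced (balanced-arc arc (ℕ.≤-trans (ℕ.<⇒≤ b<E) (ℕ.≤-trans E≤3M (ℕ.*-monoˡ-≤ M (ℕ.n≤1+n 3)))))
        ; initial  = λ k a₀≤k k<r → trans (left k (ℕ.<-≤-trans k<r r≤a)) (initial k a₀≤k k<r)
        ; small    = small′
        ; current  = new
        ; before   = λ k k<a₀ → trans (left k (ℕ.<-≤-trans k<a₀ (ℕ.≤-trans a₀≤p p≤a))) (before k k<a₀)
        ; after    = λ k b≤k → trans (cong₂ (λ s t → s ℤ.+ x ℤ.* t) (after k (ℕ.≤-trans (ℕ.<⇒≤ q<b) b≤k)) (arcf-right a≤b b≤k)) (+0* 0ℤ x)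
        }
    complete {p} {q} {z} {κ} {r} a₀≤p p≤q P (last a .z arc p≤a a≤q q<E E≤z) r≤a z≤ = record
      { c        = c′
      ; balanced = balanced-+ {c} {arcf a z} x balanced (balanced-arc arc z≤4M)
      ; before   = λ k k<a₀ → trans (left k (ℕ.<-≤-trans k<a₀ (ℕ.≤-trans a₀≤p p≤a))) (before k k<a₀)
      ; after    = right
      ; small    = small′
      }
      where
      open Partial P
      a≤z : a ≤ z
      a≤z = ℕ.<⇒≤ (proj₁ arc)
      x : ℤ
      -- The last arc is negated. On the overlap with its predecessor the weights 1 and 2 then
      -- differ by one, and on its overrun, which returns to the first arc with reversed sign, they
      -- add up to 2 or 3. This works for either parity of the number of arcs.
      x = - weight (not κ)
      c′ : ℕ → ℤ
      c′ k = c k ℤ.+ x ℤ.* arcf a z k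
      z≤4M : z ≤ 4 * M
      z≤4M = ℕ.≤-trans (ℕ.<⇒≤ (proj₁ (proj₂ arc)))
               (ℕ.≤-trans (ℕ.+-monoˡ-≤ M (ℕ.≤-trans a≤q (ℕ.≤-trans (ℕ.<⇒≤ q<E) E≤3M))) (ℕ.≤-reflexive (ℕ.+-comm (3 * M) M)))
      left : ∀ k → k < a → c′ k ≡ c k
      left k k<a = trans (cong (λ y → c k ℤ.+ x ℤ.* y) (arcf-left a≤z k<a)) (+0* (c k) x)
      right : ∀ k → z ≤ k → c′ k ≡ 0ℤ
      right k z≤k = trans (cong₂ (λ s t → s ℤ.+ x ℤ.* t) (after k (ℕ.≤-trans (ℕ.<⇒≤ q<E) (ℕ.≤-trans E≤z z≤k))) (arcf-right a≤z z≤k)) (+0* 0ℤ x)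
      small′ : ∀ k → a₀ ≤ k → k < E → Small (c′ k ℤ.- c′ (k + M))
      small′ k a₀≤k k<E with k + M ℕ.<? z
      ... | yes wraps = subst Small (sym (cong₂ ℤ._-_
              (cong₂ (λ s t → s ℤ.+ x ℤ.* t) (initial k a₀≤k k<r) (arcf-left a≤z (ℕ.<-≤-trans k<r r≤a)))
              (cong₂ (λ s t → s ℤ.+ x ℤ.* t) (after (k + M) (ℕ.≤-trans (ℕ.<⇒≤ q<E) E≤k+M)) (arcf-in (ℕ.≤-trans a≤q (ℕ.≤-trans (ℕ.<⇒≤ q<E) E≤k+M)) wraps))))
              (last-wrap (not κ))
        where
        k<r : k < r
        k<r = ℕ.+-cancelʳ-< M k r (ℕ.<-≤-trans wraps z≤)
        E≤k+M : E ≤ k + M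
        E≤k+M = ℕ.+-monoˡ-≤ M a₀≤k
      ... | no k+M≮z with k ℕ.<? a
      ... | yes k<a = subst Small (sym (trans (cong₂ ℤ._-_ (left k k<a) (right (k + M) (ℕ.≮⇒≥ k+M≮z))) (ℤ.+-identityʳ (c k))))
                            (small k a₀≤k (ℕ.<-≤-trans k<a a≤q))
      ... | no  k≮a with k ℕ.<? q
      ... | yes k<q = subst Small (sym (cong₂ ℤ._-_ (cong₂ (λ s t → s ℤ.+ x ℤ.* t) (current k (ℕ.≤-trans p≤a (ℕ.≮⇒≥ k≮a)) k<q)
                                                                       (arcf-in (ℕ.≮⇒≥ k≮a) (ℕ.<-≤-trans k<E E≤z))) (right (k + M) (ℕ.≮⇒≥ k+M≮z)))) (last-sum κ)
      ... | no  k≮q = subst Small (sym (cong₂ ℤ._-_ (cong₂ (λ s t → s ℤ.+ x ℤ.* t) (after k (ℕ.≮⇒≥ k≮q))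
                                                                       (arcf-in (ℕ.≮⇒≥ k≮a) (ℕ.<-≤-trans k<E E≤z))) (right (k + M) (ℕ.≮⇒≥ k+M≮z)))) (last-new (not κ))

    start : ∀ {b₀ z} → Arc a₀ b₀ → (L : Links E a₀ b₀ z) → z ≤ firstStart L + M → Complete z
    start {b₀} arc L z≤ = complete ℕ.≤-refl a₀≤b₀ P L ℕ.≤-refl z≤
      where
      a₀≤b₀ : a₀ ≤ b₀
      a₀≤b₀ = ℕ.<⇒≤ (proj₁ arc)
      P : Partial a₀ b₀ false (firstStart L)
      P = record
        { c        = arcf a₀ b₀
        ; balanced = balanced-arc arc (ℕ.≤-trans (ℕ.<⇒≤ (proj₁ (proj₂ arc))) (ℕ.≤-trans E≤3M (ℕ.*-monoˡ-≤ M (ℕ.n≤1+n 3))))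
        ; initial  = λ k a₀≤k k<r → arcf-in a₀≤k (ℕ.<-≤-trans k<r (firstStart-≤ L))
        ; small    = λ k a₀≤k k<b → subst Small (sym (arcf-in a₀≤k k<b)) ((λ ()) , s≤s (s≤s z≤n))
        ; current  = λ k a₀≤k k<b → arcf-in a₀≤k k<b
        ; before   = λ k k<a₀ → arcf-left a₀≤b₀ k<a₀
        ; after    = λ k b₀≤k → arcf-right a₀≤b₀ b₀≤k
        }

  module _ (covered : ∀ p → M ≤ p → p < 2 * M → Covered p) (0<M : 0 < M) where

    Furthest : ℕ → ℕ → Set
    Furthest p q = ∀ b → Cov p b → b ≤ q

    M<2M : M < 2 * M
    M<2M = ℕ.m<m+n M (ℕ.<-≤-trans 0<M (ℕ.m≤m+n M 0))

    shift-arc : ∀ {a b} → M ≤ a → Arc a b → Arc (a ∸ M) (b ∸ M)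
    shift-arc {a} {b} M≤a (a<b , b<a+M , eq) =
      ℕ.∸-monoˡ-< a<b M≤a ,
      ℕ.<-≤-trans (ℕ.∸-monoˡ-< b<a+M M≤b) (ℕ.≤-reflexive (ℕ.+-∸-comm M M≤a)) ,
      flip-injective (trans (sym (st-M (a ∸ M))) (trans (cong st (ℕ.m∸n+n≡m M≤a))
        (trans eq (trans (cong st (sym (ℕ.m∸n+n≡m M≤b))) (st-M (b ∸ M))))))
      where
      M≤b : M ≤ b
      M≤b = ℕ.≤-trans M≤a (ℕ.<⇒≤ a<b)

    -- Taking the furthest arc each time makes every arc start after the end of the last but one.
    greedy : ∀ {E b₀} → E ≤ 2 * M → M < b₀ → Furthest M b₀ → ∀ fuel {p q} → E ∸ q ≤ fuel → M ≤ p → p ≤ q → q < E → Furthest p q →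
             ∃ λ z → Links E p q z × z ≤ b₀ + M
    greedy {E} {b₀} E≤2M M<b₀ far₀ fuel {p} {q} fuel≥ M≤p p≤q q<E far
      with furthest q (covered q (ℕ.≤-trans M≤p p≤q) (ℕ.<-≤-trans q<E E≤2M))
    ... | b , (a , a≤q , q<b , arc) , far′ with b ℕ.<? E
    ... | no b≮E = b , last a b arc (ℕ.<⇒≤ p<a) (ℕ.≤-pred a≤q) q<E (ℕ.≮⇒≥ b≮E) , bound
      where
      p<a : p < a
      p<a = ℕ.≰⇒> λ a≤p → ℕ.<⇒≱ q<b (far b (a , s≤s a≤p , ℕ.≤-<-trans p≤q q<b , arc))
      -- If the last arc passes `2 * M`, its translate one period back covers position `M` and so
      -- ends no later than `b₀`, the furthest end of such an arc.
      bound : b ≤ b₀ + M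
      bound with 2 * M ℕ.<? b
      ... | no  b≤2M = ℕ.≤-trans (ℕ.≮⇒≥ b≤2M) (ℕ.≤-trans (ℕ.≤-reflexive (cong (M +_) (ℕ.+-identityʳ M))) (ℕ.+-monoˡ-≤ M (ℕ.<⇒≤ M<b₀)))
      ... | yes 2M<b = ℕ.≤-trans (ℕ.m≤n+m∸n b M) (ℕ.≤-trans (ℕ.≤-reflexive (ℕ.+-comm M (b ∸ M)))
              (ℕ.+-monoˡ-≤ M (far₀ (b ∸ M) (a ∸ M , s≤s a∸M≤M , M<b∸M , shift-arc (ℕ.≤-trans M≤p (ℕ.<⇒≤ p<a)) arc))))
        where
        2M : 2 * M ≡ M + M
        2M = cong (M +_) (ℕ.+-identityʳ M)
        a∸M≤M : a ∸ M ≤ M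
        a∸M≤M = ℕ.≤-trans (ℕ.∸-monoˡ-≤ M (ℕ.≤-trans (ℕ.≤-pred a≤q) (ℕ.≤-trans (ℕ.<⇒≤ q<E) (ℕ.≤-trans E≤2M (ℕ.≤-reflexive 2M)))))
                          (ℕ.≤-reflexive (ℕ.m+n∸n≡m M M))
        M<b∸M : M < b ∸ M
        M<b∸M = ℕ.≤-trans (ℕ.≤-reflexive (sym (ℕ.m+n∸n≡m (suc M) M)))
                          (ℕ.∸-monoˡ-≤ M (ℕ.≤-trans (ℕ.≤-reflexive (cong suc (sym 2M))) 2M<b))
    greedy {E} E≤2M M<b₀ far₀ zero {p} {q} fuel≥ M≤p p≤q q<E far | b , (a , a≤q , q<b , arc) , far′ | yes b<E =
      ⊥-elim (ℕ.<⇒≱ q<E (ℕ.m∸n≡0⇒m≤n (ℕ.n≤0⇒n≡0 fuel≥)))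
    greedy {E} E≤2M M<b₀ far₀ (suc fuel) {p} {q} fuel≥ M≤p p≤q q<E far | b , (a , a≤q , q<b , arc) , far′ | yes b<E
      with greedy E≤2M M<b₀ far₀ fuel {q} {b} (ℕ.≤-pred (ℕ.≤-trans (ℕ.∸-monoʳ-< q<b (ℕ.<⇒≤ b<E)) fuel≥))
                  (ℕ.≤-trans M≤p p≤q) (ℕ.<⇒≤ q<b) b<E far′
    ... | z , L , z≤ = z , more a b arc (ℕ.<⇒≤ (ℕ.≰⇒> λ a≤p → ℕ.<⇒≱ q<b (far b (a , s≤s a≤p , ℕ.≤-<-trans p≤q q<b , arc))))
                              (ℕ.≤-pred a≤q) q<b b<E L , z≤

    -- Beginning with position `M` instead of 0 leaves room for the first arc to start up to a
    -- period earlier.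
    cover : ∃ λ a₀ → ∃ λ z → Σ (a₀ < 2 * M) λ a₀< → z ≤ a₀ + 2 * M × Complete a₀ a₀< z
    cover with furthest M (covered M ℕ.≤-refl M<2M)
    ... | b₀ , (a₀ , a₀≤M , M<b₀ , arc) , far₀
      with greedy {a₀ + M} {b₀} (ℕ.≤-trans (ℕ.+-monoˡ-≤ M (ℕ.≤-pred a₀≤M)) (ℕ.≤-reflexive (cong (M +_) (sym (ℕ.+-identityʳ M))))) M<b₀ far₀
             (a₀ + M ∸ b₀) {M} {b₀} ℕ.≤-refl ℕ.≤-refl (ℕ.<⇒≤ M<b₀) (proj₁ (proj₂ arc)) far₀
    ... | z , L , z≤ = choose L (z ℕ.≤? firstStart L + M)
      where
      finish : ∀ {a b} (a< : a < 2 * M) → Arc a b → (K : Links (a + M) a b z) → z ≤ firstStart K + M → ∃ λ a₀ → ∃ λ z → Σ (a₀ < 2 * M) λ a₀< → z ≤ a₀ + 2 * M × Complete a₀ a₀< z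
      finish {a} a< arc K z≤ = a , z , a< , ℕ.≤-trans z≤ (ℕ.≤-trans (ℕ.+-monoˡ-≤ M (ℕ.≤-trans (firstStart-≤ K) (ℕ.<⇒≤ (proj₁ (proj₂ arc)))))
          (ℕ.≤-reflexive (trans (ℕ.+-assoc a M M) (cong (λ y → a + (M + y)) (sym (ℕ.+-identityʳ M)))))) , start a a< arc K z≤
      choose : (L : Links (a₀ + M) M b₀ z) → Dec (z ≤ firstStart L + M) → ∃ λ a₀ → ∃ λ z → Σ (a₀ < 2 * M) λ a₀< → z ≤ a₀ + 2 * M × Complete a₀ a₀< z
      choose L (yes z≤a₁+M) = finish (ℕ.≤-<-trans (ℕ.≤-pred a₀≤M) M<2M) arc (weaken (ℕ.≤-pred a₀≤M) L) (subst (λ y → z ≤ y + M) (same L) z≤a₁+M)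
        where
        same : ∀ L → firstStart L ≡ firstStart (weaken (ℕ.≤-pred a₀≤M) L)
        same (last _ _ _ _ _ _ _)   = refl
        same (more _ _ _ _ _ _ _ _) = refl
      choose (last a _ arc₁ _ _ _ _) (no z≰) = ⊥-elim (z≰ (ℕ.<⇒≤ (proj₁ (proj₂ arc₁))))
      -- The last arc runs past `a₁ + M`, so the arcs from the second one on already cover a period
      -- starting at `a₁`. The arc that is now second starts at or after `b₀`, and the overrun ends
      -- by `b₀ + M`, hence does not reach it.
      choose (more a₁ b₁ arc₁ M≤a₁ a₁≤b₀ b₀<b₁ b₁<E K) (no z≰) =
        finish (ℕ.≤-<-trans a₁≤b₀ b₀<2M) arc₁
          (weaken a₁≤b₀ (raise (ℕ.+-monoˡ-≤ M (ℕ.≤-trans (ℕ.≤-pred a₀≤M) M≤a₁)) (ℕ.<⇒≤ (ℕ.≰⇒> z≰)) K))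
          (ℕ.≤-trans z≤ (ℕ.+-monoˡ-≤ M (firstStart-≥′ K)))
        where
        b₀<2M : b₀ < 2 * M
        b₀<2M = ℕ.<-≤-trans (proj₁ (proj₂ arc)) (ℕ.≤-trans (ℕ.+-monoˡ-≤ M (ℕ.≤-pred a₀≤M)) (ℕ.≤-reflexive (cong (M +_) (sym (ℕ.+-identityʳ M)))))
        firstStart-≥′ : ∀ {E E′ q} {E≤ : E ≤ E′} {≤z : E′ ≤ z} (K : Links E b₀ q z) → b₀ ≤ firstStart (weaken {p′ = a₁} a₁≤b₀ (raise E≤ ≤z K))
        firstStart-≥′ (last _ _ _ l _ _ _)   = l
        firstStart-≥′ (more _ _ _ l _ _ _ _) = l

-- From a tour of odd sign to a 4-flow or an exceptional edge

xorTo : (ℕ → Bool) → ℕ → Bool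
xorTo f zero    = false
xorTo f (suc k) = xorTo f k xor f k

xorTo-front : ∀ f k → xorTo f (suc k) ≡ f 0 xor xorTo (f ∘ suc) k
xorTo-front f zero    = sym (Bool.xor-identityʳ (f 0))
xorTo-front f (suc k) = trans (cong (_xor f (suc k)) (xorTo-front f k)) (Bool.xor-assoc (f 0) (xorTo (f ∘ suc) k) (f (suc k)))

xorTo-cong : ∀ {f g} k → (∀ j → j < k → f j ≡ g j) → xorTo f k ≡ xorTo g k
xorTo-cong zero    eq = refl
xorTo-cong (suc k) eq = cong₂ _xor_ (xorTo-cong k (λ j j<k → eq j (ℕ.m≤n⇒m≤1+n j<k))) (eq k ℕ.≤-refl)

nth : ∀ {A : Set} → A → List A → ℕ → A
nth d []      k       = d
nth d (x ∷ L) zero    = x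
nth d (x ∷ L) (suc k) = nth d L k

sumTo-split : ∀ M N f → sumTo (M + N) f ≡ sumTo M f ℤ.+ sumTo N (λ k → f (k + M))
sumTo-split zero    N f = sym (trans (ℤ.+-identityˡ _) (sumTo-cong N (λ k _ → cong f (ℕ.+-identityʳ k))))
sumTo-split (suc M) N f =
  trans (cong₂ ℤ._+_ (refl {x = f 0}) (sumTo-split M N (f ∘ suc)))
    (trans (sym (ℤ.+-assoc (f 0) _ _))
      (cong₂ ℤ._+_ (refl {x = f 0 ℤ.+ sumTo M (f ∘ suc)}) (sumTo-cong N (λ k _ → cong f (sym (ℕ.+-suc k M))))))

sumTo-single : ∀ N f k₀ → k₀ < N → (∀ k → k < N → k ≢ k₀ → f k ≡ 0ℤ) → sumTo N f ≡ f k₀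
sumTo-single (suc N) f zero     _           off =
  trans (cong₂ ℤ._+_ (refl {x = f 0}) (trans (sumTo-cong N (λ k k<N → off (suc k) (s≤s k<N) (λ ()))) (sumTo-0 N))) (ℤ.+-identityʳ (f 0))
sumTo-single (suc N) f (suc k₀) (s≤s k₀<N) off =
  trans (cong₂ ℤ._+_ (off 0 (s≤s z≤n) (λ ())) (sumTo-single N (f ∘ suc) k₀ k₀<N (λ k k<N k≢ → off (suc k) (s≤s k<N) (k≢ ∘ ℕ.suc-injective))))
        (ℤ.+-identityˡ (f (suc k₀)))

sg-not : ∀ s → sg (not s) ≡ - sg s
sg-not true  = refl
sg-not false = refl

sumTo-fourfold : ∀ M f k₀ → k₀ < M →
  (∀ k → k < M → k ≢ k₀ → f k ≡ 0ℤ) → (∀ k → k < M → k ≢ k₀ → f (k + M) ≡ 0ℤ) →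
  (∀ k → k < M → k ≢ k₀ → f (k + M + M) ≡ 0ℤ) → (∀ k → k < M → k ≢ k₀ → f (k + M + M + M) ≡ 0ℤ) →
  sumTo (4 * M) f ≡ (f k₀ ℤ.+ f (k₀ + M)) ℤ.+ (f (k₀ + M + M) ℤ.+ f (k₀ + M + M + M))
sumTo-fourfold M f k₀ k₀<M p₀ p₁ p₂ p₃ =
  trans (sumTo-split M (3 * M) f) (trans (cong₂ ℤ._+_ (sumTo-single M f k₀ k₀<M p₀)
    (trans (sumTo-split M (2 * M) (λ k → f (k + M))) (cong₂ ℤ._+_ (sumTo-single M (λ k → f (k + M)) k₀ k₀<M p₁)
      (trans (sumTo-split M (1 * M) (λ k → f (k + M + M))) (cong₂ ℤ._+_ (sumTo-single M (λ k → f (k + M + M)) k₀ k₀<M p₂)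
        (trans (sumTo-split M 0 (λ k → f (k + M + M + M))) (cong₂ ℤ._+_ (sumTo-single M (λ k → f (k + M + M + M)) k₀ k₀<M p₃) refl)))))))
    (regroup (f k₀) (f (k₀ + M)) (f (k₀ + M + M)) (f (k₀ + M + M + M))))
  where
  regroup : ∀ a b c d → a ℤ.+ (b ℤ.+ (c ℤ.+ (d ℤ.+ 0ℤ))) ≡ (a ℤ.+ b) ℤ.+ (c ℤ.+ d)
  regroup = ℤS.solve-∀

module _ {n m : ℕ} (G : SignedGraph n m) where

  unit-at : ∀ {e} d a → proj₁ d ≡ e → unit G d a e ≡ half G e (proj₂ d) a
  unit-at (f , h) a refl = cong (if_then half G f h a else 0ℤ) (≟-refl f)

  unit-off : ∀ {e} d a → proj₁ d ≢ e → unit G d a e ≡ 0ℤ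
  unit-off (f , h) a ne = cong (if_then half G f h a else 0ℤ) (≟-false ne)

  half-4 : ∀ e h a b c d → (half G e h a ℤ.+ half G e h b) ℤ.+ (half G e h c ℤ.+ half G e h d) ≡ half G e h ((a ℤ.+ b) ℤ.+ (c ℤ.+ d))
  half-4 e h a b c d = sym (trans (half-+ G e h (a ℤ.+ b) (c ℤ.+ d)) (cong₂ ℤ._+_ (half-+ G e h a b) (half-+ G e h c d)))

  net-sumTo : ∀ N (x : ℕ → Fin m → ℤ) v → net G (λ e → sumTo N (λ k → x k e)) v ≡ sumTo N (λ k → net G (x k) v)
  net-sumTo zero    x v = net-0 G v
  net-sumTo (suc N) x v = trans (net-+ G (x 0) _ v) (cong₂ ℤ._+_ (refl {x = net G (x 0) v}) (net-sumTo N (x ∘ suc) v))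

  nth-chain : ∀ d L {u w} → IsWalk G u L w → ∀ k → suc k < length L → tgt G (nth d L k) ≡ src G (nth d L (suc k))
  nth-chain d (x ∷ y ∷ L) (_ , p , _) zero    _         = sym p
  nth-chain d (x ∷ L)     (_ , p)     (suc k) (s≤s k<) = nth-chain d L p k k<
  nth-chain d (x ∷ [])    _           zero    (s≤s ())

  nth-last : ∀ d L {u w} → IsWalk G u L w → ∀ k → length L ≡ suc k → tgt G (nth d L k) ≡ w
  nth-last d (x ∷ [])    (_ , p) zero    _  = p
  nth-last d (x ∷ y ∷ L) (_ , p) (suc k) eq = nth-last d (y ∷ L) p k (ℕ.suc-injective eq)

  xorTo-nth : ∀ d L → xorTo (neg G ∘ nth d L) (length L) ≡ par G L
  xorTo-nth d []      = refl
  xorTo-nth d (x ∷ L) = trans (xorTo-front (neg G ∘ nth d (x ∷ L)) (length L)) (cong (neg G x xor_) (xorTo-nth d L))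

  unused : ∀ d e L → cnt G e L ≡ 0 → ∀ j → j < length L → proj₁ (nth d L j) ≢ e
  unused d e (x ∷ L) c j       j<       eq with proj₁ x ≟ e
  unused d e (x ∷ L) c zero    _        eq | no  ne = ne eq
  unused d e (x ∷ L) c (suc j) (s≤s j<) eq | no  ne = unused d e L c j j< eq

  position : ∀ d e L → cnt G e L ≡ 1 →
             ∃ λ k → k < length L × proj₁ (nth d L k) ≡ e × (∀ j → j < length L → proj₁ (nth d L j) ≡ e → j ≡ k)
  position d e (x ∷ L) c with proj₁ x ≟ e
  ... | yes eq = 0 , s≤s z≤n , eq , only
    where
    only : ∀ j → j < suc (length L) → proj₁ (nth d (x ∷ L) j) ≡ e → j ≡ 0
    only zero    _        _ = refl
    only (suc j) (s≤s j<) p = ⊥-elim (unused d e L (ℕ.suc-injective c) j j< p)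
  ... | no  ne with k , k< , eq , uniq ← position d e L c = suc k , s≤s k< , eq , only
    where
    only : ∀ j → j < suc (length L) → proj₁ (nth d (x ∷ L) j) ≡ e → j ≡ suc k
    only zero    _        p = ⊥-elim (ne p)
    only (suc j) (s≤s j<) p = cong suc (uniq j j< p)

  module Periodic (M : ℕ) (0<M : 0 < M) (dart : ℕ → Dart G) (dart-M : ∀ k → dart (k + M) ≡ dart k)
                  (chain : ∀ k → tgt G (dart k) ≡ src G (dart (suc k))) (odd : xorTo (neg G ∘ dart) M ≡ true)
                  (locate : ∀ e → ∃ λ k → k < M × proj₁ (dart k) ≡ e × (∀ j → j < M → proj₁ (dart j) ≡ e → j ≡ k)) where

    vert : ℕ → Fin n
    vert k = src G (dart k)

    s : ℕ → Bool
    s = xorTo (neg G ∘ dart)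

    st : ℕ → State n
    st k = vert k , s k

    s-M : ∀ k → s (k + M) ≡ not (s k)
    s-M zero    = odd
    s-M (suc k) = trans (cong₂ _xor_ (s-M k) (cong (neg G) (dart-M k))) (sym (Bool.not-distribˡ-xor (s k) (neg G (dart k))))

    st-M : ∀ k → st (k + M) ≡ flip (st k)
    st-M k = cong₂ _,_ (cong (src G) (dart-M k)) (s-M k)

    open Cover M st st-M

    module _ (c : ℕ → ℤ) where

      value : ℕ → ℤ
      value k = c k ℤ.* sg (s k)

      ξ : Fin m → ℤ
      ξ e = sumTo (4 * M) (λ k → unit G (dart k) (value k) e)

      net-ξ : Balancedᶜ c → ∀ v → net G ξ v ≡ 0ℤ
      net-ξ bal v = trans (net-sumTo (4 * M) (λ k → unit G (dart k) (value k)) v)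
                      (trans (sumTo-cong (4 * M) (λ k _ → term k)) (bal v))
        where
        term : ∀ k → net G (unit G (dart k) (value k)) v ≡ c k ℤ.* (X v (st k) ℤ.- X v (st (suc k)))
        term k = begin
          net G (unit G (dart k) (value k)) v
            ≡⟨ net-unit G (dart k) (value k) v ⟩
          at v (vert k) (c k ℤ.* sg (s k)) ℤ.+ at v (tgt G (dart k)) (turn (neg G (dart k)) (c k ℤ.* sg (s k)))
            ≡⟨ cong₂ ℤ._+_ (at-* v (vert k) (c k) (sg (s k)))
                 (trans (cong₂ (at v) (chain k) (turn-sg (neg G (dart k)) (s k))) (at-* v (vert (suc k)) (c k) _)) ⟩
          c k ℤ.* at v (vert k) (sg (s k)) ℤ.+ c k ℤ.* at v (vert (suc k)) (- sg (s (suc k)))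
            ≡⟨ cong (λ y → c k ℤ.* at v (vert k) (sg (s k)) ℤ.+ c k ℤ.* y) (at-neg v (vert (suc k)) (sg (s (suc k)))) ⟩
          c k ℤ.* X v (st k) ℤ.+ c k ℤ.* (- X v (st (suc k)))
            ≡⟨ sym (ℤ.*-distribˡ-+ (c k) (X v (st k)) (- X v (st (suc k)))) ⟩
          c k ℤ.* (X v (st k) ℤ.- X v (st (suc k))) ∎
          where
          open ≡-Reasoning
          turn-sg : ∀ ν t → turn ν (c k ℤ.* sg t) ≡ c k ℤ.* (- sg (t xor ν))
          turn-sg true  t = trans (cong (c k ℤ.*_) (trans (sym (ℤ.neg-involutive (sg t))) (cong -_ (sym (sg-not t)))))
                                  (cong (λ y → c k ℤ.* (- sg y)) (Bool.xor-comm true t))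
          turn-sg false t = trans (ℤ.neg-distribʳ-* (c k) (sg t)) (cong (λ y → c k ℤ.* (- sg y)) (sym (Bool.xor-identityʳ t)))

      -- The four lifts of an edge carry alternating accumulated signs. Up to sign, this is the
      -- value that the edge receives.
      folded : ℕ → ℤ
      folded k = (c k ℤ.- c (k + M)) ℤ.+ (c (k + M + M) ℤ.- c (k + M + M + M))

      ∣ξ∣ : ∀ e → ∃ λ k → k < M × ∣ ξ e ∣ ≡ ∣ folded k ∣
      ∣ξ∣ e with locate e
      ... | k₀ , k₀<M , eq , uniq = k₀ , k₀<M , trans (cong ∣_∣ sum) (trans (∣half∣ G e h (σ ℤ.* folded k₀)) (∣sg*∣ (s k₀) (folded k₀)))
        where
        σ : ℤ
        σ = sg (s k₀)
        h : Fin 2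
        h = proj₂ (dart k₀)
        s1 : sg (s (k₀ + M)) ≡ - σ
        s1 = trans (cong sg (s-M k₀)) (sg-not (s k₀))
        s2 : sg (s (k₀ + M + M)) ≡ σ
        s2 = cong sg (trans (s-M (k₀ + M)) (trans (cong not (s-M k₀)) (Bool.not-involutive (s k₀))))
        s3 : sg (s (k₀ + M + M + M)) ≡ - σ
        s3 = trans (cong sg (s-M (k₀ + M + M))) (trans (sg-not (s (k₀ + M + M))) (cong -_ s2))
        hit : ∀ k → dart k ≡ dart k₀ → unit G (dart k) (value k) e ≡ half G e h (value k)
        hit k p = trans (cong (λ d → unit G d (value k) e) p) (unit-at (dart k₀) (value k) eq)
        miss : ∀ k j → j < M → j ≢ k₀ → dart k ≡ dart j → unit G (dart k) (value k) e ≡ 0ℤ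
        miss k j j<M j≢ p = unit-off (dart k) (value k) (λ q → j≢ (uniq j j<M (trans (cong proj₁ (sym p)) q)))
        d2 : ∀ k → dart (k + M + M) ≡ dart k
        d2 k = trans (dart-M (k + M)) (dart-M k)
        d3 : ∀ k → dart (k + M + M + M) ≡ dart k
        d3 k = trans (dart-M (k + M + M)) (d2 k)
        sum : ξ e ≡ half G e h (σ ℤ.* folded k₀)
        sum = trans (sumTo-fourfold M (λ k → unit G (dart k) (value k) e) k₀ k₀<M
                      (λ j j< j≢ → miss j j j< j≢ refl) (λ j j< j≢ → miss (j + M) j j< j≢ (dart-M j))
                      (λ j j< j≢ → miss (j + M + M) j j< j≢ (d2 j)) (λ j j< j≢ → miss (j + M + M + M) j j< j≢ (d3 j)))
          (trans (cong₂ ℤ._+_ (cong₂ ℤ._+_ (hit k₀ refl) (hit (k₀ + M) (dart-M k₀)))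
                              (cong₂ ℤ._+_ (hit (k₀ + M + M) (d2 k₀)) (hit (k₀ + M + M + M) (d3 k₀))))
            (trans (half-4 e h (value k₀) (value (k₀ + M)) (value (k₀ + M + M)) (value (k₀ + M + M + M)))
              (cong (half G e h) (trans (cong₂ ℤ._+_ (cong (λ y → value k₀ ℤ.+ c (k₀ + M) ℤ.* y) s1)
                                                     (cong₂ (λ x y → c (k₀ + M + M) ℤ.* x ℤ.+ c (k₀ + M + M + M) ℤ.* y) s2 s3))
                                  (collect σ (c k₀) (c (k₀ + M)) (c (k₀ + M + M)) (c (k₀ + M + M + M)))))))
          where
          collect : ∀ σ a b c d → (a ℤ.* σ ℤ.+ b ℤ.* (- σ)) ℤ.+ (c ℤ.* σ ℤ.+ d ℤ.* (- σ)) ≡ σ ℤ.* ((a ℤ.- b) ℤ.+ (c ℤ.- d))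
          collect = ℤS.solve-∀

    small-neg : ∀ {x y} → Small (x ℤ.- y) → Small ((0ℤ ℤ.- x) ℤ.+ (y ℤ.- 0ℤ))
    small-neg {x} {y} (nz , lt) = (λ p → nz (ℤ.neg-injective (trans (sym eq) p))) , subst (_< 4) (sym (trans (cong ∣_∣ eq) (ℤ.∣-i∣≡∣i∣ (x ℤ.- y)))) lt
      where
      lemma : ∀ x y → (0ℤ ℤ.- x) ℤ.+ (y ℤ.- 0ℤ) ≡ - (x ℤ.- y)
      lemma = ℤS.solve-∀
      eq = lemma x y

    complete⇒4-flow : ∀ {a₀ z} {a₀< : a₀ < 2 * M} → z ≤ a₀ + 2 * M → Complete a₀ a₀< z → HasNZkFlow G 4
    complete⇒4-flow {a₀} {z} {a₀<} z≤ C = ⇒kFlow G (ξ c) (net-ξ c balanced)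
        (λ e p → let k , k<M , eq = ∣ξ∣ c e in proj₁ (fold k k<M) (ℤ.∣i∣≡0⇒i≡0 (trans (sym eq) (cong ∣_∣ p))))
        (λ e → let k , k<M , eq = ∣ξ∣ c e in subst (_< 4) (sym eq) (proj₂ (fold k k<M)))
      where
      open Complete C
      2M : ∀ k → k + 2 * M ≡ k + M + M
      2M k = trans (cong (λ y → k + (M + y)) (ℕ.+-identityʳ M)) (sym (ℕ.+-assoc k M M))
      far : ∀ k → a₀ ≤ k → c (k + M + M) ≡ 0ℤ
      far k a₀≤k = after (k + M + M) (ℕ.≤-trans z≤ (ℕ.≤-trans (ℕ.≤-reflexive (2M a₀)) (ℕ.+-monoˡ-≤ M (ℕ.+-monoˡ-≤ M a₀≤k))))
      +0-0 : ∀ x → x ℤ.+ (0ℤ ℤ.- 0ℤ) ≡ x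
      +0-0 = ℤS.solve-∀
      0-0+ : ∀ x → (0ℤ ℤ.- 0ℤ) ℤ.+ x ≡ x
      0-0+ = ℤS.solve-∀
      -- Exactly one of `k`, `k + M`, `k + M + M` lies in the period starting at `a₀`. As `c`
      -- vanishes before `a₀` and from `a₀ + 2 * M` on, only the difference at that position
      -- remains, possibly negated.
      fold : ∀ k → k < M → Small (folded c k)
      fold k k<M with a₀ ℕ.≤? k
      ... | yes a₀≤k = subst Small (sym (trans (cong₂ (λ x y → (c k ℤ.- c (k + M)) ℤ.+ (x ℤ.- y)) (far k a₀≤k) (far (k + M) (ℕ.≤-trans a₀≤k (ℕ.m≤m+n k M)))) (+0-0 (c k ℤ.- c (k + M)))))
                             (small k a₀≤k (ℕ.<-≤-trans k<M (ℕ.m≤n+m M a₀)))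
      ... | no  a₀≰k with a₀ ℕ.≤? k + M
      ... | yes a₀≤ = subst Small (sym (cong₂ (λ x y → (x ℤ.- c (k + M)) ℤ.+ (c (k + M + M) ℤ.- y)) (before k (ℕ.≰⇒> a₀≰k)) (far (k + M) a₀≤)))
                        (small-neg {c (k + M)} {c (k + M + M)} (small (k + M) a₀≤ (ℕ.+-monoˡ-< M (ℕ.≰⇒> a₀≰k))))
      ... | no  a₀≰ = subst Small (sym (trans (cong₂ (λ x y → (x ℤ.- y) ℤ.+ (c (k + M + M) ℤ.- c (k + M + M + M))) (before k (ℕ.≰⇒> a₀≰k)) (before (k + M) (ℕ.≰⇒> a₀≰))) (0-0+ (c (k + M + M) ℤ.- c (k + M + M + M)))))
                        (small (k + M + M) (ℕ.≤-trans (ℕ.<⇒≤ a₀<) (ℕ.≤-trans (ℕ.m≤n+m (2 * M) k) (ℕ.≤-reflexive (2M k)))) (ℕ.+-monoˡ-< M (ℕ.≰⇒> a₀≰)))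

    module _ (t : ℕ) (t<M : t < M) (bare : ¬ Covered (t + M)) where

      -- The window from just after step `t` up to its next occurrence: the steps between its `M`
      -- positions are all edges except that of step `t`.
      pos : ℕ → ℕ
      pos i = suc t + i

      -- If the signs differed, then by antiperiodicity the stretch from the later visit to the
      -- earlier one, taken a period later, would be a balanced arc across `t + M`.
      sameSign< : ∀ i j → i < j → j < M → vert (pos i) ≡ vert (pos j) → s (pos i) ≡ s (pos j)
      sameSign< i j i<j j<M eq with s (pos i) ≟ᵇ s (pos j)
      ... | yes same = same
      ... | no  diff = ⊥-elim (bare (b , cov-bound cov , cov))
        where
        b : ℕ
        b = pos i + M
        cov : Cov (t + M) b
        cov = pos j , s≤s (ℕ.≤-trans (ℕ.≤-reflexive (sym (ℕ.+-suc t j))) (ℕ.+-monoʳ-≤ t j<M)) ,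
              s≤s (ℕ.+-monoˡ-≤ M (ℕ.m≤m+n t i)) ,
              ℕ.<-≤-trans (ℕ.+-monoʳ-< (suc t) j<M) (ℕ.+-monoˡ-≤ M (ℕ.m≤m+n (suc t) i)) ,
              ℕ.+-monoˡ-< M (ℕ.+-monoʳ-< (suc t) i<j) ,
              sym (trans (st-M (pos i)) (cong₂ _,_ eq (sym (Bool.¬-not (λ e → diff (sym e))))))

      sameSign : ∀ i j → i < M → j < M → vert (pos i) ≡ vert (pos j) → s (pos i) ≡ s (pos j)
      sameSign i j i<M j<M eq with ℕ.<-cmp i j
      ... | tri< i<j _ _  = sameSign< i j i<j j<M eq
      ... | tri≈ _ refl _ = refl
      ... | tri> _ _ j<i  = sym (sameSign< j i j<i i<M (sym eq))

      visit? : ∀ v → Dec (∃ λ i → i < M × vert (pos i) ≡ v)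
      visit? v = ℕ.anyUpTo? (λ i → vert (pos i) ≟ v) M

      φ : Fin n → Bool
      φ v with visit? v
      ... | yes (i , _) = s (pos i)
      -- A vertex that the tour never visits is an end of no edge, so its value is arbitrary.
      ... | no  _       = false

      φ-pos : ∀ i → i < M → φ (vert (pos i)) ≡ s (pos i)
      φ-pos i i<M with visit? (vert (pos i))
      ... | yes (j , j<M , eq) = sameSign j i j<M i<M eq
      ... | no  none           = ⊥-elim (none (i , i<M , refl))

      dart-consistent : ∀ i → suc i < M → neg G (dart (pos i)) ≡ φ (src G (dart (pos i))) xor φ (tgt G (dart (pos i)))
      dart-consistent i 1+i<M = sym (trans (cong₂ _xor_ (φ-pos i (ℕ.<-trans ℕ.≤-refl 1+i<M))
          (trans (cong φ (trans (chain (pos i)) (cong vert (sym (ℕ.+-suc (suc t) i)))))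
            (trans (φ-pos (suc i) 1+i<M) (cong s (ℕ.+-suc (suc t) i)))))
          (cancel (s (pos i)) (neg G (dart (pos i)))))
        where
        cancel : ∀ x y → x xor (x xor y) ≡ y
        cancel true  y = Bool.not-involutive y
        cancel false y = refl

      consistent-dart : ∀ d → neg G d ≡ φ (src G d) xor φ (tgt G d) → Consistent G φ (proj₁ d)
      consistent-dart (e , zero)     p = p
      consistent-dart (e , suc zero) p = trans p (Bool.xor-comm (φ (end G e (suc zero))) _)

      at-pos : ∀ i {d} → suc i < M → dart (pos i) ≡ d → Consistent G φ (proj₁ d)
      at-pos i i<M refl = consistent-dart (dart (pos i)) (dart-consistent i i<M)

      consistent : ∀ f → f ≢ proj₁ (dart t) → Consistent G φ f
      consistent f f≢ with locate f
      ... | k , k<M , refl , _ with ℕ.<-cmp k t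
      ... | tri≈ _ refl _ = ⊥-elim (f≢ refl)
      ... | tri> _ _ t<k  = at-pos (k ∸ suc t) (ℕ.≤-<-trans (ℕ.≤-trans (ℕ.≤-reflexive (sym (ℕ.+-∸-assoc 1 t<k))) (ℕ.m∸n≤m k t)) k<M) (cong dart (ℕ.m+[n∸m]≡n t<k))
      ... | tri< k<t _ _  = at-pos (k + M ∸ suc t)
              (ℕ.≤-<-trans (ℕ.≤-reflexive (sym (ℕ.+-∸-assoc 1 t<k+M))) (ℕ.≤-trans (ℕ.∸-monoˡ-< (ℕ.+-monoˡ-< M k<t) (ℕ.<⇒≤ t<k+M)) (ℕ.≤-reflexive (ℕ.m+n∸m≡n t M))))
              (trans (cong dart (ℕ.m+[n∸m]≡n t<k+M)) (dart-M k))
        where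
        t<k+M : t < k + M
        t<k+M = ℕ.<-≤-trans t<M (ℕ.m≤n+m M k)

    4-flow-or-edge : HasNZkFlow G 4 ⊎ Σ (Fin m) λ e → Σ (Fin n → Bool) λ φ → ∀ f → f ≢ e → Consistent G φ f
    4-flow-or-edge = decide (ℕ.anyUpTo? (λ t → ¬? (covered? (t + M))) M)
      where
      decide : Dec (∃ λ t → t < M × ¬ Covered (t + M)) → _
      decide (yes (t , t<M , bare)) = inj₂ (proj₁ (dart t) , φ t t<M bare , consistent t t<M bare)
      decide (no none)              = inj₁ (finish (cover covered 0<M))
        where
        covered : ∀ p → M ≤ p → p < 2 * M → Covered p
        covered p M≤p p<2M with covered? (p ∸ M + M)
        ... | yes c = subst Covered (ℕ.m∸n+n≡m M≤p) c
        ... | no ¬c = ⊥-elim (none (p ∸ M , ℕ.<-≤-trans (ℕ.∸-monoˡ-< p<2M M≤p)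
                          (ℕ.≤-reflexive (trans (ℕ.m+n∸m≡n M (M + 0)) (ℕ.+-identityʳ M))) , ¬c))
        finish : (∃ λ a₀ → ∃ λ z → Σ (a₀ < 2 * M) λ a₀< → z ≤ a₀ + 2 * M × Complete a₀ a₀< z) → HasNZkFlow G 4
        finish (a₀ , z , a₀< , z≤ , C) = complete⇒4-flow {a₀< = a₀<} z≤ C

  odd-tour : ∀ {r} L → IsWalk G r L r → (∀ e → cnt G e L ≡ 1) → par G L ≡ true →
             HasNZkFlow G 4 ⊎ Σ (Fin m) λ e → Σ (Fin n → Bool) λ φ → ∀ f → f ≢ e → Consistent G φ f
  odd-tour L@(d₀ ∷ L₀) closed once odd = Periodic.4-flow-or-edge M (s≤s z≤n) dart dart-M chain odd′ locate
    where
    M : ℕ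
    M = length L
    dart : ℕ → Dart G
    dart k = nth d₀ L (k % M)
    dart-M : ∀ k → dart (k + M) ≡ dart k
    dart-M k = cong (nth d₀ L) (DM.[m+n]%n≡m%n k M)
    dart-< : ∀ k → k < M → dart k ≡ nth d₀ L k
    dart-< k k<M = cong (nth d₀ L) (DM.m<n⇒m%n≡m k<M)
    chain : ∀ k → tgt G (dart k) ≡ src G (dart (suc k))
    chain k = trans (next (k % M) (DM.m%n<n k M)) (cong (src G ∘ nth d₀ L) (sym suc-%))
      where
      suc-% : suc k % M ≡ suc (k % M) % M
      suc-% = trans (cong (λ j → suc j % M) (DM.m≡m%n+[m/n]*n k M)) (DM.[m+kn]%n≡m%n (suc (k % M)) (k / M) M)
      next : ∀ j → j < M → tgt G (nth d₀ L j) ≡ src G (nth d₀ L (suc j % M))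
      next j j<M with ℕ.m≤n⇒m<n∨m≡n j<M
      ... | inj₁ 1+j<M = trans (nth-chain d₀ L closed j 1+j<M) (cong (src G ∘ nth d₀ L) (sym (DM.m<n⇒m%n≡m 1+j<M)))
      ... | inj₂ refl  = trans (nth-last d₀ L closed j refl)
                           (trans (sym (proj₁ closed)) (cong (src G ∘ nth d₀ L) (sym (DM.n%n≡0 M))))
    odd′ : xorTo (neg G ∘ dart) M ≡ true
    odd′ = trans (xorTo-cong M (λ j j<M → cong (neg G) (dart-< j j<M))) (trans (xorTo-nth d₀ L) odd)
    locate : ∀ e → ∃ λ k → k < M × proj₁ (dart k) ≡ e × (∀ j → j < M → proj₁ (dart j) ≡ e → j ≡ k)
    locate e with k , k<M , eq , uniq ← position d₀ e L (once e) =
      k , k<M , trans (cong proj₁ (dart-< k k<M)) eq , λ j j<M p → uniq j j<M (trans (cong proj₁ (sym (dart-< j j<M))) p)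

-- Polynomials on the cube {0,1}^k and the Chevalley–Warning argument modulo 3

Cube : ℕ → Set
Cube k = Vec Bool k

origin : ∀ {k} → Cube k
origin = replicate _ false

Δ : ∀ {k} → (Cube (suc k) → ℤ) → Cube k → ℤ
Δ f x = f (true ∷ x) ℤ.- f (false ∷ x)

-- A function on the cube is a unique multilinear polynomial, f = f(false, ·) + x · Δ f. Its degree
-- is at most `d` iff the constant part has degree at most `d` and the coefficient of x has degree
-- below `d`.
Deg : ∀ {k} → ℕ → (Cube k → ℤ) → Set
Deg {zero}  d       f = ⊤
Deg {suc k} zero    f = Deg zero (f ∘ (false ∷_)) × (∀ x → Δ f x ≡ 0ℤ)
Deg {suc k} (suc d) f = Deg (suc d) (f ∘ (false ∷_)) × Deg d (Δ f)

deg-cong : ∀ {k} d {f g : Cube k → ℤ} → (∀ x → f x ≡ g x) → Deg d f → Deg d g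
deg-cong {zero}  d       eq p       = tt
deg-cong {suc k} zero    eq (p , q) = deg-cong zero (eq ∘ (false ∷_)) p , λ x → trans (sym (cong₂ ℤ._-_ (eq (true ∷ x)) (eq (false ∷ x)))) (q x)
deg-cong {suc k} (suc d) eq (p , q) = deg-cong (suc d) (eq ∘ (false ∷_)) p , deg-cong d (λ x → cong₂ ℤ._-_ (eq (true ∷ x)) (eq (false ∷ x))) q

deg-0 : ∀ {k} d → Deg {k} d (λ _ → 0ℤ)
deg-0 {zero}  d       = tt
deg-0 {suc k} zero    = deg-0 zero , λ _ → refl
deg-0 {suc k} (suc d) = deg-0 (suc d) , deg-0 d

deg-const : ∀ {k} d a → Deg {k} d (λ _ → a)
deg-const {zero}  d       a = tt
deg-const {suc k} zero    a = deg-const zero a , λ _ → ℤ.+-inverseʳ a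
deg-const {suc k} (suc d) a = deg-const (suc d) a , deg-cong d (λ _ → sym (ℤ.+-inverseʳ a)) (deg-0 d)

deg-suc : ∀ {k} d {f : Cube k → ℤ} → Deg d f → Deg (suc d) f
deg-suc {zero}  d       p       = tt
deg-suc {suc k} zero    (p , q) = deg-suc zero p , deg-cong zero (λ x → sym (q x)) (deg-0 zero)
deg-suc {suc k} (suc d) (p , q) = deg-suc (suc d) p , deg-suc d q

private
  Δ-+ : ∀ a b c d → (a ℤ.- b) ℤ.+ (c ℤ.- d) ≡ (a ℤ.+ c) ℤ.- (b ℤ.+ d)
  Δ-+ = ℤS.solve-∀

  Δ-*ˡ : ∀ a b d → (a ℤ.- b) ℤ.* d ≡ a ℤ.* d ℤ.- b ℤ.* d
  Δ-*ˡ = ℤS.solve-∀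

  Δ-*ʳ : ∀ b c d → b ℤ.* (c ℤ.- d) ≡ b ℤ.* c ℤ.- b ℤ.* d
  Δ-*ʳ = ℤS.solve-∀

  Δ-* : ∀ a b c d → (a ℤ.- b) ℤ.* d ℤ.+ a ℤ.* (c ℤ.- d) ≡ a ℤ.* c ℤ.- b ℤ.* d
  Δ-* = ℤS.solve-∀

  b+[a-b] : ∀ a b → b ℤ.+ (a ℤ.- b) ≡ a
  b+[a-b] = ℤS.solve-∀

deg-+ : ∀ {k} d {f g : Cube k → ℤ} → Deg d f → Deg d g → Deg d (λ x → f x ℤ.+ g x)
deg-+ {zero}  d       p       q       = tt
deg-+ {suc k} zero {f} {g} (p , p′) (q , q′) = deg-+ zero p q ,
  λ x → trans (sym (Δ-+ (f (true ∷ x)) (f (false ∷ x)) (g (true ∷ x)) (g (false ∷ x)))) (cong₂ ℤ._+_ (p′ x) (q′ x))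
deg-+ {suc k} (suc d) {f} {g} (p , p′) (q , q′) = deg-+ (suc d) p q ,
  deg-cong d (λ x → Δ-+ (f (true ∷ x)) (f (false ∷ x)) (g (true ∷ x)) (g (false ∷ x))) (deg-+ d p′ q′)

-- By the product rule Δ(fg) = Δf · g(false, ·) + f(true, ·) · Δg, where f(true, ·) = f(false, ·) +
-- Δf still has the degree of f.
deg-* : ∀ {k} d e {f g : Cube k → ℤ} → Deg d f → Deg e g → Deg (d + e) (λ x → f x ℤ.* g x)
deg-* {zero}  d e p q = tt
deg-* {suc k} zero zero {f} {g} (p , p′) (q , q′) = deg-* zero zero p q ,
  λ x → ℤ.i≡j⇒i-j≡0 (cong₂ ℤ._*_ (ℤ.i-j≡0⇒i≡j (f (true ∷ x)) (f (false ∷ x)) (p′ x)) (ℤ.i-j≡0⇒i≡j (g (true ∷ x)) (g (false ∷ x)) (q′ x)))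
deg-* {suc k} zero (suc e) {f} {g} (p , p′) (q , q′) = deg-* zero (suc e) p q ,
  deg-cong e (λ x → trans (Δ-*ʳ (f (false ∷ x)) (g (true ∷ x)) (g (false ∷ x)))
                          (cong (λ y → y ℤ.* g (true ∷ x) ℤ.- f (false ∷ x) ℤ.* g (false ∷ x)) (sym (ℤ.i-j≡0⇒i≡j (f (true ∷ x)) (f (false ∷ x)) (p′ x)))))
             (deg-* zero e p q′)
deg-* {suc k} (suc d) zero {f} {g} (p , p′) (q , q′) = deg-* (suc d) zero p q ,
  deg-cong (d + 0) (λ x → trans (Δ-*ˡ (f (true ∷ x)) (f (false ∷ x)) (g (false ∷ x)))
                          (cong (λ y → f (true ∷ x) ℤ.* y ℤ.- f (false ∷ x) ℤ.* g (false ∷ x)) (sym (ℤ.i-j≡0⇒i≡j (g (true ∷ x)) (g (false ∷ x)) (q′ x)))))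
             (deg-* d zero p′ q)
deg-* {suc k} (suc d) (suc e) {f} {g} (p , p′) (q , q′) = deg-* (suc d) (suc e) p q ,
  deg-cong (d + suc e) (λ x → Δ-* (f (true ∷ x)) (f (false ∷ x)) (g (true ∷ x)) (g (false ∷ x)))
    (deg-+ (d + suc e) (deg-* d (suc e) p′ q)
      (subst (λ j → Deg j (λ x → f (true ∷ x) ℤ.* Δ g x)) (sym (ℕ.+-suc d e))
        (deg-* (suc d) e (deg-cong (suc d) (λ x → b+[a-b] (f (true ∷ x)) (f (false ∷ x))) (deg-+ (suc d) p (deg-suc d p′))) q′)))

-- The coefficient of the product of all variables and, up to sign, the alternating sum of all
-- values.
mixed : ∀ {k} → (Cube k → ℤ) → ℤ
mixed {zero}  f = f []
mixed {suc k} f = mixed (Δ f)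

mixed-≡0 : ∀ {k} {f : Cube k → ℤ} → (∀ x → f x ≡ 0ℤ) → mixed f ≡ 0ℤ
mixed-≡0 {zero}  eq = eq []
mixed-≡0 {suc k} eq = mixed-≡0 (λ x → cong₂ ℤ._-_ (eq (true ∷ x)) (eq (false ∷ x)))

mixed-deg : ∀ {k} d {f : Cube k → ℤ} → d < k → Deg d f → mixed f ≡ 0ℤ
mixed-deg {suc k} zero    _         (_ , q) = mixed-≡0 q
mixed-deg {suc k} (suc d) (s≤s d<k) (_ , q) = mixed-deg d d<k q

-- In the alternating sum the value at the origin has the coefficient ±1, and all the other values
-- are divisible.
mixed-∣ : ∀ {k p} (f : Cube k → ℤ) → (∀ x → x ≢ origin → p ∣ℤ f x) → p ∣ℤ mixed f → p ∣ℤ f origin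
mixed-∣ {zero}      f off p∣ = p∣
mixed-∣ {suc k} {p} f off p∣ = ∣ℤ.∣m+n∣m⇒∣n
    (subst (p ∣ℤ_) (lemma (f (true ∷ origin)) (f (false ∷ origin)))
      (∣ℤ.∣m⇒∣-m (mixed-∣ (Δ f) (λ x x≢ → ∣ℤ.∣m∣n⇒∣m-n (off (true ∷ x) (λ ())) (off (false ∷ x) (λ { refl → x≢ refl }))) p∣)))
    (∣ℤ.∣m⇒∣-m (off (true ∷ origin) (λ ())))
  where
  lemma : ∀ a b → - (a ℤ.- b) ≡ - a ℤ.+ b
  lemma = ℤS.solve-∀

3ℤ : ℤ
3ℤ = ℤ.+ 3

1-square : ∀ a → ¬ 3ℤ ∣ℤ a → 3ℤ ∣ℤ 1ℤ ℤ.- a ℤ.* a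
1-square a 3∤a = cases (a ℤD.%ℕ 3) (ℤD.n%ℕd<d a 3) (ℤD.a≡a%ℕn+[a/ℕn]*n a 3)
  where
  q : ℤ
  q = a ℤD./ℕ 3
  one : ∀ q → 1ℤ ℤ.- (1ℤ ℤ.+ q ℤ.* 3ℤ) ℤ.* (1ℤ ℤ.+ q ℤ.* 3ℤ) ≡ (- (q ℤ.* (ℤ.+ 2 ℤ.+ q ℤ.* 3ℤ))) ℤ.* 3ℤ
  one = ℤS.solve-∀
  two : ∀ q → 1ℤ ℤ.- (ℤ.+ 2 ℤ.+ q ℤ.* 3ℤ) ℤ.* (ℤ.+ 2 ℤ.+ q ℤ.* 3ℤ) ≡ (- (1ℤ ℤ.+ q ℤ.* (ℤ.+ 4 ℤ.+ q ℤ.* 3ℤ))) ℤ.* 3ℤ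
  two = ℤS.solve-∀
  cases : ∀ r → r < 3 → a ≡ ℤ.+ r ℤ.+ q ℤ.* 3ℤ → 3ℤ ∣ℤ 1ℤ ℤ.- a ℤ.* a
  cases 0 _ eq = ⊥-elim (3∤a (∣ℤ.divides q (trans eq (ℤ.+-identityˡ (q ℤ.* 3ℤ)))))
  cases 1 _ eq = ∣ℤ.divides (- (q ℤ.* (ℤ.+ 2 ℤ.+ q ℤ.* 3ℤ))) (trans (cong (λ b → 1ℤ ℤ.- b ℤ.* b) eq) (one q))
  cases 2 _ eq = ∣ℤ.divides (- (1ℤ ℤ.+ q ℤ.* (ℤ.+ 4 ℤ.+ q ℤ.* 3ℤ))) (trans (cong (λ b → 1ℤ ℤ.- b ℤ.* b) eq) (two q))
  cases (suc (suc (suc _))) (s≤s (s≤s (s≤s ()))) _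

prod : ∀ n → (Fin n → ℤ) → ℤ
prod zero    f = 1ℤ
prod (suc n) f = f zero ℤ.* prod n (f ∘ suc)

prod-1 : ∀ n {f : Fin n → ℤ} → (∀ v → f v ≡ 1ℤ) → prod n f ≡ 1ℤ
prod-1 zero    eq = refl
prod-1 (suc n) eq = cong₂ ℤ._*_ (eq zero) (prod-1 n (eq ∘ suc))

prod-∣ : ∀ {n p} (f : Fin n → ℤ) v → p ∣ℤ f v → p ∣ℤ prod n f
prod-∣ f zero    p∣ = ∣ℤ.∣m⇒∣m*n _ p∣
prod-∣ f (suc v) p∣ = ∣ℤ.∣n⇒∣m*n (f zero) (prod-∣ (f ∘ suc) v p∣)

prod-deg : ∀ {k} n (d : Fin n → ℕ) {f : Fin n → Cube k → ℤ} → (∀ v → Deg (d v) (f v)) →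
           Deg (sumℕ n d) (λ x → prod n (λ v → f v x))
prod-deg zero    d p = deg-const 0 1ℤ
prod-deg (suc n) d p = deg-* (d zero) _ (p zero) (prod-deg n (d ∘ suc) (p ∘ suc))

search : ∀ {k} {P : Cube k → Set} → (∀ x → Dec (P x)) → Dec (∃ P)
search {zero} P? with P? []
... | yes p = yes ([] , p)
... | no ¬p = no λ { ([] , p) → ¬p p }
search {suc k} P? with search (P? ∘ (false ∷_)) | search (P? ∘ (true ∷_))
... | yes (x , p) | _           = yes (false ∷ x , p)
... | no  _       | yes (x , p) = yes (true ∷ x , p)
... | no  ¬p      | no  ¬q      = no λ { (false ∷ x , r) → ¬p (x , r) ; (true ∷ x , r) → ¬q (x , r) }

-- If only the origin were a common zero, ∏ (1 - ℓᵥ²) would agree modulo 3 with the indicator of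
-- the origin, whose k-th mixed difference is ±1, while its degree is less than k.
nontrivial-zero : ∀ {n k} (ℓ : Fin n → Cube k → ℤ) (active : Fin n → Bool) →
  (∀ v → Deg 1 (ℓ v)) → (∀ v → ℓ v origin ≡ 0ℤ) → (∀ v → active v ≡ false → ∀ x → ℓ v x ≡ 0ℤ) →
  sumℕ n (λ v → 2 * ind (active v)) < k →
  ∃ λ x → x ≢ origin × ∀ v → 3ℤ ∣ℤ ℓ v x
nontrivial-zero {n} {k} ℓ active deg₁ at-0 inactive small
  with search (λ x → ¬? (Vec.≡-dec _≟ᵇ_ x origin) ×-dec all? (λ v → 3ℤ ∣ℤ.∣? ℓ v x))
... | yes p   = p
... | no none = ⊥-elim (3∤1 (subst (3ℤ ∣ℤ_) (prod-1 n (λ v → cong (λ a → 1ℤ ℤ.- a ℤ.* a) (at-0 v)))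
                  (mixed-∣ P off (subst (3ℤ ∣ℤ_) (sym (mixed-deg _ small (prod-deg n _ factor-deg))) (∣ℤ.divides 0ℤ refl)))))
  where
  factor : Fin n → Cube k → ℤ
  factor v x = 1ℤ ℤ.- ℓ v x ℤ.* ℓ v x
  P : Cube k → ℤ
  P x = prod n (λ v → factor v x)
  3∤1 : ¬ 3ℤ ∣ℤ 1ℤ
  3∤1 d with divides (suc _) () ← ∣ℤ.∣⇒∣ᵤ d
  off : ∀ x → x ≢ origin → 3ℤ ∣ℤ P x
  off x x≢ with ¬∀⟶∃¬ n _ (λ v → 3ℤ ∣ℤ.∣? ℓ v x) (λ all → none (x , x≢ , all))
  ... | v , 3∤ = prod-∣ (λ v → factor v x) v (1-square (ℓ v x) 3∤)
  factor-deg : ∀ v → Deg (2 * ind (active v)) (factor v)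
  factor-deg v with active v in eq
  ... | false = deg-cong 0 (λ x → cong (λ a → 1ℤ ℤ.- a ℤ.* a) (sym (inactive v eq x))) (deg-const 0 1ℤ)
  ... | true  = deg-+ 2 (deg-const 2 1ℤ) (deg-cong 2 (λ x → ℤ.-1*i≡-i (ℓ v x ℤ.* ℓ v x))
                  (deg-* 0 2 (deg-const 0 (- 1ℤ)) (deg-* 1 1 (deg₁ v) (deg₁ v))))

-- Closed trails cut at defects

flip-flip : ∀ {n} (σ : State n) → flip (flip σ) ≡ σ
flip-flip (v , s) = cong (v ,_) (Bool.not-involutive s)

wt : ∀ {n} → Fin n → State n → ℤ
wt v (w , s) = at v w (sg s)

wt-flip : ∀ {n} (v : Fin n) σ → wt v (flip σ) ≡ - wt v σ
wt-flip v (w , true)  = at-neg v w (- 1ℤ)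
wt-flip v (w , false) = at-neg v w 1ℤ

wtSum : ∀ {n} → Fin n → List (State n) → ℤ
wtSum v []      = 0ℤ
wtSum v (σ ∷ K) = wt v σ ℤ.+ wtSum v K

wtSum-++ : ∀ {n} (v : Fin n) K K′ → wtSum v (K ++ K′) ≡ wtSum v K ℤ.+ wtSum v K′
wtSum-++ v []      K′ = sym (ℤ.+-identityˡ _)
wtSum-++ v (σ ∷ K) K′ = trans (cong₂ ℤ._+_ (refl {x = wt v σ}) (wtSum-++ v K K′)) (sym (ℤ.+-assoc (wt v σ) _ _))

rev : ∀ {A : Set} → List A → List A
rev []      = []
rev (σ ∷ K) = rev K ++ σ ∷ []

length-rev : ∀ {A : Set} (K : List A) → length (rev K) ≡ length K
length-rev []      = refl
length-rev (σ ∷ K) = trans (List.length-++ (rev K)) (trans (ℕ.+-comm (length (rev K)) 1) (cong suc (length-rev K)))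

wtSum-rev : ∀ {n} (v : Fin n) K → wtSum v (rev K) ≡ wtSum v K
wtSum-rev v []      = refl
wtSum-rev v (σ ∷ K) = trans (wtSum-++ v (rev K) (σ ∷ []))
  (trans (cong₂ ℤ._+_ (wtSum-rev v K) (ℤ.+-identityʳ (wt v σ))) (ℤ.+-comm (wtSum v K) (wt v σ)))

visits : ∀ {n} → Fin n → List (State n) → ℕ
visits v []            = 0
visits v ((w , _) ∷ K) = ind (does (w ≟ v)) + visits v K

sum-visits : ∀ {n} (K : List (State n)) → sumℕ n (λ v → visits v K) ≡ length K
sum-visits {n} []            = sumℕ-0 n
sum-visits {n} ((w , _) ∷ K) = trans (sumℕ-+ n _ _) (cong₂ _+_
  (trans (sumℕ-cong n (λ v → sym (ℕ.*-identityʳ (ind (does (w ≟ v)))))) (sumℕ-δ w (λ _ → 1))) (sum-visits K))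

visits-wt : ∀ {n} (v : Fin n) t K → (v , not t) ∉ K → wtSum v K ≡ sg t ℤ.* ℤ.+ visits v K
visits-wt v t [] _ = sym (ℤ.*-zeroʳ (sg t))
visits-wt v t ((w , u) ∷ K) no∈ with w ≟ v
... | no  _    = trans (ℤ.+-identityˡ _) (visits-wt v t K (no∈ ∘ there))
... | yes refl with u ≟ᵇ t
... | yes refl = trans (cong₂ ℤ._+_ (sym (ℤ.*-identityʳ (sg t))) (visits-wt v t K (no∈ ∘ there)))
                       (sym (ℤ.*-distribˡ-+ (sg t) 1ℤ (ℤ.+ visits v K)))
... | no  u≢t  = ⊥-elim (no∈ (here (cong (v ,_) (sym (Bool.¬-not u≢t)))))

visits-∈ : ∀ {n} (v : Fin n) K → visits v K ≢ 0 → ∃ λ t → (v , t) ∈ K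
visits-∈ v [] ne = ⊥-elim (ne refl)
visits-∈ v ((w , u) ∷ K) ne with w ≟ v
... | yes refl = u , here refl
... | no  _    with t , p ← visits-∈ v K ne = t , there p

Agreeing : ∀ {n} → List (State n) → Set
Agreeing K = ∀ {σ} → σ ∈ K → flip σ ∉ K

Divisible : ∀ {n} → List (State n) → Set
Divisible K = ∀ v → 3ℤ ∣ℤ wtSum v K

-- Defects of one sign do not cancel: their signed number is plus or minus their number, a nonzero
-- multiple of 3.
visits≥3 : ∀ {n} K → Agreeing K → Divisible K → ∀ (v : Fin n) → visits v K ≢ 0 → 3 ≤ visits v K
visits≥3 K agree div v ne with visits-∈ v K ne
... | t , p = multiple (visits v K) ne (subst (3 ∣_) (∣sg*∣ t (ℤ.+ visits v K))
                (∣ℤ.∣⇒∣ᵤ (subst (3ℤ ∣ℤ_) (visits-wt v t K (agree p)) (div v))))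
  where
  multiple : ∀ k → k ≢ 0 → 3 ∣ k → 3 ≤ k
  multiple k ne (divides zero    refl) = ⊥-elim (ne refl)
  multiple k ne (divides (suc q) refl) = ℕ.m≤m+n 3 (q * 3)

visits≤length : ∀ {n} (v : Fin n) K → visits v K ≤ length K
visits≤length v []            = z≤n
visits≤length v ((w , _) ∷ K) with does (w ≟ v)
... | true  = s≤s (visits≤length v K)
... | false = ℕ.m≤n⇒m≤1+n (visits≤length v K)

all-visits : ∀ {n} (v : Fin n) K → length K ≤ visits v K → ∀ {σ} → σ ∈ K → proj₁ σ ≡ v
all-visits v ((w , _) ∷ K) len≤ p with w ≟ v
all-visits v ((w , _) ∷ K) len≤       p           | no  _    = ⊥-elim (ℕ.<⇒≱ len≤ (visits≤length v K))
all-visits v ((w , _) ∷ K) len≤       (here refl) | yes refl = refl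
all-visits v ((w , _) ∷ K) (s≤s len≤) (there p)   | yes refl = all-visits v K len≤ p

-- The vertex of `σ` takes at least three cuts, hence all of them, and they share one sign.
few-cuts : ∀ {n} {σ : State n} K → Agreeing (σ ∷ K) → Divisible (σ ∷ K) → length K ≤ 2 → K ≡ σ ∷ σ ∷ []
few-cuts {n} {σ} K agree div len≤ = exact K len≥ len≤ equal
  where
  v : Fin n
  v = proj₁ σ
  3≤ : 3 ≤ visits v (σ ∷ K)
  3≤ = visits≥3 (σ ∷ K) agree div v (λ eq → ℕ.1+n≢0 (trans (sym (cong (λ b → ind b + visits v K) (≟-refl v))) eq))
  len≥ : 2 ≤ length K
  len≥ = ℕ.≤-pred (ℕ.≤-trans 3≤ (visits≤length v (σ ∷ K)))
  ≡-or-not : ∀ s t → t ≡ s ⊎ t ≡ not s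
  ≡-or-not true  true  = inj₁ refl
  ≡-or-not true  false = inj₂ refl
  ≡-or-not false true  = inj₂ refl
  ≡-or-not false false = inj₁ refl
  equal : ∀ {ρ} → ρ ∈ K → ρ ≡ σ
  equal {ρ} p with ≡-or-not (proj₂ σ) (proj₂ ρ) | all-visits v (σ ∷ K) (ℕ.≤-trans (s≤s len≤) 3≤) (there p)
  ... | inj₁ eq | at-v = cong₂ _,_ at-v eq
  ... | inj₂ eq | at-v = ⊥-elim (agree (here refl) (there (subst (_∈ K) (cong₂ _,_ at-v eq) p)))
  exact : ∀ K → 2 ≤ length K → length K ≤ 2 → (∀ {ρ} → ρ ∈ K → ρ ≡ σ) → K ≡ σ ∷ σ ∷ []
  exact (ρ ∷ τ ∷ [])    _ _                 eq = cong₂ (λ a b → a ∷ b ∷ []) (eq (here refl)) (eq (there (here refl)))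
  exact []              () _                 eq
  exact (_ ∷ [])        (s≤s ()) _           eq
  exact (_ ∷ _ ∷ _ ∷ _) _ (s≤s (s≤s ()))     eq

positive : ℕ → Bool
positive zero    = false
positive (suc _) = true

positive-false : ∀ {k} → positive k ≡ false → k ≡ 0
positive-false {zero} _ = refl

-- The degree bound of the polynomial argument; `suc` stands for the arc that is never flipped. One
-- vertex needs the assumption of four cuts, while for D ≥ 2 vertices already 2D + 1 < 3D.
few-active : ∀ {n} (K : List (State n)) → Agreeing K → Divisible K → 4 ≤ length K →
             suc (sumℕ n (λ v → 2 * ind (positive (visits v K)))) < length K
few-active {n} K agree div 4≤ = subst (λ y → suc y < length K) (sym (sumℕ-*ˡ n 2 (λ v → ind (positive (visits v K)))))
    (bound D (subst₂ _≤_ (sumℕ-*ˡ n 3 _) (sum-visits K) (sumℕ-mono n each)) 4≤)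
  where
  D : ℕ
  D = sumℕ n (λ v → ind (positive (visits v K)))
  each : ∀ v → 3 * ind (positive (visits v K)) ≤ visits v K
  each v with visits v K | visits≥3 K agree div v
  ... | zero  | _ = z≤n
  ... | suc _ | p = p (λ ())
  bound : ∀ D {N} → 3 * D ≤ N → 4 ≤ N → suc (2 * D) < N
  bound 0             _    4≤ = ℕ.≤-trans (s≤s (s≤s z≤n)) 4≤
  bound 1             _    4≤ = 4≤
  bound (suc (suc D)) 3D≤N 4≤ = ℕ.≤-trans (ℕ.≤-trans (ℕ.m≤m+n _ D) (ℕ.≤-reflexive (lemma D))) 3D≤N
    where
    lemma : ∀ D → suc (suc (2 * suc (suc D))) + D ≡ 3 * suc (suc D)
    lemma = ℕS.solve-∀

-- Flipping a set of arcs of a closed trail with cuts σ ∷ K: x lists, for each cut in K, whether the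
-- arc ending there is flipped; the last arc is not.  A cut survives iff its two arcs agree.

bit : Bool → ℤ
bit true  = 1ℤ
bit false = 0ℤ

module _ {n : ℕ} where

  flipBy : Bool → State n → State n
  flipBy b (v , s) = v , s xor b

  lead : (K : List (State n)) → Cube (length K) → Bool
  lead []      []      = false
  lead (ρ ∷ K) (x ∷ _) = x

  survivors : (K : List (State n)) → Cube (length K) → List (State n)
  survivors []      []       = []
  survivors (ρ ∷ K) (x ∷ xs) = if x xor lead K xs then survivors K xs else flipBy x ρ ∷ survivors K xs

  lin : Fin n → State n → (K : List (State n)) → Cube (length K) → ℤ
  lin v σ []      []       = 0ℤ
  lin v σ (ρ ∷ K) (x ∷ xs) = bit x ℤ.* (wt v σ ℤ.+ wt v ρ) ℤ.+ lin v ρ K xs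

  lin-deg : ∀ v σ K → Deg 1 (lin v σ K)
  lin-deg v σ []      = tt
  lin-deg v σ (ρ ∷ K) = deg-cong 1 (λ x → off (wt v σ ℤ.+ wt v ρ) (lin v ρ K x)) (lin-deg v ρ K) ,
                        deg-cong 0 (λ x → on (wt v σ ℤ.+ wt v ρ) (lin v ρ K x)) (deg-const 0 (wt v σ ℤ.+ wt v ρ))
    where
    off : ∀ a b → b ≡ 0ℤ ℤ.* a ℤ.+ b
    off = ℤS.solve-∀
    on : ∀ a b → a ≡ (1ℤ ℤ.* a ℤ.+ b) ℤ.- (0ℤ ℤ.* a ℤ.+ b)
    on = ℤS.solve-∀

  lin-origin : ∀ v σ K → lin v σ K origin ≡ 0ℤ
  lin-origin v σ []      = refl
  lin-origin v σ (ρ ∷ K) = cong₂ ℤ._+_ (ℤ.*-zeroˡ (wt v σ ℤ.+ wt v ρ)) (lin-origin v ρ K)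

  lin-inactive : ∀ v σ K → visits v (σ ∷ K) ≡ 0 → ∀ x → lin v σ K x ≡ 0ℤ
  lin-inactive v σ []      _  []       = refl
  lin-inactive v σ (ρ ∷ K) eq (x ∷ xs) =
    trans (cong₂ (λ a b → bit x ℤ.* a ℤ.+ b) (cong₂ ℤ._+_ (unvisited σ (ℕ.m+n≡0⇒m≡0 _ eq)) (unvisited ρ (ℕ.m+n≡0⇒m≡0 _ eq′)))
                                             (lin-inactive v ρ K eq′ xs))
          (trans (ℤ.+-identityʳ _) (ℤ.*-zeroʳ (bit x)))
    where
    eq′ : visits v (ρ ∷ K) ≡ 0
    eq′ = ℕ.m+n≡0⇒n≡0 (ind (does (proj₁ σ ≟ v))) eq
    unvisited : ∀ σ → ind (does (proj₁ σ ≟ v)) ≡ 0 → wt v σ ≡ 0ℤ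
    unvisited σ p with does (proj₁ σ ≟ v)
    ... | false = refl

  wt-flipBy : ∀ v σ → wt v (flipBy true σ) ≡ - wt v σ
  wt-flipBy v (w , s) = trans (cong (λ b → wt v (w , b)) (Bool.xor-comm s true)) (wt-flip v (w , s))

  -- A cut with one flipped arc loses its weight, and a cut with two flipped arcs loses it twice. So
  -- each flipped arc subtracts the weights of both its ends, which makes the change linear in `x`.
  -- The last term corrects for `σ`, which is counted in `lin` but is not in `K`.
  wtSum-survivors : ∀ v σ K x → wtSum v (survivors K x) ℤ.+ lin v σ K x ≡ wtSum v K ℤ.+ bit (lead K x) ℤ.* wt v σ
  wtSum-survivors v σ []      []       = sym (trans (ℤ.+-identityˡ _) (ℤ.*-zeroˡ (wt v σ)))
  wtSum-survivors v σ (ρ ∷ K) (x ∷ xs) with lead K xs | wtSum-survivors v ρ K xs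
  wtSum-survivors v σ (ρ ∷ K) (false ∷ xs) | false | ih =
    trans (cong (λ s → (wt v (proj₁ ρ , s) ℤ.+ S) ℤ.+ (0ℤ ℤ.* (a ℤ.+ b) ℤ.+ l)) (Bool.xor-identityʳ (proj₂ ρ)))
      (trans (l₁ a b S l) (trans (cong (λ y → b ℤ.+ y) ih) (l₂ a b (wtSum v K))))
    where
    a = wt v σ ; b = wt v ρ ; S = wtSum v (survivors K xs) ; l = lin v ρ K xs
    l₁ : ∀ a b s l → (b ℤ.+ s) ℤ.+ (0ℤ ℤ.* (a ℤ.+ b) ℤ.+ l) ≡ b ℤ.+ (s ℤ.+ l)
    l₁ = ℤS.solve-∀
    l₂ : ∀ a b k → b ℤ.+ (k ℤ.+ 0ℤ ℤ.* b) ≡ (b ℤ.+ k) ℤ.+ 0ℤ ℤ.* a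
    l₂ = ℤS.solve-∀
  wtSum-survivors v σ (ρ ∷ K) (true ∷ xs) | true | ih =
    trans (cong (λ y → (y ℤ.+ S) ℤ.+ (1ℤ ℤ.* (a ℤ.+ b) ℤ.+ l)) (wt-flipBy v ρ))
      (trans (l₁ a b S l) (trans (cong (λ y → a ℤ.+ y) ih) (l₂ a b (wtSum v K))))
    where
    a = wt v σ ; b = wt v ρ ; S = wtSum v (survivors K xs) ; l = lin v ρ K xs
    l₁ : ∀ a b s l → (- b ℤ.+ s) ℤ.+ (1ℤ ℤ.* (a ℤ.+ b) ℤ.+ l) ≡ a ℤ.+ (s ℤ.+ l)
    l₁ = ℤS.solve-∀
    l₂ : ∀ a b k → a ℤ.+ (k ℤ.+ 1ℤ ℤ.* b) ≡ (b ℤ.+ k) ℤ.+ 1ℤ ℤ.* a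
    l₂ = ℤS.solve-∀
  wtSum-survivors v σ (ρ ∷ K) (true ∷ xs) | false | ih =
    trans (l₁ a b S l) (trans (cong (λ y → (a ℤ.+ b) ℤ.+ y) ih) (l₂ a b (wtSum v K)))
    where
    a = wt v σ ; b = wt v ρ ; S = wtSum v (survivors K xs) ; l = lin v ρ K xs
    l₁ : ∀ a b s l → s ℤ.+ (1ℤ ℤ.* (a ℤ.+ b) ℤ.+ l) ≡ (a ℤ.+ b) ℤ.+ (s ℤ.+ l)
    l₁ = ℤS.solve-∀
    l₂ : ∀ a b k → (a ℤ.+ b) ℤ.+ (k ℤ.+ 0ℤ ℤ.* b) ≡ (b ℤ.+ k) ℤ.+ 1ℤ ℤ.* a
    l₂ = ℤS.solve-∀
  wtSum-survivors v σ (ρ ∷ K) (false ∷ xs) | true | ih =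
    trans (l₁ a b S l) (trans ih (l₂ a b (wtSum v K)))
    where
    a = wt v σ ; b = wt v ρ ; S = wtSum v (survivors K xs) ; l = lin v ρ K xs
    l₁ : ∀ a b s l → s ℤ.+ (0ℤ ℤ.* (a ℤ.+ b) ℤ.+ l) ≡ s ℤ.+ l
    l₁ = ℤS.solve-∀
    l₂ : ∀ a b k → k ℤ.+ 1ℤ ℤ.* b ≡ (b ℤ.+ k) ℤ.+ 0ℤ ℤ.* a
    l₂ = ℤS.solve-∀

  survivors-≤ : ∀ K x → length (survivors K x) ≤ length K
  survivors-≤ []      []       = z≤n
  survivors-≤ (ρ ∷ K) (x ∷ xs) with x xor lead K xs
  ... | true  = ℕ.m≤n⇒m≤1+n (survivors-≤ K xs)
  ... | false = s≤s (survivors-≤ K xs)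

  -- The first and the last arc are unflipped and some other arc is flipped, so two neighbouring
  -- arcs disagree at a cut in `K`.
  survivors-< : ∀ K x → x ≢ origin → lead K x ≡ false → length (survivors K x) < length K
  survivors-< []      []           ne _ = ⊥-elim (ne refl)
  survivors-< (ρ ∷ K) (false ∷ xs) ne _ with lead K xs in eq
  ... | true  = s≤s (survivors-≤ K xs)
  ... | false = s≤s (survivors-< K xs (λ { refl → ne refl }) eq)

-- Chains of arcs and their reduction to three defects

same? : Bool → Bool → Bool
same? a b = not (a xor b)

module _ {n m : ℕ} (G : SignedGraph n m) where

  reverseDart : Dart G → Dart G
  reverseDart (e , h) = e , opp h

  reverseWalk : List (Dart G) → List (Dart G)
  reverseWalk []      = []
  reverseWalk (d ∷ L) = reverseWalk L ++ reverseDart d ∷ []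

  walk-reverse : ∀ {u w} L → IsWalk G u L w → IsWalk G w (reverseWalk L) u
  walk-reverse []            refl       = refl
  walk-reverse ((e , h) ∷ L) (refl , p) = walk-++ G (reverseWalk L) (walk-reverse L p) (refl , cong (end G e) (opp-opp h))

  par-reverse : ∀ L → par G (reverseWalk L) ≡ par G L
  par-reverse []      = refl
  par-reverse (d ∷ L) = trans (par-++ G (reverseWalk L) _)
    (trans (cong₂ _xor_ (par-reverse L) (Bool.xor-identityʳ (neg G d))) (Bool.xor-comm (par G L) (neg G d)))

  cnt-reverse : ∀ e L → cnt G e (reverseWalk L) ≡ cnt G e L
  cnt-reverse e []      = refl
  cnt-reverse e (d ∷ L) = trans (cnt-++ G e (reverseWalk L) _)
    (trans (cong₂ _+_ (cnt-reverse e L) (ℕ.+-identityʳ _)) (ℕ.+-comm (cnt G e L) _))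

  -- Labels propagate along an arc so that values are conserved at inner vertices; hence the labels
  -- leaving its two ends agree iff the arc is negative.
  record Conn (A : List (Dart G)) (σ τ : State n) : Set where
    constructor conn
    field
      walk : IsWalk G (proj₁ σ) A (proj₁ τ)
      sign : par G A ≡ same? (proj₂ σ) (proj₂ τ)

  conn-flip : ∀ {A σ τ} b → Conn A σ τ → Conn A (flipBy b σ) (flipBy b τ)
  conn-flip {σ = u , s} {w , t} b (conn p q) = conn p (trans q (lemma s t b))
    where
    lemma : ∀ s t b → same? s t ≡ same? (s xor b) (t xor b)
    lemma true  true  true  = refl
    lemma true  true  false = refl
    lemma true  false true  = refl
    lemma true  false false = refl
    lemma false true  true  = refl
    lemma false true  false = refl
    lemma false false true  = refl
    lemma false false false = refl

  conn-join : ∀ {A B σ ρ τ} → Conn A σ (flip ρ) → Conn B ρ τ → Conn (A ++ B) σ τ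
  conn-join {A} {B} {u , s} {v , r} {w , t} (conn p q) (conn p′ q′) =
    conn (walk-++ G A p p′) (trans (par-++ G A B) (trans (cong₂ _xor_ q q′) (lemma s r t)))
    where
    lemma : ∀ s r t → same? s (not r) xor same? r t ≡ same? s t
    lemma true  true  true  = refl
    lemma true  true  false = refl
    lemma true  false true  = refl
    lemma true  false false = refl
    lemma false true  true  = refl
    lemma false true  false = refl
    lemma false false true  = refl
    lemma false false false = refl

  conn-reverse : ∀ {A σ τ} → Conn A σ τ → Conn (reverseWalk A) τ σ
  conn-reverse {A} {u , s} {w , t} (conn p q) = conn (walk-reverse A p) (trans (par-reverse A) (trans q (cong not (Bool.xor-comm s t))))

  -- Chain c σ K τ: arcs from σ to τ with cuts K in between, using each edge e exactly c e times.
  data Chain (c : Fin m → ℕ) (σ : State n) : List (State n) → State n → Set where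
    one  : ∀ {τ} A → Conn A σ τ → (∀ e → cnt G e A ≡ c e) → Chain c σ [] τ
    cons : ∀ {ρ K τ c′} A → Conn A σ ρ → Chain c′ ρ K τ → (∀ e → cnt G e A + c′ e ≡ c e) → Chain c σ (ρ ∷ K) τ

  -- Arriving with `flip ρ` and departing with `ρ` conserves the value, so the meeting point is an
  -- inner vertex of a longer arc and not a cut.
  joinArc : ∀ {c c′ σ ρ K τ} A → Conn A σ (flip ρ) → Chain c′ ρ K τ → (∀ e → cnt G e A + c′ e ≡ c e) → Chain c σ K τ
  joinArc A p (one B q eB) eq = one (A ++ B) (conn-join p q) λ e → trans (cnt-++ G e A B) (trans (cong (cnt G e A +_) (eB e)) (eq e))
  joinArc A p (cons B q C eB) eq = cons (A ++ B) (conn-join p q) C λ e →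
    trans (cong (_+ _) (cnt-++ G e A B)) (trans (ℕ.+-assoc (cnt G e A) _ _) (trans (cong (cnt G e A +_) (eB e)) (eq e)))

  append : ∀ {c c₁ c₂ σ K ρ K′ τ} → Chain c₁ σ K ρ → Chain c₂ ρ K′ τ → (∀ e → c₁ e + c₂ e ≡ c e) → Chain c σ (K ++ ρ ∷ K′) τ
  append (one A p eA) D eq = cons A p D λ e → trans (cong (_+ _) (eA e)) (eq e)
  append {c₂ = c₂} (cons {c′ = c′} A p C eA) D eq = cons A p (append C D (λ e → refl)) λ e →
    trans (sym (ℕ.+-assoc (cnt G e A) (c′ e) (c₂ e))) (trans (cong (_+ c₂ e) (eA e)) (eq e))

  appendJoin : ∀ {c c₁ c₂ σ K ρ K′ τ} → Chain c₁ σ K (flip ρ) → Chain c₂ ρ K′ τ → (∀ e → c₁ e + c₂ e ≡ c e) → Chain c σ (K ++ K′) τ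
  appendJoin (one A p eA) D eq = joinArc A p D λ e → trans (cong (_+ _) (eA e)) (eq e)
  appendJoin {c₂ = c₂} (cons {c′ = c′} A p C eA) D eq = cons A p (appendJoin C D (λ e → refl)) λ e →
    trans (sym (ℕ.+-assoc (cnt G e A) (c′ e) (c₂ e))) (trans (cong (_+ c₂ e) (eA e)) (eq e))

  splitChain : ∀ {c σ} K {ρ K′ τ} → Chain c σ (K ++ ρ ∷ K′) τ →
    ∃ λ c₁ → ∃ λ c₂ → Chain c₁ σ K ρ × Chain c₂ ρ K′ τ × (∀ e → c₁ e + c₂ e ≡ c e)
  splitChain []      (cons A p C eA) = (λ e → cnt G e A) , _ , one A p (λ _ → refl) , C , eA
  splitChain (κ ∷ K) (cons A p C eA) with splitChain K C
  ... | c₁ , c₂ , D , D′ , eq = (λ e → cnt G e A + c₁ e) , c₂ , cons A p D (λ _ → refl) , D′ ,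
    λ e → trans (ℕ.+-assoc (cnt G e A) (c₁ e) (c₂ e)) (trans (cong (cnt G e A +_) (eq e)) (eA e))

  reverseChain : ∀ {c σ K τ} → Chain c σ K τ → Chain c τ (rev K) σ
  reverseChain (one A p eA)    = one (reverseWalk A) (conn-reverse {A} p) λ e → trans (cnt-reverse e A) (eA e)
  reverseChain (cons {c′ = c′} A p C eA) = append (reverseChain C) (one (reverseWalk A) (conn-reverse {A} p) (λ e → refl)) λ e →
    trans (ℕ.+-comm (c′ e) _) (trans (cong (_+ c′ e) (cnt-reverse e A)) (eA e))

  -- Arriving with flip σ means that the base is not a defect, so that it can be moved to a cut.
  rebase : ∀ {c σ ρ K} → Chain c σ (ρ ∷ K) (flip σ) → Chain c ρ K ρ
  rebase {K = K} (cons {c′ = c′} A p C eA) = subst (λ K → Chain _ _ K _) (List.++-identityʳ K)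
    (appendJoin C (one A p (λ _ → refl)) λ e → trans (ℕ.+-comm (c′ e) _) (eA e))

  parity : (Fin m → ℕ) → Bool
  parity c = odd? (sumℕ m (λ e → c e * ind (negative G e)))

  -- Each arc contributes 1 plus the difference of its end labels modulo 2. The differences
  -- telescope, as both arcs at a cut have the same label there.
  chain-parity : ∀ {c u s K w t} → Chain c (u , s) K (w , t) → parity c ≡ odd? (suc (length K)) xor (s xor t)
  chain-parity (one A (conn p q) eA) = trans (cong odd? (sumℕ-cong m λ e → cong (_* ind (negative G e)) (sym (eA e)))) (trans (sym (par-cnt G A)) q)
  chain-parity {s = s} {t = t} (cons {ρ = _ , r} {K} {c′ = c′} A (conn p q) C eA) =
    trans (cong odd? (trans (sumℕ-cong m λ e → trans (cong (_* ind (negative G e)) (sym (eA e))) (ℕ.*-distribʳ-+ (ind (negative G e)) (cnt G e A) (c′ e))) (sumℕ-+ m _ _)))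
      (trans (odd?-+ (sumℕ m (λ e → cnt G e A * ind (negative G e))) _)
        (trans (cong₂ _xor_ (trans (sym (par-cnt G A)) q) (chain-parity C)) (lemma s r t (odd? (suc (length K))))))
    where
    lemma : ∀ s r t o → same? s r xor (o xor (r xor t)) ≡ not o xor (s xor t)
    lemma true  true  t o = Bool.not-distribˡ-xor o (not t)
    lemma true  false true  true  = refl
    lemma true  false true  false = refl
    lemma true  false false true  = refl
    lemma true  false false false = refl
    lemma false true  true  true  = refl
    lemma false true  true  false = refl
    lemma false true  false true  = refl
    lemma false true  false false = refl
    lemma false false t o = Bool.not-distribˡ-xor o t

  flipChain : ∀ {c σ} K {τ} (x : Cube (length K)) → Chain c σ K τ → Chain c (flipBy (lead K x) σ) (survivors K x) τ
  flipChain {σ = u , s} [] [] C = subst (λ b → Chain _ (u , b) _ _) (sym (Bool.xor-identityʳ s)) C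
  flipChain (ρ ∷ K) (x ∷ xs) (cons A p C eA) with x | lead K xs | flipChain K xs C
  ... | false | false | D = cons A (conn-flip {A} false p) D eA
  ... | true  | true  | D = cons A (conn-flip {A} true p) D eA
  ... | false | true  | D = joinArc A (subst (Conn A _) (lemma ρ) (conn-flip {A} false p)) D eA
    where
    lemma : ∀ (ρ : State n) → flipBy false ρ ≡ flip (flipBy true ρ)
    lemma (v , true)  = refl
    lemma (v , false) = refl
  ... | true  | false | D = joinArc A (subst (Conn A _) (lemma ρ) (conn-flip {A} true p)) D eA
    where
    lemma : ∀ (ρ : State n) → flipBy true ρ ≡ flip (flipBy false ρ)
    lemma (v , true)  = refl
    lemma (v , false) = refl

  module _ {c : Fin m → ℕ} (odd : parity c ≡ true) where

    -- The end labels of a single odd arc agree. Hence a closed trail of odd sign without a defect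
    -- at its base has one elsewhere, and the base can be moved there.
    uncut-impossible : ∀ {u s w} → ¬ Chain c (u , s) [] (w , not s)
    uncut-impossible {s = true}  C with () ← trans (sym odd) (chain-parity C)
    uncut-impossible {s = false} C with () ← trans (sym odd) (chain-parity C)

    ClosedBelow : ℕ → Set
    ClosedBelow k = ∃ λ ρ → ∃ λ K → length K < k × Chain c ρ K ρ × Divisible (ρ ∷ K)

    rebase-below : ∀ {u s} K k → Chain c (u , s) K (u , not s) → Divisible K → length K ≤ k → ClosedBelow k
    rebase-below []      k C _   _  = ⊥-elim (uncut-impossible C)
    rebase-below (ρ ∷ K) k C div lt = ρ , K , lt , rebase C , div

    -- A pair of opposite defects may lie anywhere on the trail, whereas `cancelOpposite` expects
    -- one of them at the base.
    rotate : ∀ {σ K ρ} → Chain c σ K σ → ρ ∈ σ ∷ K → ∃ λ K′ →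
      Chain c ρ K′ ρ × length K′ ≡ length K × (∀ v → wtSum v (ρ ∷ K′) ≡ wtSum v (σ ∷ K)) × (∀ {τ} → τ ∈ σ ∷ K → τ ∈ ρ ∷ K′)
    rotate {K = K} C (here refl) = K , C , refl , (λ _ → refl) , λ p → p
    rotate {σ} {ρ = ρ} C (there p) with ∈-∃++ p
    ... | A , B , refl with splitChain A C
    ... | c₁ , c₂ , D₁ , D₂ , eq = B ++ σ ∷ A , append D₂ D₁ (λ e → trans (ℕ.+-comm (c₂ e) (c₁ e)) (eq e)) , len , sums , moved
      where
      len : length (B ++ σ ∷ A) ≡ length (A ++ ρ ∷ B)
      len = trans (List.length-++ B) (trans (ℕ.+-suc (length B) (length A)) (trans (cong suc (ℕ.+-comm (length B) (length A)))
              (sym (trans (List.length-++ A) (ℕ.+-suc (length A) (length B))))))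
      sums : ∀ v → wtSum v (ρ ∷ B ++ σ ∷ A) ≡ wtSum v (σ ∷ A ++ ρ ∷ B)
      sums v = trans (cong (λ y → wt v ρ ℤ.+ y) (wtSum-++ v B (σ ∷ A)))
        (trans (lemma (wt v ρ) (wtSum v B) (wt v σ) (wtSum v A)) (cong (λ y → wt v σ ℤ.+ y) (sym (wtSum-++ v A (ρ ∷ B)))))
        where
        lemma : ∀ r b s a → r ℤ.+ (b ℤ.+ (s ℤ.+ a)) ≡ s ℤ.+ (a ℤ.+ (r ℤ.+ b))
        lemma = ℤS.solve-∀
      moved : ∀ {τ} → τ ∈ σ ∷ A ++ ρ ∷ B → τ ∈ ρ ∷ B ++ σ ∷ A
      moved (here eq) = there (∈-++⁺ʳ B (here eq))
      moved (there q) with ∈-++⁻ A q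
      ... | inj₁ q∈A         = there (∈-++⁺ʳ B (there q∈A))
      ... | inj₂ (here eq)   = here eq
      ... | inj₂ (there q∈B) = there (∈-++⁺ˡ q∈B)

    -- Reversing the part of the trail between two opposite defects at one vertex removes both.
    cancelOpposite : ∀ {ρ K} → Chain c ρ K ρ → Divisible (ρ ∷ K) → flip ρ ∈ ρ ∷ K → ClosedBelow (length K)
    cancelOpposite {v , true}  C div (here ())
    cancelOpposite {v , false} C div (here ())
    cancelOpposite {ρ} {K} C div (there p) with ∈-∃++ p
    ... | A , B , refl with splitChain A C
    ... | c₁ , c₂ , D₁ , D₂ , eq = rebase-below (B ++ rev A) (length (A ++ flip ρ ∷ B))
            (subst (Chain c (flip ρ) (B ++ rev A)) (sym (flip-flip ρ))
              (appendJoin (subst (Chain c₂ (flip ρ) B) (sym (flip-flip ρ)) D₂) (reverseChain D₁) (λ e → trans (ℕ.+-comm (c₂ e) (c₁ e)) (eq e))))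
            (λ v → subst (3ℤ ∣ℤ_) (sums v) (div v)) len
      where
      len : length (B ++ rev A) ≤ length (A ++ flip ρ ∷ B)
      len = ℕ.≤-trans (ℕ.≤-reflexive (trans (List.length-++ B) (trans (cong (length B +_) (length-rev A)) (ℕ.+-comm (length B) (length A)))))
              (ℕ.≤-trans (ℕ.+-monoʳ-≤ (length A) (ℕ.n≤1+n (length B))) (ℕ.≤-reflexive (sym (List.length-++ A))))
      sums : ∀ v → wtSum v (ρ ∷ A ++ flip ρ ∷ B) ≡ wtSum v (B ++ rev A)
      sums v = trans (cong (λ y → wt v ρ ℤ.+ y) (trans (wtSum-++ v A (flip ρ ∷ B)) (cong (λ y → wtSum v A ℤ.+ (y ℤ.+ wtSum v B)) (wt-flip v ρ))))
        (trans (lemma (wt v ρ) (wtSum v A) (wtSum v B)) (sym (trans (wtSum-++ v B (rev A)) (cong (λ y → wtSum v B ℤ.+ y) (wtSum-rev v A)))))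
        where
        lemma : ∀ r a b → r ℤ.+ (a ℤ.+ (- r ℤ.+ b)) ≡ b ℤ.+ a
        lemma = ℤS.solve-∀

    -- The base lies between the first arc and the last, unflipped one. If the first arc is
    -- unflipped too, the base survives and a cut in `K` disappears; otherwise the base itself
    -- disappears and is moved to a surviving cut.
    flipSome : ∀ {σ K} → Chain c σ K σ → Divisible (σ ∷ K) → Agreeing (σ ∷ K) → 4 ≤ length (σ ∷ K) → ClosedBelow (length K)
    flipSome {σ} {K} C div agree 4≤
      with nontrivial-zero (λ v → lin v σ K) (λ v → positive (visits v (σ ∷ K))) (λ v → lin-deg v σ K) (λ v → lin-origin v σ K)
             (λ v eq → lin-inactive v σ K (positive-false eq)) (ℕ.≤-pred (few-active (σ ∷ K) agree div 4≤))
    ... | x , x≢ , zeros with lead K x in eqLead | flipChain K x C | (λ v → wtSum-survivors v σ K x)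
    ... | false | D | sums = σ , survivors K x , survivors-< K x x≢ eqLead , subst (λ σ′ → Chain c σ′ (survivors K x) σ) (flipBy-false σ) D ,
          λ v → ∣ℤ.∣m+n∣n⇒∣m (subst (3ℤ ∣ℤ_) (sym (trans (ℤ.+-assoc (wt v σ) _ _) (trans (cong (λ y → wt v σ ℤ.+ y) (sums v)) (lemma (wt v σ) (wtSum v K))))) (div v)) (zeros v)
      where
      flipBy-false : ∀ (σ : State n) → flipBy false σ ≡ σ
      flipBy-false (v , s) = cong (v ,_) (Bool.xor-identityʳ s)
      lemma : ∀ a k → a ℤ.+ (k ℤ.+ 0ℤ ℤ.* a) ≡ a ℤ.+ k
      lemma = ℤS.solve-∀
    ... | true  | D | sums = rebase-below (survivors K x) (length K) (subst (Chain c (flipBy true σ) (survivors K x)) (flipBy-true σ) D)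
          (λ v → ∣ℤ.∣m+n∣n⇒∣m (subst (3ℤ ∣ℤ_) (sym (trans (sums v) (lemma (wt v σ) (wtSum v K)))) (div v)) (zeros v)) (survivors-≤ K x)
      where
      flipBy-true : ∀ (σ : State n) → σ ≡ flip (flipBy true σ)
      flipBy-true (v , true)  = refl
      flipBy-true (v , false) = refl
      lemma : ∀ a k → k ℤ.+ 1ℤ ℤ.* a ≡ a ℤ.+ k
      lemma = ℤS.solve-∀

    reduce : ∀ k {σ K} → length K < k → Chain c σ K σ → Divisible (σ ∷ K) → ∃ λ ρ → Chain c ρ (ρ ∷ ρ ∷ []) ρ
    reduce (suc k) {σ} {K} (s≤s len≤) C div with Any.any? (λ ρ → Any.any? (flip ρ ≟ˢ_) (σ ∷ K)) (σ ∷ K)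
    ... | yes some with find some
    ... | ρ , ρ∈ , opposite with rotate C ρ∈
    ... | K′ , C′ , len′ , sums , moved with cancelOpposite C′ (λ v → subst (3ℤ ∣ℤ_) (sym (sums v)) (div v)) (moved opposite)
    ... | τ , K″ , lt , C″ , div″ = reduce k (ℕ.<-≤-trans lt (ℕ.≤-trans (ℕ.≤-reflexive len′) len≤)) C″ div″
    reduce (suc k) {σ} {K} (s≤s len≤) C div | no none with 4 ℕ.≤? suc (length K)
    ... | no  few  = σ , subst (λ K → Chain c σ K σ) (few-cuts K (λ p q → none (lose p q)) div (ℕ.≤-pred (ℕ.≤-pred (ℕ.≰⇒> few)))) C
    ... | yes many with flipSome C div (λ p q → none (lose p q)) many
    ... | ρ , K′ , lt , C′ , div′ = reduce k (ℕ.<-≤-trans lt len≤) C′ div′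

-- The sign with which a value of a nowhere-zero 3-flow is congruent to ±1 modulo 3.
label : ℤ → Bool
label (ℤ.+ 2)    = true
label (ℤ.-[1+ 0 ]) = true
label _          = false

label-mod : ∀ a → a ≢ 0ℤ → ∣ a ∣ < 3 → 3ℤ ∣ℤ a ℤ.- sg (label a)
label-mod (ℤ.+ 0)       ne _ = ⊥-elim (ne refl)
label-mod (ℤ.+ 1)       _  _ = ∣ℤ.divides 0ℤ refl
label-mod (ℤ.+ 2)       _  _ = ∣ℤ.divides 1ℤ refl
label-mod (ℤ.+ suc (suc (suc _))) _ (s≤s (s≤s (s≤s ())))
label-mod (ℤ.-[1+ 0 ])  _  _ = ∣ℤ.divides 0ℤ refl
label-mod (ℤ.-[1+ 1 ])  _  _ = ∣ℤ.divides (- 1ℤ) refl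
label-mod (ℤ.-[1+ suc (suc _) ]) _ (s≤s (s≤s (s≤s ())))

label-neg : ∀ a → a ≢ 0ℤ → ∣ a ∣ < 3 → label (- a) ≡ not (label a)
label-neg (ℤ.+ 0)       ne _ = ⊥-elim (ne refl)
label-neg (ℤ.+ 1)       _  _ = refl
label-neg (ℤ.+ 2)       _  _ = refl
label-neg (ℤ.+ suc (suc (suc _))) _ (s≤s (s≤s (s≤s ())))
label-neg (ℤ.-[1+ 0 ])  _  _ = refl
label-neg (ℤ.-[1+ 1 ])  _  _ = refl
label-neg (ℤ.-[1+ suc (suc _) ]) _ (s≤s (s≤s (s≤s ())))

-- Three-flows and triples of odd closed trails

module _ {n m : ℕ} (G : SignedGraph n m) where

  module _ (x : Fin m → ℤ) (flow : ∀ v → net G x v ≡ 0ℤ) (nz : NowhereZero G x) (bd : ∀ e → ∣ x e ∣ < 3) where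

    leaving arriving : Dart G → Bool
    leaving (e , h)  = label (half G e h (x e))
    arriving (e , h) = label (half G e (opp h) (x e))

    dart-sign : ∀ d → neg G d ≡ same? (leaving d) (arriving d)
    dart-sign (e , h) = lemma (label (half G e h (x e))) _ (negative G e) (opposite h)
      where
      turn-label : ∀ ν a → a ≢ 0ℤ → ∣ a ∣ < 3 → label (turn ν a) ≡ label a xor not ν
      turn-label true  a _  _ = sym (Bool.xor-identityʳ (label a))
      turn-label false a ne b = trans (label-neg a ne b) (Bool.xor-comm true (label a))
      opposite : ∀ h → label (half G e (opp h) (x e)) ≡ label (half G e h (x e)) xor not (negative G e)
      opposite zero       = turn-label (negative G e) (x e) (nz e) (bd e)
      opposite (suc zero) = trans (cancel (label (x e)) (not (negative G e)))
        (cong (_xor not (negative G e)) (sym (turn-label (negative G e) (x e) (nz e) (bd e))))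
        where
        cancel : ∀ a b → a ≡ (a xor b) xor b
        cancel true  true  = refl
        cancel true  false = refl
        cancel false true  = refl
        cancel false false = refl
      lemma : ∀ a b ν → b ≡ a xor not ν → ν ≡ same? a b
      lemma true  _ true  refl = refl
      lemma true  _ false refl = refl
      lemma false _ true  refl = refl
      lemma false _ false refl = refl

    edgeWeight : Fin n → Fin m → ℤ
    edgeWeight v e = at v (end G e zero) (sg (label (x e))) ℤ.+ at v (end G e (suc zero)) (sg (label (turn (negative G e) (x e))))

    edgeWeight-dart : ∀ v d → at v (src G d) (sg (leaving d)) ℤ.+ at v (tgt G d) (sg (arriving d)) ≡ edgeWeight v (proj₁ d)
    edgeWeight-dart v (e , zero)     = refl
    edgeWeight-dart v (e , suc zero) = ℤ.+-comm (at v (end G e (suc zero)) (sg (label (turn (negative G e) (x e))))) _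

    sumEdges : (Fin m → ℤ) → List (Dart G) → ℤ
    sumEdges F []      = 0ℤ
    sumEdges F (d ∷ L) = F (proj₁ d) ℤ.+ sumEdges F L

    sumEdges-cnt : ∀ F L → sumEdges F L ≡ sumℤ m (λ e → ℤ.+ cnt G e L ℤ.* F e)
    sumEdges-cnt F []      = sym (trans (sumℤ-cong m (λ e → ℤ.*-zeroˡ (F e))) (sumℤ-0 m))
    sumEdges-cnt F (d ∷ L) = sym (trans (sumℤ-cong m split) (trans (sumℤ-+ m _ _) (cong₂ ℤ._+_ (sumℤ-δ (proj₁ d) F) (sym (sumEdges-cnt F L)))))
      where
      split : ∀ e → ℤ.+ (ind (does (proj₁ d ≟ e)) + cnt G e L) ℤ.* F e ≡ (if does (proj₁ d ≟ e) then F e else 0ℤ) ℤ.+ ℤ.+ cnt G e L ℤ.* F e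
      split e with does (proj₁ d ≟ e)
      ... | false = sym (ℤ.+-identityˡ _)
      ... | true  = trans (ℤ.*-distribʳ-+ (F e) 1ℤ (ℤ.+ cnt G e L)) (cong₂ ℤ._+_ (ℤ.*-identityˡ (F e)) refl)

    -- Replacing every value by its residue ±1 changes the vanishing net flow by a multiple of 3.
    edgeWeight-total : ∀ v → 3ℤ ∣ℤ sumℤ m (edgeWeight v)
    edgeWeight-total v = ∣ℤ.∣m+n∣m⇒∣n
      (subst (3ℤ ∣ℤ_) (trans (sym (flow v)) (trans (sumℤ-cong m split) (sumℤ-+ m (λ e → δ e zero ℤ.+ δ e (suc zero)) _))) (∣ℤ.divides 0ℤ refl))
      (sumℤ-∣ m (λ e → ∣ℤ.∣m∣n⇒∣m+n (δ-∣ e zero) (δ-∣ e (suc zero))))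
      where
      err : Fin m → Fin 2 → ℤ
      err e h = half G e h (x e) ℤ.- sg (label (half G e h (x e)))
      δ : Fin m → Fin 2 → ℤ
      δ e h = at v (end G e h) (err e h)
      δ-∣ : ∀ e h → 3ℤ ∣ℤ δ e h
      δ-∣ e h with does (end G e h ≟ v)
      ... | false = ∣ℤ.divides 0ℤ refl
      ... | true  = label-mod (half G e h (x e)) (∣∣≢0 G (∣half∣ G e h (x e)) (nz e)) (subst (_< 3) (sym (∣half∣ G e h (x e))) (bd e))
      piece : ∀ w a s → at v w a ≡ at v w (a ℤ.- s) ℤ.+ at v w s
      piece w a s = trans (cong (at v w) (lemma a s)) (at-+ v w (a ℤ.- s) s)
        where
        lemma : ∀ a s → a ≡ (a ℤ.- s) ℤ.+ s
        lemma = ℤS.solve-∀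
      split : ∀ e → at v (end G e zero) (x e) ℤ.+ at v (end G e (suc zero)) (turn (negative G e) (x e)) ≡ (δ e zero ℤ.+ δ e (suc zero)) ℤ.+ edgeWeight v e
      split e = trans (cong₂ ℤ._+_ (piece (end G e zero) (x e) _) (piece (end G e (suc zero)) (turn (negative G e) (x e)) _))
                      (ℤ+.interchange (δ e zero) (at v (end G e zero) (sg (label (x e)))) _ _)

    -- Cutting the walk d ∷ L at its defects; b is the label with which it arrives at w.
    cutWalk : ∀ {w} d L → IsWalk G (tgt G d) L w → ∃ λ K → ∃ λ b →
      Chain G (λ e → cnt G e (d ∷ L)) (src G d , leaving d) K (w , b) ×
      (∀ v → (wtSum v K ℤ.+ wtSum v K) ℤ.+ (wt v (src G d , leaving d) ℤ.+ wt v (w , b)) ≡ sumEdges (edgeWeight v) (d ∷ L))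
    cutWalk d [] refl = [] , arriving d ,
      one (d ∷ []) (conn (refl , refl) (trans (Bool.xor-identityʳ (neg G d)) (dart-sign d))) (λ _ → refl) ,
      λ v → trans (ℤ.+-identityˡ _) (trans (edgeWeight-dart v d) (sym (ℤ.+-identityʳ _)))
    cutWalk {w} d (d′ ∷ L) (meet , p) with cutWalk d′ L p
    ... | K , b , C , sums with arriving d ≟ᵇ leaving d′
    ... | yes eq = ρ ∷ K , b ,
        cons (d ∷ []) (conn (refl , sym meet) (trans (Bool.xor-identityʳ (neg G d)) (trans (dart-sign d) (cong (same? (leaving d)) eq)))) C
             (λ e → cong (_+ cnt G e (d′ ∷ L)) (ℕ.+-identityʳ (ind (does (proj₁ d ≟ e))))) ,
        λ v → trans (lemma (wt v ρ) (wtSum v K) (wt v (src G d , leaving d)) (wt v (w , b)))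
                (cong₂ ℤ._+_ (trans (cong₂ (λ u y → wt v (src G d , leaving d) ℤ.+ at v u (sg y)) meet (sym eq)) (edgeWeight-dart v d)) (sums v))
      where
      ρ : State n
      ρ = src G d′ , leaving d′
      lemma : ∀ r k a b → ((r ℤ.+ k) ℤ.+ (r ℤ.+ k)) ℤ.+ (a ℤ.+ b) ≡ (a ℤ.+ r) ℤ.+ ((k ℤ.+ k) ℤ.+ (r ℤ.+ b))
      lemma = ℤS.solve-∀
    ... | no ne = K , b ,
        joinArc G (d ∷ []) (conn (refl , sym meet) (trans (Bool.xor-identityʳ (neg G d)) (trans (dart-sign d) (cong (same? (leaving d)) arr)))) C
             (λ e → cong (_+ cnt G e (d′ ∷ L)) (ℕ.+-identityʳ (ind (does (proj₁ d ≟ e))))) ,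
        λ v → trans (lemma (wt v ρ) (wtSum v K) (wt v (src G d , leaving d)) (wt v (w , b)))
                (cong₂ ℤ._+_ (trans (cong (λ y → wt v (src G d , leaving d) ℤ.+ y)
                    (trans (sym (wt-flip v ρ)) (cong₂ (λ u y → at v u (sg y)) meet (sym arr)))) (edgeWeight-dart v d)) (sums v))
      where
      ρ : State n
      ρ = src G d′ , leaving d′
      arr : arriving d ≡ not (leaving d′)
      arr = Bool.¬-not ne
      lemma : ∀ r k a b → (k ℤ.+ k) ℤ.+ (a ℤ.+ b) ≡ (a ℤ.+ (- r)) ℤ.+ ((k ℤ.+ k) ℤ.+ (r ℤ.+ b))
      lemma = ℤS.solve-∀

    -- Summing over half-edges counts each defect twice, once on arrival and once on departure; as 2
    -- is invertible modulo 3, the factor can be removed.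
    halve-∣ : ∀ {a} → 3ℤ ∣ℤ a ℤ.+ a → 3ℤ ∣ℤ a
    halve-∣ {a} p = ∣ℤ.∣m+n∣m⇒∣n (subst (3ℤ ∣ℤ_) (lemma a) (∣ℤ.∣n⇒∣m*n a (∣ℤ.∣-refl {3ℤ}))) p
      where
      lemma : ∀ a → a ℤ.* 3ℤ ≡ (a ℤ.+ a) ℤ.+ a
      lemma = ℤS.solve-∀

    threeArcs : ∀ {r} L → IsWalk G r L r → (∀ e → cnt G e L ≡ 1) → par G L ≡ true →
                ∃ λ ρ → Chain G (λ e → cnt G e L) ρ (ρ ∷ ρ ∷ []) ρ
    threeArcs (d ∷ L) (refl , p) once odd with cutWalk d L p
    ... | K , b , C , sums = base (b ≟ᵇ leaving d)
      where
      odd′ : parity G (λ e → cnt G e (d ∷ L)) ≡ true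
      odd′ = trans (sym (par-cnt G (d ∷ L))) odd
      div : ∀ v → 3ℤ ∣ℤ (wtSum v K ℤ.+ wtSum v K) ℤ.+ (wt v (src G d , leaving d) ℤ.+ wt v (src G d , b))
      div v = subst (3ℤ ∣ℤ_) (sym (trans (sums v) (trans (sumEdges-cnt (edgeWeight v) (d ∷ L))
                (sumℤ-cong m (λ e → trans (cong (λ k → ℤ.+ k ℤ.* edgeWeight v e) (once e)) (ℤ.*-identityˡ _)))))) (edgeWeight-total v)
      σ : State n
      σ = src G d , leaving d
      base : Dec (b ≡ leaving d) → ∃ λ ρ → Chain G (λ e → cnt G e (d ∷ L)) ρ (ρ ∷ ρ ∷ []) ρ
      base (yes eq) = reduce G odd′ (suc (length K)) ℕ.≤-refl (subst (λ b → Chain G _ σ K (src G d , b)) eq C)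
          (λ v → halve-∣ (subst (3ℤ ∣ℤ_) (trans (cong (λ b → (wtSum v K ℤ.+ wtSum v K) ℤ.+ (wt v σ ℤ.+ wt v (src G d , b))) eq)
                                               (lemma (wtSum v K) (wt v σ))) (div v)))
        where
        lemma : ∀ k a → (k ℤ.+ k) ℤ.+ (a ℤ.+ a) ≡ (a ℤ.+ k) ℤ.+ (a ℤ.+ k)
        lemma = ℤS.solve-∀
      -- The tour closes up without a defect: the two labels at the base cancel, and only the cuts
      -- in `K` count.
      base (no ne) = rebased (rebase-below G odd′ K (length K) (subst (λ b → Chain G _ σ K (src G d , b)) opposite C) divK ℕ.≤-refl)
        where
        opposite : b ≡ not (leaving d)
        opposite = Bool.¬-not ne
        lemma : ∀ k a → (k ℤ.+ k) ℤ.+ (a ℤ.+ (- a)) ≡ k ℤ.+ k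
        lemma = ℤS.solve-∀
        divK : Divisible K
        divK v = halve-∣ (subst (3ℤ ∣ℤ_) (trans (cong (λ y → (wtSum v K ℤ.+ wtSum v K) ℤ.+ (wt v σ ℤ.+ y))
                             (trans (cong (λ b → wt v (src G d , b)) opposite) (wt-flip v σ))) (lemma (wtSum v K) (wt v σ))) (div v))
        rebased : ClosedBelow G odd′ (length K) → ∃ λ ρ → Chain G (λ e → cnt G e (d ∷ L)) ρ (ρ ∷ ρ ∷ []) ρ
        rebased (ρ , K′ , lt , C′ , div′) = reduce G odd′ (length K) lt C′ div′

  listWalk : ∀ {S : EdgeSet m} {u w} L → (∀ e → cnt G e L ≢ 0 → S e ≡ true) → IsWalk G u L w → Walk G S u w
  listWalk []      used refl = ε
  listWalk {S} ((e , h) ∷ L) used (refl , p) =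
      (e , used e (λ eq → ℕ.1+n≢0 (trans (sym (cong (λ b → ind b + cnt G e L) (≟-refl e))) eq)) , ends h) ◅
      listWalk L (λ f ne → used f (λ eq → ne (ℕ.m+n≡0⇒n≡0 (ind (does (e ≟ f))) eq))) p
    where
    ends : ∀ h → (end G e zero ≡ end G e h × end G e (suc zero) ≡ end G e (opp h)) ⊎
                 (end G e zero ≡ end G e (opp h) × end G e (suc zero) ≡ end G e h)
    ends zero       = inj₁ (refl , refl)
    ends (suc zero) = inj₂ (refl , refl)

  oddClosed⇒eulerian : ∀ {S : EdgeSet m} {v} A → IsWalk G v A v → par G A ≡ true → (∀ e → ind (S e) ≡ cnt G e A) →
    -- The odd sign excludes the empty walk, so `A` has a first dart, which shows that `S` is
    -- nonempty and touches `v`.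
    (EulerianSub G S × Odd (negCount G S)) × Touches G S v
  oddClosed⇒eulerian {S} {v} A@((e₀ , h₀) ∷ A₀) walk odd eq = (((e₀ , e₀∈S) , connected , even) , oddNeg) , e₀ , e₀∈S , h₀ , proj₁ walk
    where
    used : ∀ e → cnt G e A ≢ 0 → S e ≡ true
    used e ne = ind-true (S e) (λ p → ne (trans (sym (eq e)) p))
    e₀∈S : S e₀ ≡ true
    e₀∈S = used e₀ (λ p → ℕ.1+n≢0 (trans (sym (cong (λ b → ind b + cnt G e₀ A₀) (≟-refl e₀))) p))
    even : ∀ w → Even (valency G S w)
    even w = odd?≡false⇒even _ (trans (cong odd? (trans (sumℕ-cong m (λ e → cong (_* halfEdgesAt G w e) (eq e))) (sym (sumL-cnt G (halfEdgesAt G w) A))))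
               (trans (walk-valency G w A walk) (Bool.xor-same (does (v ≟ w)))))
    oddNeg : Odd (negCount G S)
    oddNeg = odd?≡true⇒odd (trans (cong odd? (sumℕ-cong m (λ e → cong (_* ind (negative G e)) (eq e)))) (trans (sym (par-cnt G A)) odd))
    from : ∀ u → Touches G S u → Walk G S v u
    from u (e , Se , h , refl) with on-ends G e h A walk (λ p → ℕ.1+n≢0 (trans (sym (cong ind Se)) (trans (eq e) p)))
    ... | A₁ , A₂ , A≡ , w₁ , _ = listWalk A₁ (λ f ne → used f (λ p → ne (ℕ.m+n≡0⇒m≡0 _ (trans (sym (cnt-++ G f A₁ A₂)) (trans (cong (cnt G f) (sym A≡)) p))))) w₁
    connected : ConnectedOn G S
    connected u w tu tw = walk-sym G (from u tu) ◅◅ from w tw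

  arcs⇒decomposition : ∀ {c ρ} → (∀ e → c e ≡ 1) → Chain G c ρ (ρ ∷ ρ ∷ []) ρ → ThreeOddEulerianDecomposition G
  arcs⇒decomposition {c} {v , s} once (cons A₀ (conn w₀ p₀) (cons A₁ (conn w₁ p₁) (one A₂ (conn w₂ p₂) e₂) e₁) e₀) =
      colour , (λ i → proj₁ (each i)) , v , λ i → proj₂ (each i)
    where
    pick : ℕ → ℕ → Fin 3
    pick (suc _) _       = zero
    pick zero    (suc _) = suc zero
    pick zero    zero    = suc (suc zero)
    colour : Fin m → Fin 3
    colour e = pick (cnt G e A₀) (cnt G e A₁)
    total : ∀ e → cnt G e A₀ + (cnt G e A₁ + cnt G e A₂) ≡ 1
    total e = trans (cong (λ k → cnt G e A₀ + (cnt G e A₁ + k)) (e₂ e)) (trans (cong (cnt G e A₀ +_) (e₁ e)) (trans (e₀ e) (once e)))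
    exact : ∀ a b c → a + (b + c) ≡ 1 →
      ind (does (pick a b ≟ zero)) ≡ a × ind (does (pick a b ≟ suc zero)) ≡ b × ind (does (pick a b ≟ suc (suc zero))) ≡ c
    exact 1 0 0 refl = refl , refl , refl
    exact 0 1 0 refl = refl , refl , refl
    exact 0 0 1 refl = refl , refl , refl
    odd : ∀ {A} → par G A ≡ same? s s → par G A ≡ true
    odd p = trans p (cong not (Bool.xor-same s))
    each : ∀ i → (EulerianSub G (part G colour i) × Odd (negCount G (part G colour i))) × Touches G (part G colour i) v
    each zero             = oddClosed⇒eulerian A₀ w₀ (odd {A₀} p₀) λ e → proj₁ (exact (cnt G e A₀) (cnt G e A₁) (cnt G e A₂) (total e))
    each (suc zero)       = oddClosed⇒eulerian A₁ w₁ (odd {A₁} p₁) λ e → proj₁ (proj₂ (exact (cnt G e A₀) (cnt G e A₁) (cnt G e A₂) (total e)))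
    each (suc (suc zero)) = oddClosed⇒eulerian A₂ w₂ (odd {A₂} p₂) λ e → proj₂ (proj₂ (exact (cnt G e A₀) (cnt G e A₁) (cnt G e A₂) (total e)))

  decomposition⇒3-flow : ThreeOddEulerianDecomposition G → HasNZkFlow G 3
  decomposition⇒3-flow (c , parts , v , touched) = ⇒kFlow G x flow (λ e eq → proj₁ (value e) eq) (λ e → proj₂ (value e))
    where
    tour : ∀ i → Σ (List (Dart G)) λ L → IsWalk G v L v × (∀ e → cnt G e L ≡ ind (part G c i e))
    tour i = let (_ , connected , even) , _ = parts i in
      euler G (part G c i) v (λ w → even⇒odd?≡false (even w)) (λ e Se → connected v (end G e zero) (touched i) (e , Se , zero , refl))
    L : Fin 3 → List (Dart G)
    L i = proj₁ (tour i)
    odd : ∀ i → par G (L i) ≡ true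
    odd i = trans (par-cnt G (L i)) (trans (cong odd? (sumℕ-cong m (λ e → cong (_* ind (negative G e)) (proj₂ (proj₂ (tour i)) e)))) (odd⇒odd?≡true (proj₂ (parts i))))
    -- An odd closed tour with the value `a` has net outflow `2a` at `v`, so the three values have
    -- to sum to 0; 1, 1, -2 do so with absolute values below 3.
    a : Fin 3 → ℤ
    a zero             = 1ℤ
    a (suc zero)       = 1ℤ
    a (suc (suc zero)) = - (ℤ.+ 2)
    y : Fin 3 → Fin m → ℤ
    y i = along G (a i) (L i)
    x : Fin m → ℤ
    x e = y zero e ℤ.+ (y (suc zero) e ℤ.+ y (suc (suc zero)) e)
    net-y : ∀ i w → net G (y i) w ≡ at w v (a i) ℤ.+ at w v (a i)
    net-y i w = trans (net-along G w (a i) (L i) (proj₁ (proj₂ (tour i)))) (cong (λ b → at w v (a i) ℤ.+ at w v (turn b (a i))) (odd i))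
    flow : ∀ w → net G x w ≡ 0ℤ
    flow w = trans (net-+ G (y zero) _ w) (trans (cong₂ ℤ._+_ (net-y zero w) (trans (net-+ G (y (suc zero)) (y (suc (suc zero))) w)
               (cong₂ ℤ._+_ (net-y (suc zero) w) (net-y (suc (suc zero)) w)))) cancel)
      where
      cancel : (at w v 1ℤ ℤ.+ at w v 1ℤ) ℤ.+ ((at w v 1ℤ ℤ.+ at w v 1ℤ) ℤ.+ (at w v (- (ℤ.+ 2)) ℤ.+ at w v (- (ℤ.+ 2)))) ≡ 0ℤ
      cancel with does (v ≟ w)
      ... | true  = refl
      ... | false = refl
    on : ∀ i e → c e ≡ i → ∣ y i e ∣ ≡ ∣ a i ∣
    on i e eq = ∣along∣₁ G e (a i) (L i) (trans (proj₂ (proj₂ (tour i)) e) (trans (cong (λ j → ind (does (j ≟ i))) eq) (cong ind (≟-refl i))))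
    off : ∀ i e → c e ≢ i → y i e ≡ 0ℤ
    off i e ne = ∣along∣₀ G e (a i) (L i) (trans (proj₂ (proj₂ (tour i)) e) (cong ind (≟-false ne)))
    good : ∀ i {b} → ∣ b ∣ ≡ ∣ a i ∣ → b ≢ 0ℤ × ∣ b ∣ < 3
    good zero             p = (λ { refl → ℕ.0≢1+n p }) , subst (_< 3) (sym p) (s≤s (s≤s z≤n))
    good (suc zero)       p = (λ { refl → ℕ.0≢1+n p }) , subst (_< 3) (sym p) (s≤s (s≤s z≤n))
    good (suc (suc zero)) p = (λ { refl → ℕ.0≢1+n p }) , subst (_< 3) (sym p) ℕ.≤-refl
    sum₃ : ∀ i e → c e ≡ i → x e ≡ y i e
    sum₃ zero e eq = trans (cong₂ (λ s t → y zero e ℤ.+ (s ℤ.+ t)) (off (suc zero) e (λ q → case trans (sym eq) q of λ ())) (off (suc (suc zero)) e (λ q → case trans (sym eq) q of λ ()))) (ℤ.+-identityʳ (y zero e))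
    sum₃ (suc zero) e eq = trans (cong₂ (λ s t → s ℤ.+ (y (suc zero) e ℤ.+ t)) (off zero e (λ q → case trans (sym eq) q of λ ())) (off (suc (suc zero)) e (λ q → case trans (sym eq) q of λ ())))
                             (trans (ℤ.+-identityˡ _) (ℤ.+-identityʳ (y (suc zero) e)))
    sum₃ (suc (suc zero)) e eq = trans (cong₂ (λ s t → s ℤ.+ (t ℤ.+ y (suc (suc zero)) e)) (off zero e (λ q → case trans (sym eq) q of λ ())) (off (suc zero) e (λ q → case trans (sym eq) q of λ ())))
                             (trans (ℤ.+-identityˡ _) (ℤ.+-identityˡ (y (suc (suc zero)) e)))
    value : ∀ e → x e ≢ 0ℤ × ∣ x e ∣ < 3
    value e = good (c e) (trans (cong ∣_∣ (sum₃ (c e) e refl)) (on (c e) e refl))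

-- Obstructions to flows and the four statements

a+a≡0⇒a≡0 : ∀ a → a ℤ.+ a ≡ 0ℤ → a ≡ 0ℤ
a+a≡0⇒a≡0 (ℤ.+ zero) _ = refl

sumℤ-pos : ∀ m (f : Fin m → ℕ) → sumℤ m (λ i → ℤ.+ f i) ≡ ℤ.+ sumℕ m f
sumℤ-pos zero    f = refl
sumℤ-pos (suc m) f = cong (λ y → ℤ.+ f zero ℤ.+ y) (sumℤ-pos m (λ i → f (suc i)))

module _ {n m : ℕ} (G : SignedGraph n m) where

  kFlow-mono : ∀ {j k} → j ≤ k → HasNZkFlow G j → HasNZkFlow G k
  kFlow-mono j≤k (τ , ok , ξ , fl , nz , bd) = τ , ok , ξ , fl , nz , λ e → ℕ.<-≤-trans (bd e) j≤k

  kFlow⇒intFlow : ∀ {k} → HasNZkFlow G k → HasNZIntFlow G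
  kFlow⇒intFlow (τ , ok , ξ , fl , nz , _) = τ , ok , ξ , fl , nz

  -- Summed over all vertices, positive edges cancel and negative ones count twice, so the values on
  -- the negative edges sum to 0. All of these values are odd, hence their number is even.
  2-flow⇒even : HasNZkFlow G 2 → Even (negCount G allEdges)
  2-flow⇒even F with kFlow⇒ G F
  ... | x , fl , nz , bd = ∣ℤ.∣⇒∣ᵤ (subst (ℤ.+ 2 ∣ℤ_) count (sumℤ-∣ m odd))
    where
    f : Fin m → ℤ
    f e = if negative G e then x e else 0ℤ
    doubled : ∀ e → 1ℤ ℤ.* x e ℤ.+ 1ℤ ℤ.* turn (negative G e) (x e) ≡ f e ℤ.+ f e
    doubled e with negative G e
    ... | true  = cong₂ ℤ._+_ (ℤ.*-identityˡ (x e)) (ℤ.*-identityˡ (x e))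
    ... | false = trans (cong₂ ℤ._+_ (ℤ.*-identityˡ (x e)) (ℤ.*-identityˡ (- x e))) (ℤ.+-inverseʳ (x e))
    Σf≡0 : sumℤ m f ≡ 0ℤ
    Σf≡0 = a+a≡0⇒a≡0 _ (trans (sym (sumℤ-+ m f f)) (trans (sym (sumℤ-cong m doubled))
             (trans (sym (weighted-net G (λ _ → 1ℤ) x)) (trans (sumℤ-cong n (λ v → trans (ℤ.*-identityˡ (net G x v)) (fl v))) (sumℤ-0 n)))))
    g : Fin m → ℕ
    g e = 1 * ind (negative G e)
    unit-parity : ∀ a → a ≢ 0ℤ → ∣ a ∣ < 2 → ℤ.+ 2 ∣ℤ 1ℤ ℤ.- a
    unit-parity (ℤ.+ 0)      ne _ = ⊥-elim (ne refl)
    unit-parity (ℤ.+ 1)      _  _ = ∣ℤ.divides 0ℤ refl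
    unit-parity (ℤ.+ suc (suc _)) _ (s≤s (s≤s ()))
    unit-parity (ℤ.-[1+ 0 ]) _  _ = ∣ℤ.divides 1ℤ refl
    unit-parity (ℤ.-[1+ suc _ ]) _ (s≤s (s≤s ()))
    odd : ∀ e → ℤ.+ 2 ∣ℤ ℤ.+ g e ℤ.- f e
    odd e with negative G e
    ... | true  = unit-parity (x e) (nz e) (bd e)
    ... | false = ∣ℤ.divides 0ℤ refl
    h : Fin m → ℤ
    h e = ℤ.+ g e ℤ.- f e
    count : sumℤ m h ≡ ℤ.+ negCount G allEdges
    count = trans (sym (ℤ.+-identityʳ (sumℤ m h))) (trans (cong₂ ℤ._+_ (refl {x = sumℤ m h}) (sym Σf≡0)) (trans (sym (sumℤ-+ m h f))
              (trans (sumℤ-cong m (λ e → cancel (ℤ.+ g e) (f e))) (sumℤ-pos m g))))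
      where
      cancel : ∀ a b → (a ℤ.- b) ℤ.+ b ≡ a
      cancel = ℤS.solve-∀

  decomposition⇒odd : ThreeOddEulerianDecomposition G → odd? (negCount G allEdges) ≡ true
  decomposition⇒odd (c , parts , _) = trans (cong odd? split)
      (trans (odd?-+ (N zero) _) (cong₂ _xor_ (is-odd zero) (trans (odd?-+ (N (suc zero)) _) (cong₂ _xor_ (is-odd (suc zero)) (is-odd (suc (suc zero)))))))
    where
    N : Fin 3 → ℕ
    N i = negCount G (part G c i)
    is-odd : ∀ i → odd? (N i) ≡ true
    is-odd i = odd⇒odd?≡true (proj₂ (parts i))
    term : ∀ (i : Fin 3) k → 1 * k ≡ ind (does (i ≟ zero)) * k + (ind (does (i ≟ suc zero)) * k + ind (does (i ≟ suc (suc zero))) * k)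
    term zero             k = sym (ℕ.+-identityʳ (1 * k))
    term (suc zero)       k = sym (ℕ.+-identityʳ (1 * k))
    term (suc (suc zero)) k = refl
    split : negCount G allEdges ≡ N zero + (N (suc zero) + N (suc (suc zero)))
    split = trans (sumℕ-cong m (λ e → term (c e) (ind (negative G e))))
              (trans (sumℕ-+ m _ _) (cong (N zero +_) (sumℕ-+ m _ _)))

  -- Weighting the vertices by a potential of G - e leaves only the contribution ±2x(e) of e.
  exceptional-edge : ∀ e φ → (∀ f → f ≢ e → Consistent G φ f) → ¬ Consistent G φ e → ¬ HasNZIntFlow G
  exceptional-edge e φ ok bad F with intFlow⇒ G F
  ... | x , fl , nz = nz e (inconsistent (φ (end G e zero)) (φ (end G e (suc zero))) (negative G e) (x e) bad T≡0)
    where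
    T : Fin m → ℤ
    T f = sg (φ (end G f zero)) ℤ.* x f ℤ.+ sg (φ (end G f (suc zero))) ℤ.* turn (negative G f) (x f)
    lemma₁ : ∀ y → - 1ℤ ℤ.* y ℤ.+ - 1ℤ ℤ.* (- y) ≡ 0ℤ
    lemma₁ = ℤS.solve-∀
    lemma₂ : ∀ y → - 1ℤ ℤ.* y ℤ.+ 1ℤ ℤ.* y ≡ 0ℤ
    lemma₂ = ℤS.solve-∀
    lemma₃ : ∀ y → 1ℤ ℤ.* y ℤ.+ - 1ℤ ℤ.* y ≡ 0ℤ
    lemma₃ = ℤS.solve-∀
    lemma₄ : ∀ y → 1ℤ ℤ.* y ℤ.+ 1ℤ ℤ.* (- y) ≡ 0ℤ
    lemma₄ = ℤS.solve-∀
    consistent : ∀ a b ν y → ν ≡ a xor b → sg a ℤ.* y ℤ.+ sg b ℤ.* turn ν y ≡ 0ℤ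
    consistent true  true  _ y refl = lemma₁ y
    consistent true  false _ y refl = lemma₂ y
    consistent false true  _ y refl = lemma₃ y
    consistent false false _ y refl = lemma₄ y
    double₁ : ∀ y → - 1ℤ ℤ.* y ℤ.+ - 1ℤ ℤ.* y ≡ - (y ℤ.+ y)
    double₁ = ℤS.solve-∀
    double₂ : ∀ y → - 1ℤ ℤ.* y ℤ.+ 1ℤ ℤ.* (- y) ≡ - (y ℤ.+ y)
    double₂ = ℤS.solve-∀
    double₃ : ∀ y → 1ℤ ℤ.* y ℤ.+ - 1ℤ ℤ.* (- y) ≡ y ℤ.+ y
    double₃ = ℤS.solve-∀
    double₄ : ∀ y → 1ℤ ℤ.* y ℤ.+ 1ℤ ℤ.* y ≡ y ℤ.+ y
    double₄ = ℤS.solve-∀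
    inconsistent : ∀ a b ν y → ν ≢ a xor b → sg a ℤ.* y ℤ.+ sg b ℤ.* turn ν y ≡ 0ℤ → y ≡ 0ℤ
    inconsistent true  true  true  y _ eq = a+a≡0⇒a≡0 y (ℤ.neg-injective (trans (sym (double₁ y)) eq))
    inconsistent true  false false y _ eq = a+a≡0⇒a≡0 y (ℤ.neg-injective (trans (sym (double₂ y)) eq))
    inconsistent false true  false y _ eq = a+a≡0⇒a≡0 y (trans (sym (double₃ y)) eq)
    inconsistent false false true  y _ eq = a+a≡0⇒a≡0 y (trans (sym (double₄ y)) eq)
    inconsistent true  true  false y ne _ = ⊥-elim (ne refl)
    inconsistent true  false true  y ne _ = ⊥-elim (ne refl)
    inconsistent false true  true  y ne _ = ⊥-elim (ne refl)
    inconsistent false false false y ne _ = ⊥-elim (ne refl)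
    only : ∀ f → T f ≡ (if does (e ≟ f) then T f else 0ℤ)
    only f with e ≟ f
    ... | yes _   = refl
    ... | no  e≢f = consistent (φ (end G f zero)) (φ (end G f (suc zero))) (negative G f) (x f) (ok f (λ eq → e≢f (sym eq)))
    T≡0 : T e ≡ 0ℤ
    T≡0 = trans (sym (sumℤ-δ e T)) (trans (sym (sumℤ-cong m only)) (trans (sym (weighted-net G (λ v → sg (φ v)) x))
            (trans (sumℤ-cong n (λ v → trans (cong (sg (φ v) ℤ.*_) (fl v)) (ℤ.*-zeroʳ (sg (φ v))))) (sumℤ-0 n))))

  module _ (eulerian : Eulerian G) where

    evenAll : EvenSet G allEdges
    evenAll v = even⇒odd?≡false (proj₂ eulerian v)

    eulerTour : ∀ r → Σ (List (Dart G)) λ L → IsWalk G r L r × (∀ e → cnt G e L ≡ 1) × par G L ≡ odd? (negCount G allEdges)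
    eulerTour r with euler G allEdges r evenAll (λ e _ → proj₁ eulerian r (end G e zero))
    ... | L , w , once = L , w , once , trans (par-cnt G L) (cong odd? (sumℕ-cong m (λ e → cong (_* ind (negative G e)) (once e))))

    even⇒2-flow : Fin n → odd? (negCount G allEdges) ≡ false → HasNZkFlow G 2
    even⇒2-flow r even with eulerTour r
    ... | L , w , once , sign = ⇒kFlow G (along G 1ℤ L) flow
        (λ e eq → ℕ.0≢1+n (trans (sym (cong ∣_∣ eq)) (∣along∣₁ G e 1ℤ L (once e)))) (λ e → s≤s (ℕ.≤-reflexive (∣along∣₁ G e 1ℤ L (once e))))
      where
      flow : ∀ v → net G (along G 1ℤ L) v ≡ 0ℤ
      flow v = trans (net-along G v 1ℤ L w) (trans (cong (λ b → at v r 1ℤ ℤ.+ at v r (turn b 1ℤ)) (trans sign even))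
                 (trans (cong₂ ℤ._+_ (refl {x = at v r 1ℤ}) (at-neg v r 1ℤ)) (ℤ.+-inverseʳ (at v r 1ℤ))))

    3-flow⇒decomposition : Fin n → odd? (negCount G allEdges) ≡ true → HasNZkFlow G 3 → ThreeOddEulerianDecomposition G
    3-flow⇒decomposition r odd F with eulerTour r | kFlow⇒ G F
    ... | L , w , once , sign | x , fl , nz , bd = arcs⇒decomposition G once (proj₂ (threeArcs G x fl nz bd L w once (trans sign odd)))

    4-flow-or-exceptional : Fin n → odd? (negCount G allEdges) ≡ true →
      HasNZkFlow G 4 ⊎ Σ (Fin m) λ e → Σ (Fin n → Bool) λ φ → ∀ f → f ≢ e → Consistent G φ f
    4-flow-or-exceptional r odd with eulerTour r
    ... | L , w , once , sign = odd-tour G L w once (trans sign odd)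

    -- Under a potential every even edge set, in particular the set of all edges, would have an even
    -- number of negative edges.
    odd⇒unbalanced : odd? (negCount G allEdges) ≡ true → ¬ Balanced G
    odd⇒unbalanced odd bal with balanced⇒potential G bal
    ... | φ , pot with () ← trans (sym odd) (potential⇒even G φ pot allEdges evenAll)

    exceptional⇒inconsistent : odd? (negCount G allEdges) ≡ true → ∀ e φ → (∀ f → f ≢ e → Consistent G φ f) → ¬ Consistent G φ e
    exceptional⇒inconsistent odd e φ ok con = odd⇒unbalanced odd (potential⇒balanced G φ pot)
      where
      pot : Potential G φ
      pot f with f ≟ e
      ... | yes refl = con
      ... | no  f≢e  = ok f f≢e

mainTheorem1 : ∀ {n m : ℕ} (G : SignedGraph n (suc m)) → Eulerian G →
    ((¬ HasNZIntFlow G) ⇔ ((¬ Balanced G) × Σ (Fin (suc m)) (λ e → Balanced (deleteEdge G e))))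
    × (FlowNumberIs G 2 ⇔ Even (negCount G allEdges))
    × (FlowNumberIs G 3 ⇔ ThreeOddEulerianDecomposition G)
    × (HasNZIntFlow G → ¬ Even (negCount G allEdges) → ¬ ThreeOddEulerianDecomposition G → FlowNumberIs G 4)
mainTheorem1 {n} {m} G eulerian =
  mk⇔ noFlow⇒ (λ (unbal , e , bal) → ⇒noFlow unbal e bal) ,
  mk⇔ (λ (F , _) → 2-flow⇒even G F) (λ even → even⇒2-flow G eulerian r (even⇒odd?≡false even) , below-2) ,
  mk⇔ (λ (F , least) → 3-flow⇒decomposition G eulerian r (no-2-flow⇒odd (least 2 (s≤s (s≤s (s≤s z≤n))))) F)
      (λ D → decomposition⇒3-flow G D , below-3 (odd?≡true⇒odd (decomposition⇒odd G D))) ,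
  flow-4
  where
  -- The graph has at least one edge; an end of it serves as the base of the Euler tours.
  r : Fin n
  r = end G zero zero

  below-2 : ∀ j → j < 2 → ¬ HasNZkFlow G j
  below-2 j (s≤s j≤1) F with kFlow-mono G j≤1 F
  ... | τ , ok , ξ , fl , nz , bd = nz zero (ℤ.∣i∣≡0⇒i≡0 (ℕ.n<1⇒n≡0 (bd zero)))

  below-3 : Odd (negCount G allEdges) → ∀ j → j < 3 → ¬ HasNZkFlow G j
  below-3 odd j (s≤s j≤2) F = odd (2-flow⇒even G (kFlow-mono G j≤2 F))

  no-2-flow⇒odd : ¬ HasNZkFlow G 2 → odd? (negCount G allEdges) ≡ true
  no-2-flow⇒odd none with odd? (negCount G allEdges) in eq
  ... | true  = refl
  ... | false = ⊥-elim (none (even⇒2-flow G eulerian r eq))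

  -- The absence of a 2-flow makes the sign odd, and the absence of a 4-flow then leaves the edge in
  -- no balanced arc, whose potential balances the rest.
  noFlow⇒ : ¬ HasNZIntFlow G → (¬ Balanced G) × Σ (Fin (suc m)) (λ e → Balanced (deleteEdge G e))
  noFlow⇒ noFlow with no-2-flow⇒odd (λ F → noFlow (kFlow⇒intFlow G F))
  ... | odd with 4-flow-or-exceptional G eulerian r odd
  ... | inj₁ F            = ⊥-elim (noFlow (kFlow⇒intFlow G F))
  ... | inj₂ (e , φ , ok) = odd⇒unbalanced G eulerian odd , e ,
          potential⇒balanced (deleteEdge G e) φ (λ f → ok (punchIn e f) (punchInᵢ≢i e f))

  ⇒noFlow : ¬ Balanced G → ∀ e → Balanced (deleteEdge G e) → ¬ HasNZIntFlow G
  ⇒noFlow unbal e bal with balanced⇒potential (deleteEdge G e) bal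
  ... | φ , pot = exceptional-edge G e φ ok inconsistent
    where
    ok : ∀ f → f ≢ e → Consistent G φ f
    ok f f≢e = subst (Consistent G φ) (punchIn-punchOut (λ eq → f≢e (sym eq))) (pot (punchOut (λ eq → f≢e (sym eq))))
    inconsistent : ¬ Consistent G φ e
    inconsistent con = unbal (potential⇒balanced G φ full)
      where
      full : Potential G φ
      full f with f ≟ e
      ... | yes refl = con
      ... | no  f≢e  = ok f f≢e

  flow-4 : HasNZIntFlow G → ¬ Even (negCount G allEdges) → ¬ ThreeOddEulerianDecomposition G → FlowNumberIs G 4
  flow-4 F odd noDecomposition = four (4-flow-or-exceptional G eulerian r odd′) , least
    where
    odd′ : odd? (negCount G allEdges) ≡ true
    odd′ = odd⇒odd?≡true odd
    four : _ → HasNZkFlow G 4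
    four (inj₁ F₄)           = F₄
    four (inj₂ (e , φ , ok)) = ⊥-elim (exceptional-edge G e φ ok (exceptional⇒inconsistent G eulerian odd′ e φ ok) F)
    least : ∀ j → j < 4 → ¬ HasNZkFlow G j
    least j (s≤s j≤3) F = noDecomposition (3-flow⇒decomposition G eulerian r odd′ (kFlow-mono G j≤3 F))
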